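{- For every integer $k\ge2$, the polynomial $\widetilde{\Delta}_{3k,3}(C)$ has no roots in $\mathbb{Q}^{\mathrm{ab}}$, the maximal abelian extension of $\mathbb{Q}$.
   Context: Let $f_c(z)=z^2+c$, with iterates $f_c^{\circ 0}(z)=z$, $f_c^{\circ j}=f_c\circ f_c^{\circ(j-1)}$. For $n\ge1$ let $\Phi_n^*(z,c)=\prod_{j\mid n}(f_c^{\circ j}(z)-z)^{\mu(n/j)}$, and let $\delta_n(x,c)$ be the polynomial, monic in $x$, with $\delta_n(x,c)^n=\operatorname{Res}_z(\Phi_n^*(z,c),x-(f_c^{\circ n})'(z))$ (it lies in $\mathbb{Z}[x,4c]$ and is monic in $4c$). Let $\Psi_j$ be the $j$-th cyclotomic polynomial. For $m\mid n$, $m<n$, set $\Delta_{n,m}(c)=\operatorname{Res}_x(\Psi_{n/m}(x),\delta_m(x,c))$ and $\widetilde{\Delta}_{n,m}(C)=\Delta_{n,m}(C/4)\in\mathbb{Z}[C]$. Explicitly $\delta_3(x,C/4)=x^2-(2C+16)x+(C^3+8C^2+16C+64)$, so $\widetilde\Delta_{3k,3}(C)=\operatorname{Res}_x(\Psi_k(x),x^2-(2C+16)x+C^3+8C^2+16C+64)$. -}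

module Defs where

open import Algebra.Apartness using (HeytingCommutativeRing; HeytingField)
open import Algebra.Bundles using (CommutativeRing; RawRing)
import Algebra.Definitions.RawSemiring as RawSemiringDefinitions
open import Algebra.Morphism.Structures using (module RingMorphisms)
open import Data.Bool.Base using (if_then_else_)
open import Data.Fin.Base using (Fin; zero; suc; opposite; punchIn; splitAt; toℕ)
open import Data.Integer.Base as ℤ using (ℤ; +_; 0ℤ; 1ℤ; -1ℤ)
import Data.Integer.Properties as ℤₚ
open import Data.List.Base using (List; []; _∷_; filter; foldr; length; map; replicate; upTo; _++_)
open import Data.List.Relation.Unary.Any using (any?)
open import Data.Nat.Base as ℕ using (ℕ; zero; suc; NonZero)
open import Data.Nat.Divisibility using (_∣?_)
open import Data.Nat.DivMod using (_/_)
open import Data.Nat.Primality using (prime?)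
open import Data.Product.Base using (∃; ∃-syntax; _×_)
open import Data.Rational.Base as ℚ using (ℚ)
open import Data.Sum.Base using ([_,_]′)
open import Function.Base using (_∘_)
open import Level using (Level; _⊔_) renaming (suc to lsuc)
open import Relation.Binary.PropositionalEquality.Core using (_≡_)
open import Relation.Nullary.Decidable using (does; _×-dec_)
open import Relation.Nullary.Negation using (¬_)

private
  variable
    a ℓ c ℓ₁ ℓ₂ : Level

------------------------------------------------------------------------
-- Determinants and polynomials over a ring.  Only the raw operations are
-- needed to define these, so that the constructions can be iterated
-- without first proving that polynomials form a ring.

module Determinant (R : RawRing a ℓ) where
  open RawRing R
  open RawSemiringDefinitions rawSemiring using (sum; _^_)

  -- Laplace expansion along the first row.
  det : ∀ {n} → (Fin n → Fin n → Carrier) → Carrier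
  det {zero}  M = 1#
  det {suc n} M = sum λ j →
    ((- 1#) ^ toℕ j) * (M zero j * det λ r s → M (suc r) (punchIn j s))

module Polynomial (R : RawRing a ℓ) where
  open RawRing R
  open RawSemiringDefinitions rawSemiring using () renaming (_×_ to _·_)
  open Determinant R using (det)

  -- Coefficients in order of increasing degree.  Trailing zeros are
  -- allowed; polynomials are compared by _≈ₚ_ below.
  Poly : Set a
  Poly = List Carrier

  coeff : Poly → ℕ → Carrier
  coeff []      _       = 0#
  coeff (x ∷ _) zero    = x
  coeff (_ ∷ p) (suc i) = coeff p i

  infix 4 _≈ₚ_
  _≈ₚ_ : Poly → Poly → Set ℓ
  p ≈ₚ q = ∀ i → coeff p i ≈ coeff q i

  infixl 6 _+ₚ_
  _+ₚ_ : Poly → Poly → Poly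
  []      +ₚ q       = q
  (x ∷ p) +ₚ []      = x ∷ p
  (x ∷ p) +ₚ (y ∷ q) = (x + y) ∷ (p +ₚ q)

  infixl 7 _*ₚ_
  _*ₚ_ : Poly → Poly → Poly
  []      *ₚ q = []
  (x ∷ p) *ₚ q = map (x *_) q +ₚ (0# ∷ (p *ₚ q))

  const : Carrier → Poly
  const x = x ∷ []

  X : Poly
  X = 0# ∷ 1# ∷ []

  rawRing : RawRing a ℓ
  rawRing = record
    { Carrier = Poly
    ; _≈_     = _≈ₚ_
    ; _+_     = _+ₚ_
    ; _*_     = _*ₚ_
    ; -_      = map -_
    ; 0#      = []
    ; 1#      = const 1#
    }

  eval : Poly → Carrier → Carrier
  eval p x = foldr (λ b r → b + x * r) 0# p

  -- The coefficients of p multiplied by i, i + 1, i + 2, …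
  weighted : ℕ → Poly → Poly
  weighted i []      = []
  weighted i (x ∷ p) = (i · x) ∷ weighted (suc i) p

  derivative : Poly → Poly
  derivative []      = []
  derivative (_ ∷ p) = weighted 1 p

  HasDegree : Poly → ℕ → Set ℓ
  HasDegree p d = ¬ (coeff p d ≈ 0#) × (∀ i → d ℕ.< i → coeff p i ≈ 0#)

  Monic : Poly → Set ℓ
  Monic p = ∃[ d ] coeff p d ≈ 1# × (∀ i → d ℕ.< i → coeff p i ≈ 0#)

  -- Xᵉp
  shift : ℕ → Poly → Poly
  shift e p = replicate e 0# ++ p

  -- The matrix of p (of degree m) and q (of degree n): the rows are the
  -- coefficients, highest degree first, of
  -- Xⁿ⁻¹p, …, Xp, p, Xᵐ⁻¹q, …, Xq, q.
  sylvester : ∀ m n → Poly → Poly → Fin (n ℕ.+ m) → Fin (n ℕ.+ m) → Carrier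
  sylvester m n p q i j = coeff
    ([ (λ r → shift (toℕ (opposite r)) p) , (λ r → shift (toℕ (opposite r)) q) ]′
      (splitAt n i))
    (toℕ (opposite j))

  -- r = Res(p, q).  A relation, since the degrees of p and q cannot be
  -- computed when equality of coefficients is not known to be decidable.
  IsResultant : Poly → Poly → Carrier → Set ℓ
  IsResultant p q r =
    ∃[ m ] ∃[ n ] HasDegree p m × HasDegree q n × r ≈ det (sylvester m n p q)

------------------------------------------------------------------------
-- Arithmetic functions and products over divisors

-- Only meaningful for n ≥ 1.
μ : ℕ → ℤ
μ n = if does (any? (λ d → (2 ℕ.+ d) ℕ.* (2 ℕ.+ d) ∣? n) (upTo n))
      then 0ℤ
      else -1ℤ ℤ.^ length (filter (λ p → prime? p ×-dec (p ∣? n)) (upTo (suc n)))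

module DivisorProducts (R : RawRing a ℓ) where
  open RawRing R

  ∏ : List Carrier → Carrier
  ∏ = foldr _*_ 1#

  -- ∏_{j ∣ n} F j
  ∏∣ : ℕ → (ℕ → Carrier) → Carrier
  ∏∣ n F = ∏ (map F (filter (_∣? n) (map suc (upTo n))))

  -- ∏_{j ∣ n, μ(n/j) = ε} F j, where j = suc i
  ∏∣μ : ℤ → ℕ → (ℕ → Carrier) → Carrier
  ∏∣μ ε n F = ∏ (map (F ∘ suc)
    (filter (λ i → (suc i ∣? n) ×-dec (μ (n / suc i) ℤₚ.≟ ε)) (upTo n)))

  -- P = ∏_{j ∣ n} (F j)^μ(n/j), with the factors of exponent -1 moved to
  -- the left-hand side.
  IsMöbiusProduct : ℕ → (ℕ → Carrier) → Carrier → Set ℓ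
  IsMöbiusProduct n F P = P * ∏∣μ -1ℤ n F ≈ ∏∣μ 1ℤ n F

------------------------------------------------------------------------
-- The polynomial rings in use.  ℤ[c] and ℤ[c][z] are also used with other
-- names for the variables: ℤ[x] and ℤ[C] are ℤ[c], and ℤ[c][x] is ℤ[c][z].

ℤ-rawRing ℤ[c] ℤ[c][z] : RawRing _ _
ℤ-rawRing = ℤ.+-*-rawRing
ℤ[c]      = Polynomial.rawRing ℤ-rawRing
ℤ[c][z]   = Polynomial.rawRing ℤ[c]

module Pℤ       = Polynomial ℤ-rawRing
module Pℤ[c]    = Polynomial ℤ[c]
module Pℤ[c][x] = Polynomial ℤ[c][z]

module Rℤ[c]    = RawRing ℤ[c]
module Rℤ[c][z] = RawRing ℤ[c][z]

open RawSemiringDefinitions Rℤ[c].rawSemiring    using () renaming (_^_ to _^ᶜ_)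
open RawSemiringDefinitions Rℤ[c][z].rawSemiring using () renaming (_^_ to _^ˣ_)

------------------------------------------------------------------------
-- Cyclotomic polynomials

-- The family of all cyclotomic polynomials is determined by
-- ∏_{d ∣ n} Ψ_d(x) = xⁿ - 1 for all n ≥ 1.
IsCyclotomicFamily : (ℕ → Pℤ.Poly) → Set
IsCyclotomicFamily Ψ = ∀ n → .{{_ : NonZero n}} →
  DivisorProducts.∏∣ ℤ[c] n Ψ Rℤ[c].≈ (Pℤ.X ^ᶜ n) Rℤ[c].+ (Rℤ[c].- Rℤ[c].1#)

------------------------------------------------------------------------
-- Dynamics of f_c(z) = z² + c

-- f_c^{∘j}(z) ∈ ℤ[c][z]
iterate-f : ℕ → Pℤ[c].Poly
iterate-f zero    = Pℤ[c].X
iterate-f (suc j) = (iterate-f j Rℤ[c][z].* iterate-f j) Rℤ[c][z].+ Pℤ[c].const Pℤ.X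

-- Φ = Φ*_n
IsDynatomic : ℕ → Pℤ[c].Poly → Set
IsDynatomic n Φ = DivisorProducts.IsMöbiusProduct ℤ[c][z] n
  (λ j → iterate-f j Rℤ[c][z].+ (Rℤ[c][z].- Pℤ[c].X)) Φ

-- δ = δ_n ∈ ℤ[c][x].  The resultant is taken in ℤ[c][x][z], in which
-- elements of ℤ[c][z] are viewed by making their coefficients constant in x.
IsMultiplierPolynomial : ℕ → Pℤ[c].Poly → Set
IsMultiplierPolynomial n δ = Pℤ[c].Monic δ ×
  ∃[ Φ ] IsDynatomic n Φ ×
    Pℤ[c][x].IsResultant
      (map Pℤ[c].const Φ)
      (Pℤ[c][x].const Pℤ[c].X Pℤ[c][x].+ₚ
        map (Rℤ[c][z].-_ ∘ Pℤ[c].const) (Pℤ[c].derivative (iterate-f n)))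
      (δ ^ˣ n)

-- Δ = Δ_{n,m} ∈ ℤ[c], for m ∣ n and m < n.
IsΔ : (n m : ℕ) → .{{_ : NonZero m}} → Pℤ.Poly → Set
IsΔ n m Δ = ∃[ Ψ ] ∃[ δ ] IsCyclotomicFamily Ψ × IsMultiplierPolynomial m δ ×
  Pℤ[c].IsResultant (map Pℤ.const (Ψ (n / m))) δ Δ

-- Δ̃(C) = Δ_{n,m}(C/4) in ℤ[C], written as Δ̃(4c) = Δ_{n,m}(c).
IsΔ̃ : (n m : ℕ) → .{{_ : NonZero m}} → Pℤ.Poly → Set
IsΔ̃ n m Δ̃ = ∃[ Δ ] IsΔ n m Δ ×
  (∀ i → Pℤ.coeff Δ i ≡ ((+ 4) ℤ.^ i) ℤ.* Pℤ.coeff Δ̃ i)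

------------------------------------------------------------------------
-- Extensions of ℚ

record Extension c ℓ₁ ℓ₂ : Set (lsuc (c ⊔ ℓ₁ ⊔ ℓ₂)) where
  field
    field′ : HeytingField c ℓ₁ ℓ₂

  open HeytingField field′ public using (Carrier; _≈_; 0#; heytingCommutativeRing)

  rawRing : RawRing c ℓ₁
  rawRing = CommutativeRing.rawRing
    (HeytingCommutativeRing.commutativeRing heytingCommutativeRing)

  field
    ι      : ℚ → Carrier
    ι-homo : RingMorphisms.IsRingHomomorphism ℚ.+-*-rawRing rawRing ι

record Embedding {c ℓ₁ ℓ₂} (K L : Extension c ℓ₁ ℓ₂) : Set (c ⊔ ℓ₁) where
  private
    module K = Extension K
    module L = Extension L
  field
    ⟦_⟧   : K.Carrier → L.Carrier
    homo  : RingMorphisms.IsRingHomomorphism K.rawRing L.rawRing ⟦_⟧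
    fixes : ∀ q → ⟦ K.ι q ⟧ L.≈ L.ι q

record Automorphism (L : Extension c ℓ₁ ℓ₂) : Set (c ⊔ ℓ₁) where
  open Extension L
  field
    ⟦_⟧   : Carrier → Carrier
    iso   : RingMorphisms.IsRingIsomorphism rawRing rawRing ⟦_⟧
    fixes : ∀ q → ⟦ ι q ⟧ ≈ ι q

open Automorphism using (⟦_⟧)

module _ (L : Extension c ℓ₁ ℓ₂) where
  open Extension L
  private
    module Pℚ = Polynomial ℚ.+-*-rawRing
    module PL = Polynomial rawRing

  IsAlgebraic : Set (c ⊔ ℓ₁)
  IsAlgebraic = ∀ x → ∃[ p ] ¬ (p Pℚ.≈ₚ []) × PL.eval (map ι p) x ≈ 0#

  -- Algebraic, with ℚ as the fixed field of all automorphisms.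
  IsGalois : Set (c ⊔ ℓ₁)
  IsGalois = IsAlgebraic ×
    (∀ x → (∀ (σ : Automorphism L) → ⟦ σ ⟧ x ≈ x) → ∃[ q ] x ≈ ι q)

  IsAbelian : Set (c ⊔ ℓ₁)
  IsAbelian = IsGalois ×
    (∀ (σ τ : Automorphism L) x → ⟦ σ ⟧ (⟦ τ ⟧ x) ≈ ⟦ τ ⟧ (⟦ σ ⟧ x))

  HasRoot : Pℤ.Poly → Set (c ⊔ ℓ₁)
  HasRoot p = ∃[ α ] PL.eval (map (λ i → ι (i ℚ./ 1)) p) α ≈ 0#

-- L is a model of ℚᵃᵇ: it is abelian over ℚ and contains a copy of every
-- abelian extension of ℚ.  This determines L up to isomorphism.
IsMaximalAbelian : Extension c ℓ₁ ℓ₂ → Set (lsuc (c ⊔ ℓ₁ ⊔ ℓ₂))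
IsMaximalAbelian {c} {ℓ₁} {ℓ₂} L =
  IsAbelian L × (∀ (K : Extension c ℓ₁ ℓ₂) → IsAbelian K → Embedding K L)

{-# OPTIONS --safe #-}
module Submission where

-- Everything below a negation may use excluded middle, so ℚᵃᵇ can be treated as a classical field.
--
-- Let C be a root.  Then Ψₖ(x) and Q(x) = x² - (2C + 16)x + C³ + 8C² + 16C + 64 have a common factor over
-- ℚᵃᵇ.  If it is Q itself, then both roots ζ₁, ζ₂ of Q are roots of unity and γ = C + 8 is their midpoint;
-- now 1 - 2γ/ζ₁ = - ζ₂/ζ₁ is a root of unity with γ/ζ₁ integral, hence ± 1, so γ = 0 or γ = ζ₁, and both
-- are impossible.  Thus Q has a root ζ ≠ 1 in ℚᵃᵇ with ζᵏ = 1.  The substitution s = (ζ - C - 8)/C turns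
-- Q(ζ) = 0 into s³ + s² + 7s = 1 - ζ.
--
-- Complex conjugation J commutes with every automorphism of ℚᵃᵇ.  The condition |1 - 7s - s² - s³| = 1
-- forces - 1/4 ≤ T² + T ≤ 15/16 for T = s + Js, and the same holds for every conjugate.  So the norm of the
-- algebraic integer T² + T is an integer of absolute value < 1, and T = 0 or T = - 1.  Let N = s · Js.
-- If T = 0, then N(2 + N + (7 - N)²) = 0, contrary to N > 0.  If T = - 1, then N² - 7N - 1 = 0, whose roots
-- are irrational and have product - 1, contrary to N > 0 for every conjugate of N.
--
-- There is no embedding into ℂ at hand.  Instead J is an automorphism with Jζ = ζ⁻¹ that is an involution
-- on ℚ(ζ, s), and positive elements are the sums of elements y · Jy with y in ℚ(ζ, s).  That - 1 is not such
-- a sum follows from Parseval's identity for ℚ(ζ), and is inherited by extensions of degree 3 as in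
-- Springer's theorem.

open import Algebra.Apartness using (HeytingCommutativeRing; HeytingField)
open import Algebra.Bundles using (CommutativeRing; RawRing)
open import Algebra.Morphism.Structures using (module RingMorphisms)
open import Data.Empty using (⊥; ⊥-elim)
open import Data.Bool.Base using (if_then_else_)
open import Data.Fin.Base as Fin using (Fin; zero; suc; toℕ; opposite; splitAt; _↑ˡ_; _↑ʳ_; punchIn; punchOut; inject₁; fromℕ<)
open import Data.Fin.Patterns using (0F; 1F; 2F)
open import Data.Fin.Properties as Finₚ using (punchIn-punchOut; punchInᵢ≢i; punchIn-injective; splitAt-↑ˡ; splitAt-↑ʳ;
  opposite-involutive; toℕ-inject₁; toℕ-fromℕ; toℕ-fromℕ<; join-splitAt)
open import Data.Integer.Base as ℤ using (ℤ; +_; -[1+_])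
import Data.Integer.Properties as ℤₚ
open import Data.Integer.Tactic.RingSolver using (solve-∀)
open import Data.List.Base using (List; []; _∷_; _∷ʳ_; _++_; map; length; replicate; initLast; _∷ʳ′_; filter; upTo; applyUpTo)
import Data.List.Properties as Listₚ
open import Data.List.Relation.Unary.All as All using (All; []; _∷_)
open import Data.Maybe.Base using (Maybe; just; nothing)
open import Data.Nat.Base as ℕ using (ℕ; zero; suc; _≤_; _<_; z≤n; s≤s)
open import Data.Nat.Coprimality as Coprimality using (coprime-Bézout; recompute)
open import Data.Nat.DivMod using (m*n/n≡m)
open import Data.Nat.GCD using (module Bézout)
import Data.Nat.Properties as ℕₚ
open import Data.Product.Base using (∃-syntax; Σ; _×_; _,_; proj₁; proj₂)
open import Data.Rational.Base as ℚ using (ℚ; mkℚ; 0ℚ; 1ℚ)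
import Data.Rational.Properties as ℚₚ
open import Data.Rational.Unnormalised.Base as ℚᵘ using (mkℚᵘ; *≡*)
import Data.Rational.Unnormalised.Properties as ℚᵘₚ
open import Data.Sum.Base using (_⊎_; inj₁; inj₂; [_,_]′)
open import Function.Base using (_∘_)
open import Level as Level using (Level; _⊔_) renaming (suc to lsuc)
open import Relation.Binary.Definitions using (Decidable; tri<; tri≈; tri>)
open import Relation.Binary.PropositionalEquality as ≡ using (_≡_; _≢_)
open import Relation.Nullary.Decidable using (Dec; yes; no; does; toWitness; decidable-stable; ¬¬-excluded-middle)
open import Relation.Nullary.Negation using (¬_; contradiction)
open import Defs

open import Algebra.Definitions.RawSemiring Rℤ[c].rawSemiring using () renaming (_^_ to _^ᶜ_)
open import Algebra.Definitions.RawSemiring Rℤ[c][z].rawSemiring using () renaming (_^_ to _^ˣ_)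

-- A quarter of the discriminant of Q is (C + 8)² - (C³ + 8C² + 16C + 64) = C²(- C - 7), so s is a
-- square root of - C - 7. Eliminating C = - 7 - s² from ζ = C + 8 + C s leaves the cubic in s. The
-- division by C is legitimate because C = 0 would give ζ = 8. Under an embedding T is twice the
-- real part of s. The bounds on T² + T both have absolute value below 1, the lower one for every
-- real T, and they pass to all conjugates because automorphisms commute with J. The main obstacle
-- is J itself. Automorphisms are supplied only by the hypothesis that their fixed field is ℚ, and
-- one that sends ζ to ζ⁻¹ may fail to be an involution on ℚ(ζ, s). By commutativity either some
-- root of the cubic already lies in ℚ(ζ), or ℚ(ζ, s) is cyclic of degree 3 over ℚ(ζ). In the second
-- case the oddness of 3 is used twice: the cube of such an automorphism is an involution, and - 1
-- cannot become a sum of norms in an extension of odd degree.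

private
  variable
    ℓᵃ ℓᵇ c ℓ r₁ ℓ₁ r₂ ℓ₂ r₃ ℓ₃ : Level
    A : Set ℓᵃ
    B : Set ℓᵇ
    n : ℕ

-- Classical reasoning under a double negation

infixl 1 _>>=_
_>>=_ : ¬ ¬ A → (A → ¬ ¬ B) → ¬ ¬ B
(m >>= f) k = m λ x → f x k

return : A → ¬ ¬ A
return x k = k x

em : ¬ ¬ Dec A
em = ¬¬-excluded-middle

¬¬-finite-choice : ∀ {n} {P : Fin n → Set ℓᵃ} → (∀ i → ¬ ¬ P i) → ¬ ¬ (∀ i → P i)
¬¬-finite-choice {n = zero}  f = return λ ()
¬¬-finite-choice {n = suc n} f =
  f zero >>= λ p₀ → ¬¬-finite-choice (λ i → f (suc i)) >>= λ p →
  return λ { zero → p₀ ; (suc i) → p i }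

least : (P : ℕ → Set ℓᵃ) → ∀ n → P n → ¬ ¬ (∃[ m ] P m × (∀ k → k ℕ.< m → ¬ P k))
least P n p = go n n ℕₚ.≤-refl p
  where
  go : ∀ bound n → n ≤ bound → P n → ¬ ¬ (∃[ m ] P m × (∀ k → k ℕ.< m → ¬ P k))
  go zero        n n≤ p = return (n , p , λ k k<n → contradiction (ℕₚ.<-≤-trans k<n n≤) λ ())
  go (suc bound) n n≤ p = em {A = ∃[ k ] k ℕ.< n × P k} >>= λ where
    (no none)          → return (n , p , λ k k<n q → none (k , k<n , q))
    (yes (k , k<n , q)) → go bound k (ℕ.s≤s⁻¹ (ℕₚ.≤-trans k<n n≤)) q

-- Integers in a commutative ring, and ring homomorphisms

module FromIntegers (R : CommutativeRing c ℓ) where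
  open CommutativeRing R
  open import Algebra.Definitions.RawSemiring (RawRing.rawSemiring rawRing) using (_×′_) public
  open import Algebra.Properties.Semiring.Mult.TCOptimised semiring
    using (×-homo-+; ×1-homo-*; 1+×)
  open import Algebra.Properties.Ring ring using (-0#≈0#; -‿distribˡ-*; -‿distribʳ-*)
  open import Algebra.Properties.AbelianGroup +-abelianGroup using (⁻¹-∙-comm; ⁻¹-involutive)
  open import Relation.Binary.Reasoning.Setoid setoid

  -- With the optimised multiple `×′` the term `fromℤ (+ 1)` reduces to `1#`, so that `con (+ 1)` in
  -- a solver expression denotes `1#` definitionally.
  fromℤ : ℤ → Carrier
  fromℤ (+ n)      = n ×′ 1#
  fromℤ (-[1+ n ]) = - (suc n ×′ 1#)

  fromℤ-⊖ : ∀ m n → fromℤ (m ℤ.⊖ n) ≈ m ×′ 1# - n ×′ 1#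
  fromℤ-⊖ zero zero = sym (-‿inverseʳ 0#)
  fromℤ-⊖ zero (suc n) = sym (+-identityˡ _)
  fromℤ-⊖ (suc m) zero = sym (trans (+-congˡ -0#≈0#) (+-identityʳ _))
  fromℤ-⊖ (suc m) (suc n) = begin
    fromℤ (suc m ℤ.⊖ suc n)                      ≡⟨ ≡.cong fromℤ (ℤₚ.[1+m]⊖[1+n]≡m⊖n m n) ⟩
    fromℤ (m ℤ.⊖ n)                              ≈⟨ fromℤ-⊖ m n ⟩
    m ×′ 1# - n ×′ 1#                            ≈⟨ +-identityˡ _ ⟨
    0# + (m ×′ 1# - n ×′ 1#)                     ≈⟨ +-congʳ (-‿inverseʳ 1#) ⟨
    (1# - 1#) + (m ×′ 1# - n ×′ 1#)              ≈⟨ interchange 1# (- 1#) (m ×′ 1#) (- (n ×′ 1#)) ⟩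
    (1# + m ×′ 1#) + (- 1# - n ×′ 1#)            ≈⟨ +-congˡ (⁻¹-∙-comm 1# (n ×′ 1#)) ⟩
    (1# + m ×′ 1#) - (1# + n ×′ 1#)              ≈⟨ +-cong (1+× m 1#) (-‿cong (1+× n 1#)) ⟨
    suc m ×′ 1# - suc n ×′ 1#                    ∎
    where open import Algebra.Properties.CommutativeSemigroup (CommutativeRing.+-commutativeSemigroup R) using (interchange)

  fromℤ-+ : ∀ i j → fromℤ (i ℤ.+ j) ≈ fromℤ i + fromℤ j
  fromℤ-+ (+ m)      (+ n)      = ×-homo-+ 1# m n
  fromℤ-+ (+ m)      (-[1+ n ]) = fromℤ-⊖ m (suc n)
  fromℤ-+ (-[1+ m ]) (+ n)      = trans (fromℤ-⊖ n (suc m)) (+-comm _ _)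
  fromℤ-+ (-[1+ m ]) (-[1+ n ]) = begin
    - (suc (suc (m ℕ.+ n)) ×′ 1#)     ≡⟨ ≡.cong (λ k → - (suc k ×′ 1#)) (ℕₚ.+-suc m n) ⟨
    - ((suc m ℕ.+ suc n) ×′ 1#)       ≈⟨ -‿cong (×-homo-+ 1# (suc m) (suc n)) ⟩
    - (suc m ×′ 1# + suc n ×′ 1#)     ≈⟨ ⁻¹-∙-comm _ _ ⟨
    - (suc m ×′ 1#) - suc n ×′ 1#     ∎

  fromℤ-neg : ∀ i → fromℤ (ℤ.- i) ≈ - fromℤ i
  fromℤ-neg (+ zero)   = sym -0#≈0#
  fromℤ-neg (+ suc n)  = refl
  fromℤ-neg (-[1+ n ]) = sym (⁻¹-involutive _)

  private
    fromℤ-*⁺ : ∀ m j → fromℤ (+ m ℤ.* j) ≈ m ×′ 1# * fromℤ j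
    fromℤ-*⁺ m (+ n) = trans (reflexive (≡.cong fromℤ (≡.sym (ℤₚ.pos-* m n)))) (×1-homo-* m n)
    fromℤ-*⁺ m (-[1+ n ]) = begin
      fromℤ (+ m ℤ.* -[1+ n ])            ≡⟨ ≡.cong fromℤ (ℤₚ.neg-distribʳ-* (+ m) (+ suc n)) ⟨
      fromℤ (ℤ.- (+ m ℤ.* + suc n))       ≈⟨ fromℤ-neg (+ m ℤ.* + suc n) ⟩
      - fromℤ (+ m ℤ.* + suc n)           ≈⟨ -‿cong (fromℤ-*⁺ m (+ suc n)) ⟩
      - (m ×′ 1# * (suc n ×′ 1#))         ≈⟨ -‿distribʳ-* _ _ ⟩
      m ×′ 1# * - (suc n ×′ 1#)           ∎

  fromℤ-* : ∀ i j → fromℤ (i ℤ.* j) ≈ fromℤ i * fromℤ j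
  fromℤ-* (+ m)      j = fromℤ-*⁺ m j
  fromℤ-* (-[1+ m ]) j = begin
    fromℤ (-[1+ m ] ℤ.* j)        ≡⟨ ≡.cong fromℤ (ℤₚ.neg-distribˡ-* (+ suc m) j) ⟨
    fromℤ (ℤ.- (+ suc m ℤ.* j))   ≈⟨ fromℤ-neg (+ suc m ℤ.* j) ⟩
    - fromℤ (+ suc m ℤ.* j)       ≈⟨ -‿cong (fromℤ-*⁺ (suc m) j) ⟩
    - (suc m ×′ 1# * fromℤ j)     ≈⟨ -‿distribˡ-* _ _ ⟩
    - (suc m ×′ 1#) * fromℤ j     ∎

  open import Algebra.Solver.Ring.AlmostCommutativeRing using (fromCommutativeRing; _-Raw-AlmostCommutative⟶_)

  -- Coefficients in ℤ, whose equality is decidable, let the ring solver treat identities with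
  -- numerals in an arbitrary commutative ring.
  ℤ⟶R : ℤ.+-*-rawRing -Raw-AlmostCommutative⟶ fromCommutativeRing R
  ℤ⟶R = record
    { ⟦_⟧ = fromℤ ; +-homo = fromℤ-+ ; *-homo = fromℤ-* ; -‿homo = fromℤ-neg
    ; 0-homo = refl ; 1-homo = refl }

  private
    coeff≟ : ∀ i j → Maybe (fromℤ i ≈ fromℤ j)
    coeff≟ i j with i ℤₚ.≟ j
    ... | yes i≡j = just (reflexive (≡.cong fromℤ i≡j))
    ... | no _    = nothing

  open import Algebra.Solver.Ring ℤ.+-*-rawRing (fromCommutativeRing R) ℤ⟶R coeff≟ public
    using (Polynomial; solve; _:=_; con; _:+_; _:*_; _:-_; :-_)

-- The source is a raw ring, so that specialisations can start at the raw rings ℤ[c] and ℤ[c][z] of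
-- the definitions without ring laws being proved for them.
record Hom (A : RawRing r₁ ℓ₁) (S : CommutativeRing r₂ ℓ₂) : Set (r₁ ⊔ r₂ ⊔ ℓ₁ ⊔ ℓ₂) where
  private
    module A = RawRing A
    module S = CommutativeRing S
  field
    ⟦_⟧      : A.Carrier → S.Carrier
    ⟦⟧-cong  : ∀ {x y} → x A.≈ y → ⟦ x ⟧ S.≈ ⟦ y ⟧
    +-homo   : ∀ x y → ⟦ x A.+ y ⟧ S.≈ ⟦ x ⟧ S.+ ⟦ y ⟧
    *-homo   : ∀ x y → ⟦ x A.* y ⟧ S.≈ ⟦ x ⟧ S.* ⟦ y ⟧
    neg-homo : ∀ x → ⟦ A.- x ⟧ S.≈ S.- ⟦ x ⟧
    0-homo   : ⟦ A.0# ⟧ S.≈ S.0#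
    1-homo   : ⟦ A.1# ⟧ S.≈ S.1#

fromℤ-homo : {R : CommutativeRing r₁ ℓ₁} {S : CommutativeRing r₂ ℓ₂} (φ : Hom (CommutativeRing.rawRing R) S) →
  ∀ i → CommutativeRing._≈_ S (Hom.⟦_⟧ φ (FromIntegers.fromℤ R i)) (FromIntegers.fromℤ S i)
fromℤ-homo {R = R} {S} φ = λ { (+ n) → ℕ-homo n ; (-[1+ n ]) → S.trans (neg-homo _) (S.-‿cong (ℕ-homo (suc n))) }
  where
  open Hom φ
  module S = CommutativeRing S
  module R = CommutativeRing R
  module RI = FromIntegers R
  module SI = FromIntegers S
  ℕ-homo : ∀ n → ⟦ n RI.×′ R.1# ⟧ S.≈ n SI.×′ S.1#
  ℕ-homo zero          = 0-homo
  ℕ-homo (suc zero)    = 1-homo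
  ℕ-homo (suc (suc n)) = S.trans (+-homo _ _) (S.+-cong (ℕ-homo (suc n)) 1-homo)

infixr 9 _∘ʰ_
_∘ʰ_ : {A : RawRing r₁ ℓ₁} {S : CommutativeRing r₂ ℓ₂} {T : CommutativeRing r₃ ℓ₃} →
  Hom (CommutativeRing.rawRing S) T → Hom A S → Hom A T
_∘ʰ_ {T = T} g f = record
  { ⟦_⟧ = λ x → G.⟦ F.⟦ x ⟧ ⟧
  ; ⟦⟧-cong = λ e → G.⟦⟧-cong (F.⟦⟧-cong e)
  ; +-homo = λ x y → trans (G.⟦⟧-cong (F.+-homo x y)) (G.+-homo _ _)
  ; *-homo = λ x y → trans (G.⟦⟧-cong (F.*-homo x y)) (G.*-homo _ _)
  ; neg-homo = λ x → trans (G.⟦⟧-cong (F.neg-homo x)) (G.neg-homo _)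
  ; 0-homo = trans (G.⟦⟧-cong F.0-homo) G.0-homo
  ; 1-homo = trans (G.⟦⟧-cong F.1-homo) G.1-homo }
  where
  module F = Hom f
  module G = Hom g
  open CommutativeRing T using (trans)

-- Polynomials

module PolynomialRing (R : CommutativeRing c ℓ) where
  open CommutativeRing R hiding (zero; _-_)
  open Polynomial rawRing renaming (rawRing to polyRawRing) public
  open FromIntegers R using (solve; _:=_; con; _:+_; _:*_; _:-_; :-_)
  open import Relation.Binary.Reasoning.Setoid setoid
  open import Algebra.Properties.Ring ring using (-0#≈0#)
  open import Algebra.Properties.CommutativeSemigroup +-commutativeSemigroup using (interchange; x∙yz≈y∙xz)

  -- ≈ₚ unfolds to a function type, from which its arguments cannot be inferred.
  infix 4 _≋_
  record _≋_ (p q : Poly) : Set ℓ where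
    constructor mk
    field coeffs : p ≈ₚ q
  open _≋_ public

  coeff-+ : ∀ p q i → coeff (p +ₚ q) i ≈ coeff p i + coeff q i
  coeff-+ []      q       i       = sym (+-identityˡ _)
  coeff-+ (x ∷ p) []      i       = sym (+-identityʳ _)
  coeff-+ (x ∷ p) (y ∷ q) zero    = refl
  coeff-+ (x ∷ p) (y ∷ q) (suc i) = coeff-+ p q i

  coeff-scale : ∀ x q i → coeff (map (x *_) q) i ≈ x * coeff q i
  coeff-scale x []      i       = sym (zeroʳ x)
  coeff-scale x (y ∷ q) zero    = refl
  coeff-scale x (y ∷ q) (suc i) = coeff-scale x q i

  coeff-neg : ∀ q i → coeff (map -_ q) i ≈ - coeff q i
  coeff-neg []      i       = sym -0#≈0#
  coeff-neg (y ∷ q) zero    = refl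
  coeff-neg (y ∷ q) (suc i) = coeff-neg q i

  ≋-refl : ∀ {p} → p ≋ p
  ≋-refl = mk λ i → refl

  ≋-sym : ∀ {p q} → p ≋ q → q ≋ p
  ≋-sym e = mk λ i → sym (coeffs e i)

  ≋-trans : ∀ {p q r} → p ≋ q → q ≋ r → p ≋ r
  ≋-trans e f = mk λ i → trans (coeffs e i) (coeffs f i)

  tail-≋ : ∀ {x y p q} → x ∷ p ≋ y ∷ q → p ≋ q
  tail-≋ e = mk λ i → coeffs e (suc i)

  ∷-cong : ∀ {x y p q} → x ≈ y → p ≋ q → x ∷ p ≋ y ∷ q
  ∷-cong e f = mk λ { zero → e ; (suc i) → coeffs f i }

  0∷≋[] : ∀ {x p} → x ≈ 0# → p ≋ [] → x ∷ p ≋ []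
  0∷≋[] e f = mk λ { zero → e ; (suc i) → coeffs f i }

  +ₚ-cong : ∀ {p p′ q q′} → p ≋ p′ → q ≋ q′ → p +ₚ q ≋ p′ +ₚ q′
  +ₚ-cong {p} {p′} {q} {q′} e f = mk λ i →
    trans (coeff-+ p q i) (trans (+-cong (coeffs e i) (coeffs f i)) (sym (coeff-+ p′ q′ i)))

  +ₚ-comm : ∀ p q → p +ₚ q ≋ q +ₚ p
  +ₚ-comm p q = mk λ i → trans (coeff-+ p q i) (trans (+-comm _ _) (sym (coeff-+ q p i)))

  +ₚ-assoc : ∀ p q r → (p +ₚ q) +ₚ r ≋ p +ₚ (q +ₚ r)
  +ₚ-assoc p q r = mk λ i → begin
    coeff ((p +ₚ q) +ₚ r) i               ≈⟨ coeff-+ (p +ₚ q) r i ⟩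
    coeff (p +ₚ q) i + coeff r i          ≈⟨ +-congʳ (coeff-+ p q i) ⟩
    coeff p i + coeff q i + coeff r i     ≈⟨ +-assoc _ _ _ ⟩
    coeff p i + (coeff q i + coeff r i)   ≈⟨ +-congˡ (coeff-+ q r i) ⟨
    coeff p i + coeff (q +ₚ r) i          ≈⟨ coeff-+ p (q +ₚ r) i ⟨
    coeff (p +ₚ (q +ₚ r)) i               ∎

  +ₚ-identityʳ : ∀ p → p +ₚ [] ≋ p
  +ₚ-identityʳ p = mk λ i → trans (coeff-+ p [] i) (+-identityʳ _)

  negₚ-cong : ∀ {p q} → p ≋ q → map -_ p ≋ map -_ q
  negₚ-cong {p} {q} e = mk λ i → trans (coeff-neg p i) (trans (-‿cong (coeffs e i)) (sym (coeff-neg q i)))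

  +ₚ-inverseˡ : ∀ p → map -_ p +ₚ p ≋ []
  +ₚ-inverseˡ p = mk λ i → trans (coeff-+ (map -_ p) p i) (trans (+-congʳ (coeff-neg p i)) (-‿inverseˡ _))

  scale-cong : ∀ {x y p q} → x ≈ y → p ≋ q → map (x *_) p ≋ map (y *_) q
  scale-cong {x} {y} {p} {q} e f = mk λ i →
    trans (coeff-scale x p i) (trans (*-cong e (coeffs f i)) (sym (coeff-scale y q i)))

  coeff-*-∷ : ∀ x p q i → coeff ((x ∷ p) *ₚ q) i ≈ x * coeff q i + coeff (0# ∷ p *ₚ q) i
  coeff-*-∷ x p q i = trans (coeff-+ (map (x *_) q) (0# ∷ p *ₚ q) i) (+-congʳ (coeff-scale x q i))

  *ₚ-zeroˡ : ∀ {p} q → p ≋ [] → p *ₚ q ≋ []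
  *ₚ-zeroˡ {[]}    q e = ≋-refl
  *ₚ-zeroˡ {x ∷ p} q e = mk λ i → begin
    coeff ((x ∷ p) *ₚ q) i                   ≈⟨ coeff-*-∷ x p q i ⟩
    x * coeff q i + coeff (0# ∷ p *ₚ q) i    ≈⟨ +-congˡ (coeffs (0∷≋[] refl (*ₚ-zeroˡ {p} q (mk λ j → coeffs e (suc j)))) i) ⟩
    x * coeff q i + 0#                       ≈⟨ +-identityʳ _ ⟩
    x * coeff q i                            ≈⟨ *-congʳ (coeffs e zero) ⟩
    0# * coeff q i                           ≈⟨ zeroˡ _ ⟩
    0#                                       ∎

  *ₚ-cong : ∀ {p p′ q q′} → p ≋ p′ → q ≋ q′ → p *ₚ q ≋ p′ *ₚ q′
  *ₚ-cong {[]}    {p′}     {q} {q′} e f = ≋-sym (*ₚ-zeroˡ q′ (≋-sym e))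
  *ₚ-cong {x ∷ p} {[]}     {q} {q′} e f = *ₚ-zeroˡ q e
  *ₚ-cong {x ∷ p} {y ∷ p′} {q} {q′} e f =
    +ₚ-cong (scale-cong (coeffs e zero) f) (∷-cong refl (*ₚ-cong (tail-≋ e) f))

  *ₚ-distribʳ : ∀ r p q → (p +ₚ q) *ₚ r ≋ p *ₚ r +ₚ q *ₚ r
  *ₚ-distribʳ r []      q       = ≋-refl
  *ₚ-distribʳ r (x ∷ p) []      = ≋-sym (+ₚ-identityʳ ((x ∷ p) *ₚ r))
  *ₚ-distribʳ r (x ∷ p) (y ∷ q) = mk λ i → begin
    coeff ((x + y ∷ p +ₚ q) *ₚ r) i
      ≈⟨ coeff-*-∷ (x + y) (p +ₚ q) r i ⟩
    (x + y) * coeff r i + coeff (0# ∷ (p +ₚ q) *ₚ r) i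
      ≈⟨ +-cong (distribʳ _ _ _) (tail i) ⟩
    (x * coeff r i + y * coeff r i) + (coeff (0# ∷ p *ₚ r) i + coeff (0# ∷ q *ₚ r) i)
      ≈⟨ interchange _ _ _ _ ⟩
    (x * coeff r i + coeff (0# ∷ p *ₚ r) i) + (y * coeff r i + coeff (0# ∷ q *ₚ r) i)
      ≈⟨ +-cong (coeff-*-∷ x p r i) (coeff-*-∷ y q r i) ⟨
    coeff ((x ∷ p) *ₚ r) i + coeff ((y ∷ q) *ₚ r) i
      ≈⟨ coeff-+ ((x ∷ p) *ₚ r) ((y ∷ q) *ₚ r) i ⟨
    coeff ((x ∷ p) *ₚ r +ₚ (y ∷ q) *ₚ r) i ∎
    where
    tail : ∀ i → coeff (0# ∷ (p +ₚ q) *ₚ r) i ≈ coeff (0# ∷ p *ₚ r) i + coeff (0# ∷ q *ₚ r) i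
    tail zero    = sym (+-identityˡ 0#)
    tail (suc i) = trans (coeffs (*ₚ-distribʳ r p q) i) (coeff-+ (p *ₚ r) (q *ₚ r) i)

  *ₚ-zeroʳ : ∀ p → p *ₚ [] ≋ []
  *ₚ-zeroʳ []      = ≋-refl
  *ₚ-zeroʳ (x ∷ p) = 0∷≋[] refl (*ₚ-zeroʳ p)

  *ₚ-consʳ : ∀ p y q → p *ₚ (y ∷ q) ≋ map (y *_) p +ₚ (0# ∷ p *ₚ q)
  *ₚ-consʳ []      y q = ≋-sym (0∷≋[] refl ≋-refl)
  *ₚ-consʳ (x ∷ p) y q = ∷-cong (+-congʳ (*-comm x y)) (mk λ i → begin
    coeff (map (x *_) q +ₚ p *ₚ (y ∷ q)) i
      ≈⟨ coeff-+ (map (x *_) q) (p *ₚ (y ∷ q)) i ⟩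
    coeff (map (x *_) q) i + coeff (p *ₚ (y ∷ q)) i
      ≈⟨ +-congˡ (trans (coeffs (*ₚ-consʳ p y q) i) (coeff-+ (map (y *_) p) (0# ∷ p *ₚ q) i)) ⟩
    coeff (map (x *_) q) i + (coeff (map (y *_) p) i + coeff (0# ∷ p *ₚ q) i)
      ≈⟨ x∙yz≈y∙xz _ _ _ ⟩
    coeff (map (y *_) p) i + (coeff (map (x *_) q) i + coeff (0# ∷ p *ₚ q) i)
      ≈⟨ +-congˡ (coeff-+ (map (x *_) q) (0# ∷ p *ₚ q) i) ⟨
    coeff (map (y *_) p) i + coeff ((x ∷ p) *ₚ q) i
      ≈⟨ coeff-+ (map (y *_) p) ((x ∷ p) *ₚ q) i ⟨
    coeff (map (y *_) p +ₚ (x ∷ p) *ₚ q) i ∎)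

  *ₚ-comm : ∀ p q → p *ₚ q ≋ q *ₚ p
  *ₚ-comm []      q = ≋-sym (*ₚ-zeroʳ q)
  *ₚ-comm (x ∷ p) q = ≋-sym (≋-trans (*ₚ-consʳ q x p) (+ₚ-cong ≋-refl (∷-cong refl (*ₚ-comm q p))))

  scale-assoc : ∀ x q r → map (x *_) q *ₚ r ≋ map (x *_) (q *ₚ r)
  scale-assoc x []      r = ≋-refl
  scale-assoc x (y ∷ q) r = mk λ i → begin
    coeff ((x * y ∷ map (x *_) q) *ₚ r) i
      ≈⟨ coeff-*-∷ (x * y) (map (x *_) q) r i ⟩
    x * y * coeff r i + coeff (0# ∷ map (x *_) q *ₚ r) i
      ≈⟨ +-cong (*-assoc _ _ _) (tail i) ⟩
    x * (y * coeff r i) + x * coeff (0# ∷ q *ₚ r) i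
      ≈⟨ distribˡ _ _ _ ⟨
    x * (y * coeff r i + coeff (0# ∷ q *ₚ r) i)
      ≈⟨ *-congˡ (coeff-*-∷ y q r i) ⟨
    x * coeff ((y ∷ q) *ₚ r) i
      ≈⟨ coeff-scale x ((y ∷ q) *ₚ r) i ⟨
    coeff (map (x *_) ((y ∷ q) *ₚ r)) i ∎
    where
    tail : ∀ i → coeff (0# ∷ map (x *_) q *ₚ r) i ≈ x * coeff (0# ∷ q *ₚ r) i
    tail zero    = sym (zeroʳ x)
    tail (suc i) = trans (coeffs (scale-assoc x q r) i) (coeff-scale x (q *ₚ r) i)

  0∷-*ₚ : ∀ p q → (0# ∷ p) *ₚ q ≋ 0# ∷ p *ₚ q
  0∷-*ₚ p q = +ₚ-cong {map (0# *_) q} {[]} (mk λ i → trans (coeff-scale 0# q i) (zeroˡ _)) ≋-refl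

  *ₚ-assoc : ∀ p q r → (p *ₚ q) *ₚ r ≋ p *ₚ (q *ₚ r)
  *ₚ-assoc []      q r = ≋-refl
  *ₚ-assoc (x ∷ p) q r =
    ≋-trans (*ₚ-distribʳ r (map (x *_) q) (0# ∷ p *ₚ q))
      (+ₚ-cong (scale-assoc x q r) (≋-trans (0∷-*ₚ (p *ₚ q) r) (∷-cong refl (*ₚ-assoc p q r))))

  const-*ₚ : ∀ x q → const x *ₚ q ≋ map (x *_) q
  const-*ₚ x q = ≋-trans (+ₚ-cong ≋-refl (0∷≋[] refl ≋-refl)) (+ₚ-identityʳ (map (x *_) q))

  *ₚ-identityˡ : ∀ q → const 1# *ₚ q ≋ q
  *ₚ-identityˡ q = mk λ i → trans (coeffs (const-*ₚ 1# q) i) (trans (coeff-scale 1# q i) (*-identityˡ _))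

  polyRing : CommutativeRing c ℓ
  polyRing = record
    { Carrier = Poly ; _≈_ = _≋_ ; _+_ = _+ₚ_ ; _*_ = _*ₚ_ ; -_ = λ p → map -_ p ; 0# = [] ; 1# = const 1#
    ; isCommutativeRing = record
      { isRing = record
        { +-isAbelianGroup = record
          { isGroup = record
            { isMonoid = record
              { isSemigroup = record
                { isMagma = record
                  { isEquivalence = record { refl = ≋-refl ; sym = ≋-sym ; trans = ≋-trans }
                  ; ∙-cong = +ₚ-cong }
                ; assoc = +ₚ-assoc }
              ; identity = (λ p → ≋-refl) , +ₚ-identityʳ }
            ; inverse = +ₚ-inverseˡ , λ p → ≋-trans (+ₚ-comm p (map -_ p)) (+ₚ-inverseˡ p)
            ; ⁻¹-cong = negₚ-cong }
          ; comm = +ₚ-comm }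
        ; *-cong = *ₚ-cong
        ; *-assoc = *ₚ-assoc
        ; *-identity = *ₚ-identityˡ , λ p → ≋-trans (*ₚ-comm p (const 1#)) (*ₚ-identityˡ p)
        ; distrib = (λ r p q → ≋-trans (*ₚ-comm r (p +ₚ q))
            (≋-trans (*ₚ-distribʳ r p q) (+ₚ-cong (*ₚ-comm p r) (*ₚ-comm q r))))
          , *ₚ-distribʳ }
      ; *-comm = *ₚ-comm } }

  module R[X] = CommutativeRing polyRing

  eval-cong : ∀ {p q} x → p ≋ q → eval p x ≈ eval q x
  eval-cong {[]}    {[]}    x e = refl
  eval-cong {[]}    {b ∷ q} x e = sym (trans (+-cong (sym (coeffs e 0)) (*-congˡ (sym (eval-cong {[]} {q} x (mk λ i → coeffs e (suc i)))))) (trans (+-identityˡ _) (zeroʳ x)))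
  eval-cong {a ∷ p} {[]}    x e = trans (+-cong (coeffs e 0) (*-congˡ (eval-cong {p} {[]} x (mk λ i → coeffs e (suc i))))) (trans (+-identityˡ _) (zeroʳ x))
  eval-cong {a ∷ p} {b ∷ q} x e = +-cong (coeffs e 0) (*-congˡ (eval-cong x (tail-≋ e)))

  eval-congʳ : ∀ p {x y} → x ≈ y → eval p x ≈ eval p y
  eval-congʳ []      e = refl
  eval-congʳ (a ∷ p) e = +-congˡ (*-cong e (eval-congʳ p e))

  eval-+ : ∀ x p q → eval (p +ₚ q) x ≈ eval p x + eval q x
  eval-+ x []      q       = sym (+-identityˡ _)
  eval-+ x (a ∷ p) []      = sym (+-identityʳ _)
  eval-+ x (a ∷ p) (b ∷ q) = trans (+-congˡ (*-congˡ (eval-+ x p q)))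
    (solve 5 (λ a b x p q → (a :+ b) :+ x :* (p :+ q) := (a :+ x :* p) :+ (b :+ x :* q)) refl a b x (eval p x) (eval q x))

  eval-scale : ∀ x y q → eval (map (y *_) q) x ≈ y * eval q x
  eval-scale x y []      = sym (zeroʳ y)
  eval-scale x y (b ∷ q) = trans (+-congˡ (*-congˡ (eval-scale x y q)))
    (solve 4 (λ b x y q → y :* b :+ x :* (y :* q) := y :* (b :+ x :* q)) refl b x y (eval q x))

  eval-* : ∀ x p q → eval (p *ₚ q) x ≈ eval p x * eval q x
  eval-* x []      q = sym (zeroˡ _)
  eval-* x (a ∷ p) q = trans (eval-+ x (map (a *_) q) (0# ∷ p *ₚ q))
    (trans (+-cong (eval-scale x a q) (+-congˡ (*-congˡ (eval-* x p q))))
      (solve 4 (λ a x p q → a :* q :+ (con (+ 0) :+ x :* (p :* q)) := (a :+ x :* p) :* q) refl a x (eval p x) (eval q x)))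

  eval-const : ∀ x y → eval (const y) x ≈ y
  eval-const x y = trans (+-congˡ (zeroʳ x)) (+-identityʳ y)

  eval-neg : ∀ x p → eval (map -_ p) x ≈ - eval p x
  eval-neg x []      = sym -0#≈0#
  eval-neg x (a ∷ p) = trans (+-congˡ (*-congˡ (eval-neg x p)))
    (solve 3 (λ a x p → :- a :+ x :* (:- p) := :- (a :+ x :* p)) refl a x (eval p x))

  evalHom : Carrier → Hom R[X].rawRing R
  evalHom x = record
    { ⟦_⟧ = λ p → eval p x ; ⟦⟧-cong = λ {p} {q} → eval-cong {p} {q} x
    ; +-homo = eval-+ x ; *-homo = eval-* x ; neg-homo = eval-neg x ; 0-homo = refl ; 1-homo = eval-const x 1# }

  module _ {S : CommutativeRing r₂ ℓ₂} (φ : Hom polyRawRing S) where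
    open Hom φ

    onPolyRing : Hom R[X].rawRing S
    onPolyRing = record
      { ⟦_⟧ = ⟦_⟧ ; ⟦⟧-cong = λ {p} {q} e → ⟦⟧-cong {p} {q} (coeffs e) ; +-homo = +-homo ; *-homo = *-homo
      ; neg-homo = neg-homo ; 0-homo = 0-homo ; 1-homo = 1-homo }

  constHom : Hom rawRing polyRing
  constHom = record
    { ⟦_⟧ = const ; ⟦⟧-cong = λ e → ∷-cong e ≋-refl ; +-homo = λ x y → ≋-refl ; neg-homo = λ x → ≋-refl ; 0-homo = 0∷≋[] refl ≋-refl
    ; *-homo = λ x y → ∷-cong (sym (+-identityʳ _)) ≋-refl ; 1-homo = ≋-refl }

  coeff-beyond : ∀ p i → length p ≤ i → coeff p i ≈ 0#
  coeff-beyond []      i       l       = refl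
  coeff-beyond (x ∷ p) (suc i) (s≤s l) = coeff-beyond p i l

  length-∷ʳ : ∀ (p : Poly) x → length (p ∷ʳ x) ≡ suc (length p)
  length-∷ʳ []      x = ≡.refl
  length-∷ʳ (y ∷ p) x = ≡.cong suc (length-∷ʳ p x)

  coeff-∷ʳ : ∀ p x → coeff (p ∷ʳ x) (length p) ≈ x
  coeff-∷ʳ []      x = refl
  coeff-∷ʳ (y ∷ p) x = coeff-∷ʳ p x

  coeff-∷ʳ-< : ∀ p x i → i < length p → coeff (p ∷ʳ x) i ≈ coeff p i
  coeff-∷ʳ-< (y ∷ p) x zero    l       = refl
  coeff-∷ʳ-< (y ∷ p) x (suc i) (s≤s l) = coeff-∷ʳ-< p x i l

  ∷ʳ-0 : ∀ p {x} → x ≈ 0# → p ∷ʳ x ≋ p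
  ∷ʳ-0 []      e = 0∷≋[] e ≋-refl
  ∷ʳ-0 (y ∷ p) e = ∷-cong refl (∷ʳ-0 p e)

  ∷ʳ≈+ : ∀ p x → p ∷ʳ x ≋ p +ₚ shift (length p) (const x)
  ∷ʳ≈+ []      x = ≋-refl
  ∷ʳ≈+ (y ∷ p) x = ∷-cong (sym (+-identityʳ y)) (∷ʳ≈+ p x)

  shift-cong : ∀ e {p q} → p ≋ q → shift e p ≋ shift e q
  shift-cong zero    f = f
  shift-cong (suc e) f = ∷-cong refl (shift-cong e f)

  shift-*ₚ : ∀ e p q → shift e p *ₚ q ≋ shift e (p *ₚ q)
  shift-*ₚ zero    p q = ≋-refl
  shift-*ₚ (suc e) p q = ≋-trans {shift (suc e) p *ₚ q} {0# ∷ shift e p *ₚ q} (0∷-*ₚ (shift e p) q) (∷-cong refl (shift-*ₚ e p q))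

  coeff-shift-+ : ∀ e p i → coeff (shift e p) (e ℕ.+ i) ≈ coeff p i
  coeff-shift-+ zero    p i = refl
  coeff-shift-+ (suc e) p i = coeff-shift-+ e p i

  VanishesAbove : ℕ → Poly → Set ℓ
  VanishesAbove m p = ∀ i → m < i → coeff p i ≈ 0#

  ∷ʳ-*ₚ : ∀ w x p → (w ∷ʳ x) *ₚ p ≋ w *ₚ p +ₚ shift (length w) (map (x *_) p)
  ∷ʳ-*ₚ w x p =
    R[X].trans (R[X].*-congʳ {p} (∷ʳ≈+ w x))
      (R[X].trans (*ₚ-distribʳ p w (shift (length w) (const x)))
        (R[X].+-congˡ {w *ₚ p} (R[X].trans (shift-*ₚ (length w) (const x) p) (shift-cong (length w) (const-*ₚ x p)))))

  *ₚ-vanishes : ∀ m p → VanishesAbove m p → ∀ w i → m ℕ.+ length w ≤ i → coeff (w *ₚ p) i ≈ 0#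
  *ₚ-vanishes m p v []      i l = refl
  *ₚ-vanishes m p v (x ∷ w) zero    l = contradiction (≡.subst (_≤ 0) (ℕₚ.+-suc m (length w)) l) λ ()
  *ₚ-vanishes m p v (x ∷ w) (suc i) l = trans (coeff-+ (map (x *_) p) (0# ∷ w *ₚ p) (suc i))
    (trans (+-cong (trans (coeff-scale x p (suc i)) (trans (*-congˡ (v (suc i) m<i)) (zeroʳ x)))
                   (*ₚ-vanishes m p v w i (ℕ.s≤s⁻¹ l′)))
      (+-identityʳ 0#))
    where
    l′ = ≡.subst (_≤ suc i) (ℕₚ.+-suc m (length w)) l
    m<i = ℕₚ.≤-trans (s≤s (ℕₚ.m≤m+n m (length w))) l′

  *ₚ-top : ∀ m p → VanishesAbove m p → ∀ w x → coeff ((w ∷ʳ x) *ₚ p) (length w ℕ.+ m) ≈ x * coeff p m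
  *ₚ-top m p v w x = begin
    coeff ((w ∷ʳ x) *ₚ p) d                                        ≈⟨ coeffs (∷ʳ-*ₚ w x p) d ⟩
    coeff (w *ₚ p +ₚ shift (length w) (map (x *_) p)) d            ≈⟨ coeff-+ (w *ₚ p) (shift (length w) (map (x *_) p)) d ⟩
    coeff (w *ₚ p) d + coeff (shift (length w) (map (x *_) p)) d
      ≈⟨ +-cong (*ₚ-vanishes m p v w d (ℕₚ.≤-reflexive (ℕₚ.+-comm m (length w))))
                (trans (coeff-shift-+ (length w) (map (x *_) p) m) (coeff-scale x p m)) ⟩
    0# + x * coeff p m                                             ≈⟨ +-identityˡ _ ⟩
    x * coeff p m ∎
    where d = length w ℕ.+ m

  -- A monic polynomial is represented by its lower coefficients, which makes its degree the
  -- computable number `length low`.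
  monic : Poly → Poly
  monic low = low ∷ʳ 1#

  monic-top : ∀ low → coeff (monic low) (length low) ≈ 1#
  monic-top low = coeff-∷ʳ low 1#

  monic-vanishes : ∀ low → VanishesAbove (length low) (monic low)
  monic-vanishes low i l = coeff-beyond (monic low) i
    (ℕₚ.≤-trans (ℕₚ.≤-reflexive (length-∷ʳ low 1#)) l)

  length-+ₚ : ∀ n p q → length p ≤ n → length q ≤ n → length (p +ₚ q) ≤ n
  length-+ₚ n       []      q       l        l′        = l′
  length-+ₚ n       (x ∷ p) []      l        l′        = l
  length-+ₚ (suc n) (x ∷ p) (y ∷ q) (s≤s l) (s≤s l′) = s≤s (length-+ₚ n p q l l′)

  length-map : ∀ (f : Carrier → Carrier) n p → length p ≤ n → length (map f p) ≤ n
  length-map f n p l = ≡.subst (_≤ n) (≡.sym (Listₚ.length-map f p)) l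

  -- Recursion from the top coefficient down: dividing the tail p leaves a remainder r, and a + X r
  -- exceeds the permitted degree by at most one term, which one multiple of the divisor removes.
  division : ∀ low a → ∃[ q ] ∃[ r ] a ≋ q *ₚ monic low +ₚ r × length r ≤ length low
  division low []      = [] , [] , ≋-refl , z≤n
  division low (a ∷ p) with division low p
  ... | q , r , e , l = (t ∷ q) , r′ , eq , length-r′
    where
    d = length low
    -- The coefficient of a + X r at the degree of the divisor is the next coefficient of the
    -- quotient.
    t = coeff (a ∷ r) d
    m = monic low
    -- The bound on the remainder is a bound on the length of a list. The top entries are zero only
    -- up to `_≈_` and have to be cut off.
    truncate : ∀ n (f : ℕ → Carrier) → Poly
    truncate zero    f = []
    truncate (suc n) f = f 0 ∷ truncate n (λ i → f (suc i))
    truncate-≈ : ∀ n p → VanishesAbove n (0# ∷ p) → truncate n (coeff p) ≋ p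
    truncate-≈ zero    p       v = mk λ i → sym (v (suc i) (s≤s z≤n))
    truncate-≈ (suc n) []      v = 0∷≋[] refl (truncate-≈ n [] λ { (suc i) _ → refl })
    truncate-≈ (suc n) (x ∷ p) v = ∷-cong refl (truncate-≈ n p λ { (suc i) l → v (suc (suc i)) (s≤s l) })
    truncate-length : ∀ n f → length (truncate n f) ≤ n
    truncate-length zero    f = z≤n
    truncate-length (suc n) f = s≤s (truncate-length n _)
    full = (a ∷ r) +ₚ map -_ (map (t *_) m)
    r′ = truncate d (coeff full)
    length-r′ = truncate-length d (coeff full)
    full-vanishes : VanishesAbove d (0# ∷ full)
    full-vanishes (suc i) (s≤s d≤i) = trans (coeff-+ (a ∷ r) (map -_ (map (t *_) m)) i)
      (trans (+-congˡ (trans (coeff-neg (map (t *_) m) i) (-‿cong (coeff-scale t m i)))) (cancel (ℕₚ.m≤n⇒m<n∨m≡n d≤i)))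
      where
      cancel : d < i ⊎ d ≡ i → coeff (a ∷ r) i + - (t * coeff m i) ≈ 0#
      cancel (inj₂ ≡.refl) = trans (+-congˡ (-‿cong (trans (*-congˡ (monic-top low)) (*-identityʳ t)))) (-‿inverseʳ t)
      cancel (inj₁ d<i) = trans (+-cong (coeff-beyond (a ∷ r) i (ℕₚ.≤-trans (s≤s l) d<i))
        (-‿cong (trans (*-congˡ (monic-vanishes low i d<i)) (zeroʳ t)))) (-‿inverseʳ 0#)
    module P = FromIntegers polyRing
    eq : (a ∷ p) ≋ (t ∷ q) *ₚ m +ₚ r′
    eq = R[X].trans (∷-cong {a} {a + 0#} (sym (+-identityʳ a)) e)
      (R[X].trans step (R[X].sym (R[X].+-congˡ {(t ∷ q) *ₚ m} (truncate-≈ d full full-vanishes))))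
      where
      step : (a + 0#) ∷ (q *ₚ m +ₚ r) ≋ (map (t *_) m +ₚ (0# ∷ q *ₚ m)) +ₚ ((a ∷ r) +ₚ map -_ (map (t *_) m))
      step = R[X].trans (∷-cong (trans (+-identityʳ a) (sym (+-identityˡ a))) ≋-refl)
        (P.solve 3 (λ A B C → B P.:+ C P.:= (A P.:+ B) P.:+ (C P.:- A)) R[X].refl (map (t *_) m) (0# ∷ q *ₚ m) (a ∷ r))

module _ {A : RawRing r₁ ℓ₁} {S : CommutativeRing r₂ ℓ₂} (φ : Hom A S) where
  private
    module A = RawRing A
    module S = CommutativeRing S
    module PA = Polynomial A
    module PS = PolynomialRing S
  open Hom φ

  coeff-map : ∀ p i → PS.coeff (map ⟦_⟧ p) i S.≈ ⟦ PA.coeff p i ⟧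
  coeff-map []      i       = S.sym 0-homo
  coeff-map (x ∷ p) zero    = S.refl
  coeff-map (x ∷ p) (suc i) = coeff-map p i

  eval-map : ∀ p x → PS.eval (map ⟦_⟧ p) ⟦ x ⟧ S.≈ ⟦ PA.eval p x ⟧
  eval-map []      x = S.sym 0-homo
  eval-map (a ∷ p) x = S.sym (S.trans (+-homo _ _) (S.+-congˡ (S.trans (*-homo _ _) (S.*-congˡ (S.sym (eval-map p x))))))

  mapHom : Hom PA.rawRing PS.polyRing
  mapHom = record
    { ⟦_⟧ = map ⟦_⟧
    ; ⟦⟧-cong = λ {p} {q} e → PS.mk λ i → S.trans (coeff-map p i) (S.trans (⟦⟧-cong (e i)) (S.sym (coeff-map q i)))
    ; +-homo = map-+
    ; *-homo = map-*
    ; neg-homo = map-neg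
    ; 0-homo = PS.≋-refl
    ; 1-homo = PS.∷-cong 1-homo PS.≋-refl }
    where
    map-+ : ∀ p q → map ⟦_⟧ (p PA.+ₚ q) PS.≋ map ⟦_⟧ p PS.+ₚ map ⟦_⟧ q
    map-+ []      q       = PS.≋-refl
    map-+ (x ∷ p) []      = PS.≋-refl
    map-+ (x ∷ p) (y ∷ q) = PS.∷-cong (+-homo x y) (map-+ p q)
    map-neg : ∀ p → map ⟦_⟧ (map A.-_ p) PS.≋ map S.-_ (map ⟦_⟧ p)
    map-neg []      = PS.≋-refl
    map-neg (x ∷ p) = PS.∷-cong (neg-homo x) (map-neg p)
    map-scale : ∀ x q → map ⟦_⟧ (map (x A.*_) q) PS.≋ map (⟦ x ⟧ S.*_) (map ⟦_⟧ q)
    map-scale x []      = PS.≋-refl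
    map-scale x (y ∷ q) = PS.∷-cong (*-homo x y) (map-scale x q)
    map-* : ∀ p q → map ⟦_⟧ (p PA.*ₚ q) PS.≋ map ⟦_⟧ p PS.*ₚ map ⟦_⟧ q
    map-* []      q = PS.≋-refl
    map-* (x ∷ p) q = PS.≋-trans (map-+ (map (x A.*_) q) (A.0# ∷ p PA.*ₚ q))
      (PS.+ₚ-cong (map-scale x q) (PS.∷-cong 0-homo (map-* p q)))

-- Determinants

-- Inverses under a double negation suffice for refutations, and they are what a residue field
-- F[X]/(q) provides: there they come from a gcd found by excluded middle.
record IsClassicalField (R : CommutativeRing c ℓ) : Set (c ⊔ ℓ) where
  open CommutativeRing R
  field
    nontrivial : ¬ 1# ≈ 0#
    invertible : ∀ x → ¬ x ≈ 0# → ¬ ¬ (∃[ y ] x * y ≈ 1#)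

  cancel : ∀ {x y} → x * y ≈ 0# → ¬ x ≈ 0# → ¬ ¬ y ≈ 0#
  cancel {x} {y} xy≈0 x≉0 = invertible x x≉0 >>= λ (z , xz≈1) → return
    (solve-cancel z xz≈1)
    where
    solve-cancel : ∀ z → x * z ≈ 1# → y ≈ 0#
    solve-cancel z xz≈1 = trans (sym (*-identityˡ y)) (trans (*-congʳ (sym xz≈1))
      (trans (trans (*-congʳ (*-comm x z)) (*-assoc z x y)) (trans (*-congˡ xy≈0) (zeroʳ z))))

-- Column operations are confined to neighbouring columns. For these the alternating property
-- follows from the Laplace expansion without any theory of permutations.
data Adjacent : Fin n → Fin n → Set where
  zero : Adjacent {suc (suc n)} zero (suc zero)
  suc  : ∀ {s t : Fin n} → Adjacent s t → Adjacent (suc s) (suc t)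

Adjacent⇒≢ : ∀ {s t : Fin n} → Adjacent s t → s ≢ t
Adjacent⇒≢ zero ()
Adjacent⇒≢ (suc a) e = Adjacent⇒≢ a (Finₚ.suc-injective e)

Adjacent-toℕ : ∀ {s t : Fin n} → Adjacent s t → toℕ t ≡ suc (toℕ s)
Adjacent-toℕ zero    = ≡.refl
Adjacent-toℕ (suc a) = ≡.cong suc (Adjacent-toℕ a)

Adjacent-inject₁ : ∀ (f : Fin n) → Adjacent (inject₁ f) (suc f)
Adjacent-inject₁ zero    = zero
Adjacent-inject₁ (suc f) = suc (Adjacent-inject₁ f)

Adjacent-punchOut : ∀ {s t : Fin (suc n)} → Adjacent s t → ∀ j → j ≢ s → j ≢ t →
  ∃[ s′ ] ∃[ t′ ] Adjacent s′ t′ × punchIn j s′ ≡ s × punchIn j t′ ≡ t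
Adjacent-punchOut zero zero j≢s j≢t = contradiction ≡.refl j≢s
Adjacent-punchOut zero (suc zero) j≢s j≢t = contradiction ≡.refl j≢t
Adjacent-punchOut {n = suc (suc n)} zero (suc (suc j)) j≢s j≢t = zero , suc zero , zero , ≡.refl , ≡.refl
Adjacent-punchOut (suc {s = s} {t} a) zero j≢s j≢t = s , t , a , ≡.refl , ≡.refl
Adjacent-punchOut {n = suc n} (suc a) (suc j) j≢s j≢t =
  let s′ , t′ , a′ , e , f = Adjacent-punchOut a j (j≢s ∘ ≡.cong suc) (j≢t ∘ ≡.cong suc)
  in suc s′ , suc t′ , suc a′ , ≡.cong suc e , ≡.cong suc f

Adjacent-punchIn : ∀ {s t : Fin (suc n)} → Adjacent s t → ∀ c →
  punchIn s c ≡ punchIn t c ⊎ punchIn s c ≡ t × punchIn t c ≡ s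
Adjacent-punchIn zero zero = inj₂ (≡.refl , ≡.refl)
Adjacent-punchIn zero (suc c) = inj₁ ≡.refl
Adjacent-punchIn (suc a) zero = inj₁ ≡.refl
Adjacent-punchIn {n = suc n} (suc a) (suc c) with Adjacent-punchIn a c
... | inj₁ e       = inj₁ (≡.cong suc e)
... | inj₂ (e , f) = inj₂ (≡.cong suc e , ≡.cong suc f)

module DeterminantProperties (R : CommutativeRing c ℓ) where
  open CommutativeRing R hiding (zero)
  open Determinant rawRing using (det) public
  open FromIntegers R using (solve; _:=_; con; _:+_; _:*_; _:-_; :-_)
  open import Algebra.Definitions.RawSemiring (RawRing.rawSemiring rawRing) using (_^_)
  open import Algebra.Properties.Semiring.Sum semiring public
    using (sum; sum-cong-≋; ∑-distrib-+; *-distribˡ-sum; *-distribʳ-sum; sum-replicate-zero; ∑-comm)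
  open import Relation.Binary.Reasoning.Setoid setoid

  Matrix : ℕ → Set c
  Matrix n = Fin n → Fin n → Carrier

  minor : Matrix (suc n) → Fin (suc n) → Matrix n
  minor M j r s = M (suc r) (punchIn j s)

  sum-zero : ∀ {n} (f : Fin n → Carrier) → (∀ i → f i ≈ 0#) → sum f ≈ 0#
  sum-zero {n} f e = trans (sum-cong-≋ e) (sum-replicate-zero n)

  det-cong : {M N : Matrix n} → (∀ i j → M i j ≈ N i j) → det M ≈ det N
  det-cong {zero}  e = refl
  det-cong {suc n} e = sum-cong-≋ λ j → *-congˡ {(- 1#) ^ toℕ j}
    (*-cong (e zero j) (det-cong λ r s → e (suc r) (punchIn j s)))

  det-linear : ∀ (s : Fin n) k (A B C : Matrix n) →
    (∀ r c → c ≢ s → A r c ≈ B r c) → (∀ r c → c ≢ s → A r c ≈ C r c) →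
    (∀ r → A r s ≈ B r s + k * C r s) → det A ≈ det B + k * det C
  det-linear {suc n} s k A B C A≈B A≈C As = begin
    det A                                         ≈⟨ sum-cong-≋ term ⟩
    sum (λ j → tB j + k * tC j)                   ≈⟨ ∑-distrib-+ tB (λ j → k * tC j) ⟩
    sum tB + sum (λ j → k * tC j)                 ≈⟨ +-congˡ (*-distribˡ-sum k tC) ⟨
    det B + k * det C                             ∎
    where
    tB tC : Fin (suc n) → Carrier
    tB j = (- 1#) ^ toℕ j * (B zero j * det (minor B j))
    tC j = (- 1#) ^ toℕ j * (C zero j * det (minor C j))
    term : ∀ j → (- 1#) ^ toℕ j * (A zero j * det (minor A j)) ≈ tB j + k * tC j
    term j with j Finₚ.≟ s
    ... | yes ≡.refl = trans (*-congˡ {(- 1#) ^ toℕ j} (*-congʳ (As zero)))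
          (trans (solve 5 (λ ε b c k d → ε :* ((b :+ k :* c) :* d) := ε :* (b :* d) :+ k :* (ε :* (c :* d))) refl
                   ((- 1#) ^ toℕ j) (B zero j) (C zero j) k (det (minor A j)))
            (+-cong (*-congˡ {(- 1#) ^ toℕ j} (*-congˡ (det-cong λ r c → A≈B (suc r) _ (punchInᵢ≢i j c))))
                    (*-congˡ (*-congˡ {(- 1#) ^ toℕ j} (*-congˡ (det-cong λ r c → A≈C (suc r) _ (punchInᵢ≢i j c)))))))
    ... | no j≢s = trans (*-congˡ {(- 1#) ^ toℕ j} (*-congˡ
            (det-linear s′ k (minor A j) (minor B j) (minor C j)
              (λ r c c≢ → A≈B (suc r) _ (away c c≢)) (λ r c c≢ → A≈C (suc r) _ (away c c≢))
              (λ r → ≡.subst (λ t → A (suc r) t ≈ B (suc r) t + k * C (suc r) t) (≡.sym (punchIn-punchOut j≢s)) (As (suc r))))))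
          (trans (solve 5 (λ ε a k b c → ε :* (a :* (b :+ k :* c)) := ε :* (a :* b) :+ k :* (ε :* (a :* c))) refl
                   ((- 1#) ^ toℕ j) (A zero j) k (det (minor B j)) (det (minor C j)))
            (+-cong (*-congˡ {(- 1#) ^ toℕ j} (*-congʳ (A≈B zero j j≢s)))
                    (*-congˡ (*-congˡ {(- 1#) ^ toℕ j} (*-congʳ (A≈C zero j j≢s))))))
          where
          s′ = punchOut j≢s
          away : ∀ c → c ≢ s′ → punchIn j c ≢ s
          away c c≢ e = c≢ (punchIn-injective j c s′ (≡.trans e (≡.sym (punchIn-punchOut j≢s))))

  sum-adjacent : ∀ {n} {s t : Fin n} → Adjacent s t → ∀ f → f s + f t ≈ 0# →
    (∀ j → j ≢ s → j ≢ t → f j ≈ 0#) → sum f ≈ 0#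
  sum-adjacent zero f e z = begin
    f zero + (f (suc zero) + sum rest)  ≈⟨ +-assoc (f zero) (f (suc zero)) (sum rest) ⟨
    (f zero + f (suc zero)) + sum rest  ≈⟨ +-cong e (sum-zero rest λ i → z (suc (suc i)) (λ ()) (λ ())) ⟩
    0# + 0#                                        ≈⟨ +-identityʳ 0# ⟩
    0#                                             ∎
    where
    rest : Fin _ → Carrier
    rest i = f (suc (suc i))
  sum-adjacent (suc a) f e z = trans (+-cong (z zero (λ ()) (λ ()))
    (sum-adjacent a (f ∘ suc) e (λ j j≢s j≢t → z (suc j) (j≢s ∘ Finₚ.suc-injective) (j≢t ∘ Finₚ.suc-injective))))
    (+-identityʳ 0#)

  -- In the expansion along the first row, the minors that delete one of the two equal columns
  -- coincide and carry opposite signs. Every other minor still has two equal adjacent columns.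
  det-alternating : ∀ {s t : Fin n} → Adjacent s t → (A : Matrix n) → (∀ r → A r s ≈ A r t) → det A ≈ 0#
  det-alternating {suc n} {s} {t} a A e = sum-adjacent a f cancelling others
    where
    f : Fin (suc n) → Carrier
    f j = (- 1#) ^ toℕ j * (A zero j * det (minor A j))
    same : ∀ r c → A (suc r) (punchIn t c) ≈ A (suc r) (punchIn s c)
    same r c with Adjacent-punchIn a c
    ... | inj₁ p       = reflexive (≡.cong (A (suc r)) (≡.sym p))
    ... | inj₂ (p , q) = trans (reflexive (≡.cong (A (suc r)) q)) (trans (e (suc r)) (reflexive (≡.cong (A (suc r)) (≡.sym p))))
    cancelling : f s + f t ≈ 0#
    cancelling = begin
      f s + f t
        ≈⟨ +-congˡ (*-cong (reflexive (≡.cong ((- 1#) ^_) (Adjacent-toℕ a))) (*-cong (sym (e zero)) (det-cong same))) ⟩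
      f s + (- 1# * (- 1#) ^ toℕ s) * (A zero s * det (minor A s))
        ≈⟨ solve 2 (λ ε x → ε :* x :+ (:- con (+ 1) :* ε) :* x := con (+ 0)) refl ((- 1#) ^ toℕ s) (A zero s * det (minor A s)) ⟩
      0# ∎
    others : ∀ j → j ≢ s → j ≢ t → f j ≈ 0#
    others j j≢s j≢t =
      let s′ , t′ , a′ , p , q = Adjacent-punchOut a j j≢s j≢t in
      trans (*-congˡ {(- 1#) ^ toℕ j} (trans (*-congˡ (det-alternating a′ (minor A j) λ r →
        trans (reflexive (≡.cong (A (suc r)) p)) (trans (e (suc r)) (reflexive (≡.cong (A (suc r)) (≡.sym q)))))) (zeroʳ _))) (zeroʳ _)

  addColumn : (s t : Fin n) → Carrier → Matrix n → Matrix n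
  addColumn s t k M r c = if does (c Finₚ.≟ t) then M r t + k * M r s else M r c

  addColumn-target : ∀ (s t : Fin n) k M r → addColumn s t k M r t ≈ M r t + k * M r s
  addColumn-target s t k M r with t Finₚ.≟ t
  ... | yes _ = refl
  ... | no ¬p = contradiction ≡.refl ¬p

  addColumn-other : ∀ (s t : Fin n) k M r c → c ≢ t → addColumn s t k M r c ≈ M r c
  addColumn-other s t k M r c c≢t with c Finₚ.≟ t
  ... | yes p = contradiction p c≢t
  ... | no _  = refl

  Neighbours : Fin n → Fin n → Set
  Neighbours s t = Adjacent s t ⊎ Adjacent t s

  Neighbours⇒≢ : ∀ {s t : Fin n} → Neighbours s t → s ≢ t
  Neighbours⇒≢ (inj₁ a) = Adjacent⇒≢ a
  Neighbours⇒≢ (inj₂ a) = Adjacent⇒≢ a ∘ ≡.sym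

  det-addColumn : ∀ {s t : Fin n} → Neighbours s t → ∀ k M → det (addColumn s t k M) ≈ det M
  det-addColumn {n} {s} {t} nb k M = begin
    det (addColumn s t k M)
      ≈⟨ det-linear t k (addColumn s t k M) M copy (addColumn-other s t k M)
           (λ r c c≢t → trans (addColumn-other s t k M r c c≢t) (sym (copy-other r c c≢t)))
           (λ r → trans (addColumn-target s t k M r) (+-congˡ (*-congˡ (sym (copy-target r))))) ⟩
    det M + k * det copy  ≈⟨ +-congˡ (trans (*-congˡ (alt nb)) (zeroʳ k)) ⟩
    det M + 0#            ≈⟨ +-identityʳ _ ⟩
    det M                 ∎
    where
    copy : Matrix n
    copy r c = if does (c Finₚ.≟ t) then M r s else M r c
    copy-other : ∀ r c → c ≢ t → copy r c ≈ M r c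
    copy-other r c c≢t with c Finₚ.≟ t
    ... | yes p = contradiction p c≢t
    ... | no _  = refl
    copy-target : ∀ r → copy r t ≈ M r s
    copy-target r with t Finₚ.≟ t
    ... | yes _ = refl
    ... | no ¬p = contradiction ≡.refl ¬p
    equal : ∀ r → copy r s ≈ copy r t
    equal r = trans (copy-other r s (Neighbours⇒≢ nb)) (sym (copy-target r))
    alt : Neighbours s t → det copy ≈ 0#
    alt (inj₁ a) = det-alternating a copy equal
    alt (inj₂ a) = det-alternating a copy (λ r → sym (equal r))

  LeftKernel : Matrix n → Set (c ⊔ ℓ)
  LeftKernel {n} M = Σ (Fin n → Carrier) λ v → (∃[ i ] ¬ v i ≈ 0#) × (∀ j → sum (λ i → v i * M i j) ≈ 0#)

  -- Column operations leave the left kernel unchanged, so a matrix may be simplified by them until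
  -- a kernel vector is visible.
  leftKernel-addColumn : ∀ {s t : Fin n} → s ≢ t → ∀ k M → LeftKernel (addColumn s t k M) → LeftKernel M
  leftKernel-addColumn {s = s} {t} s≢t k M (v , nz , ker) = v , nz , ker′
    where
    other : ∀ j → j ≢ t → sum (λ i → v i * M i j) ≈ 0#
    other j j≢t = trans (sum-cong-≋ λ i → *-congˡ (sym (addColumn-other s t k M i j j≢t))) (ker j)
    at-t : sum (λ i → v i * M i t) ≈ 0#
    at-t = begin
      sum (λ i → v i * M i t)
        ≈⟨ sum-cong-≋ (λ i → solve 4 (λ v a b k → v :* a := v :* (a :+ k :* b) :+ (:- k) :* (v :* b)) refl (v i) (M i t) (M i s) k) ⟩
      sum (λ i → v i * (M i t + k * M i s) + - k * (v i * M i s))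
        ≈⟨ ∑-distrib-+ _ (λ i → - k * (v i * M i s)) ⟩
      sum (λ i → v i * (M i t + k * M i s)) + sum (λ i → - k * (v i * M i s))
        ≈⟨ +-cong (trans (sum-cong-≋ λ i → *-congˡ (sym (addColumn-target s t k M i))) (ker t))
                  (trans (sym (*-distribˡ-sum (- k) (λ i → v i * M i s))) (trans (*-congˡ (other s s≢t)) (zeroʳ _))) ⟩
      0# + 0#  ≈⟨ +-identityʳ 0# ⟩
      0# ∎
    ker′ : ∀ j → sum (λ i → v i * M i j) ≈ 0#
    ker′ j with j Finₚ.≟ t
    ... | yes ≡.refl = at-t
    ... | no j≢t     = other j j≢t

module _ {A : RawRing r₁ ℓ₁} {S : CommutativeRing r₂ ℓ₂} (φ : Hom A S) where
  private
    module A = RawRing A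
    module S = CommutativeRing S
  open Hom φ
  open DeterminantProperties S using (sum; sum-cong-≋)
  open import Algebra.Definitions.RawSemiring A.rawSemiring using () renaming (sum to sumᴬ; _^_ to _^ᴬ_)
  open import Algebra.Definitions.RawSemiring (RawRing.rawSemiring S.rawRing) using (_^_)

  sum-homo : ∀ {n} (f : Fin n → A.Carrier) → sum (⟦_⟧ ∘ f) S.≈ ⟦ sumᴬ f ⟧
  sum-homo {zero}  f = S.sym 0-homo
  sum-homo {suc n} f = S.trans (S.+-congˡ (sum-homo (f ∘ suc))) (S.sym (+-homo _ _))

  ^-homo : ∀ x n → ⟦ x ^ᴬ n ⟧ S.≈ ⟦ x ⟧ ^ n
  ^-homo x zero    = 1-homo
  ^-homo x (suc n) = S.trans (*-homo _ _) (S.*-congˡ (^-homo x n))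

  det-homo : (M : Fin n → Fin n → A.Carrier) →
    Determinant.det S.rawRing (λ i j → ⟦ M i j ⟧) S.≈ ⟦ Determinant.det A M ⟧
  det-homo {zero}  M = S.sym 1-homo
  det-homo {suc n} M = S.trans
    (sum-cong-≋ λ j → S.trans
      (S.*-cong (sign (toℕ j)) (S.trans (S.*-congˡ (det-homo λ r s → M (suc r) (punchIn j s))) (S.sym (*-homo (M zero j) _))))
      (S.sym (*-homo ((A.- A.1#) ^ᴬ toℕ j) _)))
    (sum-homo λ j → (A.- A.1#) ^ᴬ toℕ j A.* (M zero j A.* Determinant.det A λ r s → M (suc r) (punchIn j s)))
    where
    sign : ∀ k → (S.- S.1#) ^ k S.≈ ⟦ (A.- A.1#) ^ᴬ k ⟧
    sign zero    = S.sym 1-homo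
    sign (suc k) = S.trans (S.*-cong (S.sym (S.trans (neg-homo A.1#) (S.-‿cong 1-homo))) (sign k)) (S.sym (*-homo _ _))

module _ {R : CommutativeRing c ℓ} (field′ : IsClassicalField R) where
  open CommutativeRing R hiding (zero)
  open DeterminantProperties R
  open IsClassicalField field′
  open FromIntegers R using (solve; _:=_; _:+_; _:*_; _:-_; :-_)
  open import Relation.Binary.Reasoning.Setoid setoid

  private
    record Reduction (M : Matrix n) : Set (c ⊔ ℓ) where
      field
        result  : Matrix n
        det≈    : det result ≈ det M
        kernel  : LeftKernel result → LeftKernel M
    open Reduction

    addColumnReduction : ∀ {s t : Fin n} → Neighbours s t → ∀ k M → Reduction M
    addColumnReduction {s = s} {t} nb k M = record
      { result = addColumn s t k M ; det≈ = det-addColumn nb k M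
      ; kernel = leftKernel-addColumn (Neighbours⇒≢ nb) k M }

    _then_ : ∀ {M : Matrix n} (ρ : Reduction M) → Reduction (result ρ) → Reduction M
    ρ then σ = record { result = result σ ; det≈ = trans (det≈ σ) (det≈ ρ) ; kernel = λ k → kernel ρ (kernel σ k) }

    RowZeroFrom : ℕ → Matrix (suc n) → Set ℓ
    RowZeroFrom i M = ∀ t → i ≤ toℕ t → M zero t ≈ 0#

    clearWith : ∀ {s t : Fin (suc n)} → Adjacent s t → (M : Matrix (suc n)) → RowZeroFrom (suc (toℕ t)) M →
      ¬ M zero s ≈ 0# → ¬ ¬ Σ (Reduction M) λ ρ → RowZeroFrom (toℕ t) (result ρ)
    clearWith {s = s} {t} a M z nz = invertible (M zero s) nz >>= λ (y , e) →
      return (addColumnReduction (inj₁ a) (- (M zero t * y)) M , cleared y e)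
      where
      cleared : ∀ y → M zero s * y ≈ 1# → RowZeroFrom (toℕ t) (addColumn s t (- (M zero t * y)) M)
      cleared y e j t≤j with j Finₚ.≟ t
      ... | yes ≡.refl = begin
        M zero t + - (M zero t * y) * M zero s  ≈⟨ solve 3 (λ b y a → b :+ (:- (b :* y)) :* a := b :- b :* (a :* y)) refl (M zero t) y (M zero s) ⟩
        M zero t - M zero t * (M zero s * y)    ≈⟨ +-congˡ (-‿cong (trans (*-congˡ e) (*-identityʳ _))) ⟩
        M zero t - M zero t                     ≈⟨ -‿inverseʳ _ ⟩
        0#                                      ∎
      ... | no j≢t = z j (ℕₚ.≤∧≢⇒< t≤j (j≢t ∘ ≡.sym ∘ Finₚ.toℕ-injective))

    -- Entry t of the first row is cleared by its left neighbour s. If that entry vanishes as well,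
    -- adding column t to column s first supplies a nonzero pivot.
    clearStep : ∀ {s t : Fin (suc n)} → Adjacent s t → (M : Matrix (suc n)) → RowZeroFrom (suc (toℕ t)) M →
      ¬ ¬ Σ (Reduction M) λ ρ → RowZeroFrom (toℕ t) (result ρ)
    clearStep {s = s} {t} a M z = em >>= go
      where
      s<t : suc (toℕ s) ≤ toℕ t
      s<t = ℕₚ.≤-reflexive (≡.sym (Adjacent-toℕ a))
      Zero : M zero t ≈ 0# → ∀ j → toℕ t < toℕ j ⊎ toℕ t ≡ toℕ j → M zero j ≈ 0#
      Zero t0 j (inj₁ l) = z j l
      Zero t0 j (inj₂ e) = ≡.subst (λ k → M zero k ≈ 0#) (Finₚ.toℕ-injective e) t0

      go : Dec (M zero s ≈ 0#) → _
      go (no nz)  = clearWith a M z nz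
      go (yes s0) = em {A = M zero t ≈ 0#} >>= λ where
        (yes t0) → return (record { result = M ; det≈ = refl ; kernel = λ k → k } , λ j t≤j → Zero t0 j (ℕₚ.m≤n⇒m<n∨m≡n t≤j))
        (no nz)  → let ρ = addColumnReduction (inj₂ a) 1# M in
          clearWith a (result ρ)
            (λ j t<j → trans (addColumn-other t s 1# M zero j (λ { ≡.refl → ℕₚ.<-asym t<j (s<t) })) (z j t<j))
            (λ e → nz (trans (sym (trans (+-congʳ s0) (trans (+-identityˡ _) (*-identityˡ _)))) (trans (sym (addColumn-target t s 1# M zero)) e)))
          >>= λ (σ , z′) → return (ρ then σ , z′)

    clearRow : ∀ i → i ≤ n → (M : Matrix (suc n)) → RowZeroFrom (suc i) M →
      ¬ ¬ Σ (Reduction M) λ ρ → RowZeroFrom 1 (result ρ)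
    clearRow zero i≤n M z = return (record { result = M ; det≈ = refl ; kernel = λ k → k } , z)
    clearRow (suc i) i<n M z =
      clearStep (Adjacent-inject₁ f) M (≡.subst (λ k → RowZeroFrom (suc (suc k)) M) (≡.sym (Finₚ.toℕ-fromℕ< i<n)) z) >>= λ (ρ , z′) →
      clearRow i (ℕₚ.<⇒≤ i<n) (result ρ) (≡.subst (λ k → RowZeroFrom (suc k) (result ρ)) (Finₚ.toℕ-fromℕ< i<n) z′) >>= λ (σ , z″) →
      return (ρ then σ , z″)
      where f = fromℕ< i<n

  -- Once the first row is (d, 0, ..., 0) the determinant is d times a minor. If d = 0, the first
  -- unit vector is in the left kernel. Otherwise the minor is singular, and a kernel vector of it
  -- extends by the entry that annihilates the first column.
  det≈0⇒leftKernel : (M : Matrix n) → det M ≈ 0# → ¬ ¬ LeftKernel M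
  det≈0⇒leftKernel {zero}  M e = contradiction e nontrivial
  det≈0⇒leftKernel {suc n} M e =
    clearRow n ℕₚ.≤-refl M (λ t l → contradiction (ℕₚ.≤-trans l (ℕ.s≤s⁻¹ (Finₚ.toℕ<n t))) (ℕₚ.<-irrefl ≡.refl)) >>= λ (ρ , z) →
    split ρ z em
    where
    firstRow : (N : Matrix (suc n)) → (∀ j → N zero j ≈ 0#) → LeftKernel N
    firstRow N N0 = v , (zero , nontrivial) , λ j →
      trans (+-cong (trans (*-identityˡ _) (N0 j)) (sum-zero {n} (λ i → 0# * N (suc i) j) λ i → zeroˡ _)) (+-identityʳ _)
      where
      v : Fin (suc n) → Carrier
      v zero    = 1#
      v (suc i) = 0#
    extend : (N : Matrix (suc n)) → RowZeroFrom 1 N → ∃[ y ] N zero zero * y ≈ 1# → LeftKernel (minor N zero) → LeftKernel N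
    extend N z (y , ay) (w , (i , nz) , ker) = v , (suc i , nz) , ker′
      where
      S = sum (λ i → w i * N (suc i) zero)
      v : Fin (suc n) → Carrier
      v zero    = - (S * y)
      v (suc i) = w i
      ker′ : ∀ j → sum (λ i → v i * N i j) ≈ 0#
      ker′ zero    = begin
        - (S * y) * N zero zero + S  ≈⟨ solve 3 (λ s y a → (:- (s :* y)) :* a :+ s := s :- s :* (a :* y)) refl S y (N zero zero) ⟩
        S - S * (N zero zero * y)    ≈⟨ +-congˡ (-‿cong (trans (*-congˡ ay) (*-identityʳ S))) ⟩
        S - S                        ≈⟨ -‿inverseʳ S ⟩
        0#                           ∎
      ker′ (suc j) = trans (+-cong (trans (*-congˡ {v zero} (z (suc j) (s≤s z≤n))) (zeroʳ (v zero))) (ker j)) (+-identityʳ 0#)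
    split : (ρ : Reduction M) → RowZeroFrom 1 (result ρ) →
      ¬ ¬ Dec (result ρ zero zero ≈ 0#) → ¬ ¬ LeftKernel M
    split ρ z pivot? = pivot? >>= cases
      where
      N = result ρ
      d = N zero zero
      det-N : d * det (minor N zero) ≈ 0#
      det-N = begin
        d * det (minor N zero)             ≈⟨ *-identityˡ _ ⟨
        1# * (d * det (minor N zero))      ≈⟨ +-identityʳ _ ⟨
        1# * (d * det (minor N zero)) + 0# ≈⟨ +-congˡ (sum-zero _ λ j → trans (*-congˡ (trans (*-congʳ (z (suc j) (s≤s z≤n))) (zeroˡ _))) (zeroʳ _)) ⟨
        det N                              ≈⟨ det≈ ρ ⟩
        det M                              ≈⟨ e ⟩
        0#                                 ∎
      cases : Dec (d ≈ 0#) → ¬ ¬ LeftKernel M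
      cases (yes d≈0) = return (kernel ρ (firstRow N (λ { zero → d≈0 ; (suc j) → z (suc j) (s≤s z≤n) })))
      cases (no d≉0) = cancel det-N d≉0 >>= λ m≈0 → det≈0⇒leftKernel (minor N zero) m≈0 >>= λ w →
        invertible d d≉0 >>= λ y → return (kernel ρ (extend N z y w))

-- Resultants and residue fields

module PolynomialCancellation (R : CommutativeRing c ℓ) where
  open CommutativeRing R hiding (zero; _-_)
  open PolynomialRing R

  -- The top coefficient of w p is that of w times the coefficient of p at m, so the entries of w
  -- are stripped from the top. The condition on degrees ≥ m expresses that a multiple of p of
  -- smaller degree is zero. Regularity covers monic polynomials over any ring as well as nonzero
  -- leading coefficients over a field.
  cancel-regular : ∀ m p → (∀ x → x * coeff p m ≈ 0# → ¬ ¬ (x ≈ 0#)) → VanishesAbove m p →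
    ∀ w → (∀ i → m ≤ i → coeff (w *ₚ p) i ≈ 0#) → ¬ ¬ (w ≋ [])
  cancel-regular m p regular v w z = go (length w) w ℕₚ.≤-refl z
    where
    go : ∀ n w → length w ≤ n → (∀ i → m ≤ i → coeff (w *ₚ p) i ≈ 0#) → ¬ ¬ (w ≋ [])
    go n w l z with initLast w
    ... | [] = return ≋-refl
    ... | w′ ∷ʳ′ x = regular x (trans (sym (*ₚ-top m p v w′ x)) (z _ (ℕₚ.m≤n+m m (length w′)))) >>= λ x≈0 →
          smaller n (≡.subst (_≤ n) (length-∷ʳ w′ x) l) (∷ʳ-0 w′ x≈0)
      where
      smaller : ∀ n → suc (length w′) ≤ n → w′ ∷ʳ x ≋ w′ → ¬ ¬ (w′ ∷ʳ x ≋ [])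
      smaller (suc n) (s≤s l) e =
        go n w′ l (λ i m≤i → trans (sym (coeffs (*ₚ-cong {q = p} e ≋-refl) i)) (z i m≤i)) >>= λ f → return (≋-trans e f)

  cancel-monic : ∀ low w → (∀ i → length low ≤ i → coeff (w *ₚ monic low) i ≈ 0#) → ¬ ¬ (w ≋ [])
  cancel-monic low = cancel-regular (length low) (monic low)
    (λ x e → return (trans (sym (trans (*-congˡ (monic-top low)) (*-identityʳ x))) e)) (monic-vanishes low)

module Sylvester (R : CommutativeRing c ℓ) where
  open CommutativeRing R hiding (zero; _-_)
  open PolynomialRing R
  open DeterminantProperties R using (sum; sum-cong-≋; LeftKernel)
  open import Relation.Binary.Reasoning.Setoid setoid

  fromTop : ∀ n → (Fin n → Carrier) → Poly
  fromTop zero    g = []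
  fromTop (suc n) g = fromTop n (g ∘ suc) ∷ʳ g zero

  length-fromTop : ∀ n g → length (fromTop n g) ≡ n
  length-fromTop zero    g = ≡.refl
  length-fromTop (suc n) g = ≡.trans (length-∷ʳ (fromTop n (g ∘ suc)) (g zero)) (≡.cong suc (length-fromTop n (g ∘ suc)))

  coeff-shift-scale : ∀ e x p k → coeff (shift e (map (x *_) p)) k ≈ x * coeff (shift e p) k
  coeff-shift-scale zero    x p k       = coeff-scale x p k
  coeff-shift-scale (suc e) x p zero    = sym (zeroʳ x)
  coeff-shift-scale (suc e) x p (suc k) = coeff-shift-scale e x p k

  coeff-fromTop-* : ∀ n g p k →
    coeff (fromTop n g *ₚ p) k ≈ sum (λ r → g r * coeff (shift (toℕ (opposite r)) p) k)
  coeff-fromTop-* zero    g p k = refl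
  coeff-fromTop-* (suc n) g p k = begin
    coeff (fromTop (suc n) g *ₚ p) k
      ≈⟨ coeffs (∷ʳ-*ₚ (fromTop n (g ∘ suc)) (g zero) p) k ⟩
    coeff (fromTop n (g ∘ suc) *ₚ p +ₚ shift (length (fromTop n (g ∘ suc))) (map (g zero *_) p)) k
      ≈⟨ coeff-+ (fromTop n (g ∘ suc) *ₚ p) _ k ⟩
    coeff (fromTop n (g ∘ suc) *ₚ p) k + coeff (shift (length (fromTop n (g ∘ suc))) (map (g zero *_) p)) k
      ≈⟨ +-cong (coeff-fromTop-* n (g ∘ suc) p k) (coeff-shift-scale (length (fromTop n (g ∘ suc))) (g zero) p k) ⟩
    sum (λ r → g (suc r) * coeff (shift (toℕ (opposite r)) p) k) + g zero * coeff (shift (length (fromTop n (g ∘ suc))) p) k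
      ≈⟨ +-comm _ _ ⟩
    g zero * coeff (shift (length (fromTop n (g ∘ suc))) p) k + sum (λ r → g (suc r) * coeff (shift (toℕ (opposite r)) p) k)
      ≈⟨ +-cong (at (≡.trans (length-fromTop n (g ∘ suc)) (≡.sym (toℕ-fromℕ n))) zero)
                (sum-cong-≋ λ r → at (≡.sym (toℕ-inject₁ (opposite r))) (suc r)) ⟩
    sum (λ r → g r * coeff (shift (toℕ (opposite r)) p) k) ∎
    where
    at : ∀ {d e} → d ≡ e → ∀ r → g r * coeff (shift d p) k ≈ g r * coeff (shift e p) k
    at ≡.refl r = refl

  coeff-fromTop : ∀ n g r → coeff (fromTop n g) (toℕ (opposite r)) ≈ g r
  coeff-fromTop (suc n) g zero = trans
    (reflexive (≡.cong (coeff (fromTop (suc n) g)) (≡.trans (toℕ-fromℕ n) (≡.sym (length-fromTop n (g ∘ suc))))))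
    (coeff-∷ʳ (fromTop n (g ∘ suc)) (g zero))
  coeff-fromTop (suc n) g (suc r) = trans (reflexive (≡.cong (coeff (fromTop (suc n) g)) (toℕ-inject₁ (opposite r))))
    (trans (coeff-∷ʳ-< (fromTop n (g ∘ suc)) (g zero) (toℕ (opposite r))
             (≡.subst (toℕ (opposite r) <_) (≡.sym (length-fromTop n (g ∘ suc))) (Finₚ.toℕ<n (opposite r))))
      (coeff-fromTop n (g ∘ suc) r))

  sum-splitAt : ∀ n {m} (f : Fin (n ℕ.+ m) → Carrier) → sum f ≈ sum (λ i → f (i ↑ˡ m)) + sum (λ i → f (n ↑ʳ i))
  sum-splitAt zero    f = sym (+-identityˡ _)
  sum-splitAt (suc n) f = trans (+-congˡ (sum-splitAt n (f ∘ suc))) (sym (+-assoc _ _ _))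

  module _ (m n : ℕ) (p q : Poly) (p-deg : VanishesAbove m p) (q-deg : VanishesAbove n q) where

    -- The rows of the Sylvester matrix are shifts of p and q, so the entries of a kernel vector are
    -- the coefficients of u and v, highest degree first. The length of v is recorded because it
    -- keeps v below the degree of p.
    leftKernel⇒syzygy : LeftKernel (sylvester m n p q) →
      ∃[ u ] ∃[ v ] (u *ₚ p +ₚ v *ₚ q ≋ []) × length v ≡ m × ¬ (u ≋ [] × v ≋ [])
    leftKernel⇒syzygy (κ , (i , κᵢ≉0) , ker) = u , v , mk syzygy , length-fromTop m _ , nonzero
      where
      u = fromTop n (λ r → κ (r ↑ˡ m))
      v = fromTop m (λ r → κ (n ↑ʳ r))
      expand : ∀ j → sum (λ i → κ i * sylvester m n p q i j) ≈ coeff (u *ₚ p +ₚ v *ₚ q) (toℕ (opposite j))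
      expand j = begin
        sum (λ i → κ i * sylvester m n p q i j)
          ≈⟨ sum-splitAt n (λ i → κ i * sylvester m n p q i j) ⟩
        sum (λ r → κ (r ↑ˡ m) * sylvester m n p q (r ↑ˡ m) j) + sum (λ r → κ (n ↑ʳ r) * sylvester m n p q (n ↑ʳ r) j)
          ≈⟨ +-cong (sum-cong-≋ λ r → *-congˡ {κ (r ↑ˡ m)} (reflexive (≡.cong row (splitAt-↑ˡ n r m))))
                    (sum-cong-≋ λ r → *-congˡ {κ (n ↑ʳ r)} (reflexive (≡.cong row (splitAt-↑ʳ n m r)))) ⟩
        sum (λ r → κ (r ↑ˡ m) * coeff (shift (toℕ (opposite r)) p) k) + sum (λ r → κ (n ↑ʳ r) * coeff (shift (toℕ (opposite r)) q) k)
          ≈⟨ +-cong (coeff-fromTop-* n _ p k) (coeff-fromTop-* m _ q k) ⟨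
        coeff (u *ₚ p) k + coeff (v *ₚ q) k
          ≈⟨ coeff-+ (u *ₚ p) (v *ₚ q) k ⟨
        coeff (u *ₚ p +ₚ v *ₚ q) k ∎
        where
        k = toℕ (opposite j)
        row : Fin n ⊎ Fin m → Carrier
        row x = coeff ([ (λ r → shift (toℕ (opposite r)) p) , (λ r → shift (toℕ (opposite r)) q) ]′ x) k
      syzygy : ∀ k → coeff (u *ₚ p +ₚ v *ₚ q) k ≈ 0#
      syzygy k with k ℕₚ.<? n ℕ.+ m
      ... | yes k<n+m = trans (reflexive (≡.cong (coeff (u *ₚ p +ₚ v *ₚ q))
              (≡.sym (≡.trans (≡.cong toℕ (opposite-involutive (fromℕ< k<n+m))) (toℕ-fromℕ< k<n+m)))))
              (trans (sym (expand (opposite (fromℕ< k<n+m)))) (ker _))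
      ... | no k≮n+m = trans (coeff-+ (u *ₚ p) (v *ₚ q) k) (trans (+-cong
              (*ₚ-vanishes m p p-deg u k (≡.subst (_≤ k) (≡.trans (ℕₚ.+-comm n m) (≡.cong (m ℕ.+_) (≡.sym (length-fromTop n _)))) n+m≤k))
              (*ₚ-vanishes n q q-deg v k (≡.subst (_≤ k) (≡.cong (n ℕ.+_) (≡.sym (length-fromTop m _))) n+m≤k))) (+-identityʳ 0#))
        where n+m≤k = ℕₚ.≮⇒≥ k≮n+m
      nonzero : ¬ (u ≋ [] × v ≋ [])
      nonzero (u≋0 , v≋0) = κᵢ≉0 (trans (reflexive (≡.cong κ (≡.sym (join-splitAt n m i)))) (entry (splitAt n i)))
        where
        entry : ∀ x → κ (Fin.join n m x) ≈ 0#
        entry (inj₁ r) = trans (sym (coeff-fromTop n _ r)) (coeffs u≋0 (toℕ (opposite r)))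
        entry (inj₂ r) = trans (sym (coeff-fromTop m _ r)) (coeffs v≋0 (toℕ (opposite r)))

module QuotientRing (S : CommutativeRing c ℓ) (q : CommutativeRing.Carrier S) where
  open CommutativeRing S hiding (zero; _-_)
  open FromIntegers S using (solve; _:=_; _:+_; _:*_; _:-_; :-_)

  infix 4 _~_
  record _~_ (a b : Carrier) : Set (c ⊔ ℓ) where
    constructor _,_
    field
      multiple : Carrier
      equation : a ≈ b + multiple * q

  quotientRing : CommutativeRing c (c ⊔ ℓ)
  quotientRing = record
    { Carrier = Carrier ; _≈_ = _~_ ; _+_ = _+_ ; _*_ = _*_ ; -_ = -_ ; 0# = 0# ; 1# = 1#
    ; isCommutativeRing = record
      { isRing = record
        { +-isAbelianGroup = record
          { isGroup = record
            { isMonoid = record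
              { isSemigroup = record
                { isMagma = record
                  { isEquivalence = record
                    { refl = ≈⇒~ refl
                    ; sym = λ {a} {b} → λ (w , e) → (- w) , trans
                        (solve 3 (λ b w q → b := (b :+ w :* q) :+ (:- w) :* q) refl b w q) (+-congʳ (sym e))
                    ; trans = λ {a} {b} {d} → λ (w , e) (w′ , e′) → (w + w′) , trans e (trans (+-congʳ e′)
                        (solve 4 (λ d w w′ q → (d :+ w′ :* q) :+ w :* q := d :+ (w :+ w′) :* q) refl d w w′ q)) }
                  ; ∙-cong = λ {a} {b} {d} {f} → λ (w , e) (w′ , e′) → (w + w′) , trans (+-cong e e′)
                      (solve 5 (λ b w f w′ q → (b :+ w :* q) :+ (f :+ w′ :* q) := (b :+ f) :+ (w :+ w′) :* q) refl b w f w′ q) }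
                ; assoc = λ x y z → ≈⇒~ (+-assoc x y z) }
              ; identity = (λ x → ≈⇒~ (+-identityˡ x)) , (λ x → ≈⇒~ (+-identityʳ x)) }
            ; inverse = (λ x → ≈⇒~ (-‿inverseˡ x)) , (λ x → ≈⇒~ (-‿inverseʳ x))
            ; ⁻¹-cong = λ {a} {b} → λ (w , e) → (- w) , trans (-‿cong e)
                (solve 3 (λ b w q → :- (b :+ w :* q) := :- b :+ (:- w) :* q) refl b w q) }
          ; comm = λ x y → ≈⇒~ (+-comm x y) }
        ; *-cong = λ {a} {b} {d} {f} → λ (w , e) (w′ , e′) → (w * f + b * w′ + w * w′ * q) , trans (*-cong e e′)
            (solve 5 (λ b w f w′ q → (b :+ w :* q) :* (f :+ w′ :* q) := b :* f :+ (w :* f :+ b :* w′ :+ w :* w′ :* q) :* q) refl b w f w′ q)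
        ; *-assoc = λ x y z → ≈⇒~ (*-assoc x y z)
        ; *-identity = (λ x → ≈⇒~ (*-identityˡ x)) , (λ x → ≈⇒~ (*-identityʳ x))
        ; distrib = (λ x y z → ≈⇒~ (distribˡ x y z)) , (λ x y z → ≈⇒~ (distribʳ x y z)) }
      ; *-comm = λ x y → ≈⇒~ (*-comm x y) } }
    where
    ≈⇒~ : ∀ {a b} → a ≈ b → a ~ b
    ≈⇒~ {a} {b} e = 0# , trans e (sym (trans (+-congˡ (zeroˡ q)) (+-identityʳ b)))

  projection : Hom rawRing quotientRing
  projection = record
    { ⟦_⟧ = λ x → x ; ⟦⟧-cong = λ {a} {b} e → 0# , trans e (sym (trans (+-congˡ (zeroˡ q)) (+-identityʳ b)))
    ; +-homo = λ x y → E.refl ; *-homo = λ x y → E.refl ; neg-homo = λ x → E.refl ; 0-homo = E.refl ; 1-homo = E.refl }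
    where module E = CommutativeRing quotientRing

  _∣_ : Carrier → Carrier → Set (c ⊔ ℓ)
  a ∣ b = ∃[ w ] b ≈ w * a

  ~0⇒∣ : ∀ {a} → a ~ 0# → q ∣ a
  ~0⇒∣ (w , e) = w , trans e (+-identityˡ _)

  ∣⇒~0 : ∀ {a} → q ∣ a → a ~ 0#
  ∣⇒~0 (w , e) = w , trans e (sym (+-identityˡ _))

module ClassicalPolynomials {F : CommutativeRing c ℓ} (field′ : IsClassicalField F) where
  open CommutativeRing F hiding (zero; _-_)
  open IsClassicalField field′
  open PolynomialRing F
  open PolynomialCancellation F
  open Sylvester F
  open DeterminantProperties F using (det)
  open FromIntegers polyRing using (solve; _:=_; _:+_; _:*_; _:-_; :-_)

  infix 4 _∣_
  _∣_ : Poly → Poly → Set (c ⊔ ℓ)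
  p ∣ q = ∃[ w ] q ≋ w *ₚ p

  ∣-trans : ∀ {p q r} → p ∣ q → q ∣ r → p ∣ r
  ∣-trans {p} (w , e) (w′ , e′) = w′ *ₚ w ,
    ≋-trans e′ (≋-trans (*ₚ-cong (≋-refl {w′}) e) (≋-sym (*ₚ-assoc w′ w p)))

  module _ (m n : ℕ) (p q : Poly) (p-top : ¬ coeff p m ≈ 0#) (p-deg : VanishesAbove m p) (q-deg : VanishesAbove n q)
           where

    private
      cancel-p : ∀ w → (∀ i → m ≤ i → coeff (w *ₚ p) i ≈ 0#) → ¬ ¬ (w ≋ [])
      cancel-p = cancel-regular m p (λ x e → cancel (trans (*-comm _ x) e) p-top) p-deg

    -- A singular matrix gives u p + v q = 0, whence (v a - b u) p = e v. As v is shorter than p,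
    -- both sides vanish. So v = 0, then u p = 0 and u = 0, although u and v are not both zero.
    bezout⇒det≉0 : ∀ a b e → (a *ₚ p +ₚ b *ₚ q ≋ const e) → ¬ e ≈ 0# → ¬ det (sylvester m n p q) ≈ 0#
    bezout⇒det≉0 a b e bezout e≉0 d≈0 = (det≈0⇒leftKernel field′ (sylvester m n p q) d≈0 >>= λ k →
      contradict (leftKernel⇒syzygy m n p q p-deg q-deg k)) λ x → x
      where
      contradict : (∃[ u ] ∃[ v ] (u *ₚ p +ₚ v *ₚ q ≋ []) × length v ≡ m × ¬ (u ≋ [] × v ≋ [])) → ¬ ¬ ⊥
      contradict (u , v , syz , len-v , nonzero) =
        invertible e e≉0 >>= λ (e⁻¹ , ee⁻¹) →
        cancel-p w (λ i m≤i → trans (coeffs we i) (coeff-beyond (map (e *_) v) i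
          (≡.subst (_≤ i) (≡.sym (≡.trans (Listₚ.length-map (e *_) v) len-v)) m≤i))) >>= λ w≋0 →
        let v≋0 : v ≋ []
            v≋0 = ≋-trans (unscale e⁻¹ ee⁻¹) (mk λ i → trans (coeff-scale e⁻¹ (map (e *_) v) i)
              (trans (*-congˡ (coeffs (≋-trans (≋-sym we) (*ₚ-zeroˡ p w≋0)) i)) (zeroʳ e⁻¹))) in
        cancel-p u (λ i _ → coeffs (≋-trans (≋-sym (+ₚ-identityʳ (u *ₚ p)))
          (≋-trans (+ₚ-cong (≋-refl {u *ₚ p}) (≋-sym (*ₚ-zeroˡ q v≋0))) syz)) i) >>= λ u≋0 →
        λ _ → nonzero (u≋0 , v≋0)
        where
        w = v *ₚ a +ₚ map -_ (b *ₚ u)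
        we : w *ₚ p ≋ map (e *_) v
        we = ≋-trans (≋-trans
          (solve 6 (λ u v a b p q → (v :* a :- b :* u) :* p := v :* (a :* p :+ b :* q) :- b :* (u :* p :+ v :* q)) ≋-refl u v a b p q)
          (+ₚ-cong (*ₚ-cong (≋-refl {v}) bezout) (negₚ-cong (*ₚ-cong (≋-refl {b}) syz))))
          (≋-trans (≋-trans (+ₚ-cong (*ₚ-comm v (const e)) (negₚ-cong (*ₚ-zeroʳ b))) (+ₚ-identityʳ _)) (const-*ₚ e v))
        unscale : ∀ e⁻¹ → e * e⁻¹ ≈ 1# → v ≋ map (e⁻¹ *_) (map (e *_) v)
        unscale e⁻¹ ee⁻¹ = mk λ i → sym (trans (coeff-scale e⁻¹ (map (e *_) v) i) (trans (*-congˡ (coeff-scale e v i))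
          (trans (sym (*-assoc _ _ _)) (trans (*-congʳ (trans (*-comm _ _) ee⁻¹)) (*-identityˡ _)))))

  record ScaledMonic (p : Poly) : Set (c ⊔ ℓ) where
    field
      lower     : Poly
      scale     : Carrier
      unscale   : Carrier
      inverse   : unscale * scale ≈ 1#
      shorter   : length lower < length p
      p≋        : p ≋ const scale *ₚ monic lower

    monic≋ : monic lower ≋ const unscale *ₚ p
    monic≋ = ≋-sym (≋-trans (*ₚ-cong (≋-refl {const unscale}) p≋) (≋-trans (≋-sym (*ₚ-assoc (const unscale) (const scale) (monic lower)))
      (≋-trans (*ₚ-cong {const unscale *ₚ const scale} {const 1#} {monic lower} (∷-cong (trans (+-identityʳ _) inverse) ≋-refl) ≋-refl) (*ₚ-identityˡ (monic lower)))))

    monic∣ : monic lower ∣ p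
    monic∣ = const scale , p≋

  normalise : ∀ p → ¬ ¬ (p ≋ [] ⊎ ScaledMonic p)
  normalise p = go (length p) p ℕₚ.≤-refl
    where
    go : ∀ n p → length p ≤ n → ¬ ¬ (p ≋ [] ⊎ ScaledMonic p)
    go n p l with initLast p
    ... | [] = return (inj₁ ≋-refl)
    ... | p′ ∷ʳ′ x = em {A = x ≈ 0#} >>= λ where
          (yes x≈0) → smaller n (≡.subst (_≤ n) (length-∷ʳ p′ x) l) (∷ʳ-0 p′ x≈0)
          (no x≉0) → invertible x x≉0 >>= λ (y , xy) → return (inj₂ record
            { lower = map (y *_) p′ ; scale = x ; unscale = y ; inverse = trans (*-comm y x) xy
            ; shorter = ℕₚ.≤-reflexive (≡.trans (≡.cong suc (Listₚ.length-map (y *_) p′)) (≡.sym (length-∷ʳ p′ x)))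
            ; p≋ = ≋-sym (≋-trans (const-*ₚ x (map (y *_) p′ ∷ʳ 1#)) (rescale p′ y xy)) })
      where
      rescale : ∀ p y → x * y ≈ 1# → map (x *_) (map (y *_) p ∷ʳ 1#) ≋ p ∷ʳ x
      rescale []      y xy = ∷-cong (*-identityʳ x) ≋-refl
      rescale (a ∷ p) y xy = ∷-cong (trans (sym (*-assoc x y a)) (trans (*-congʳ xy) (*-identityˡ a))) (rescale p y xy)
      smaller : ∀ n → suc (length p′) ≤ n → p′ ∷ʳ x ≋ p′ → ¬ ¬ (p′ ∷ʳ x ≋ [] ⊎ ScaledMonic (p′ ∷ʳ x))
      smaller (suc n) (s≤s l) e = go n p′ l >>= λ where
        (inj₁ z) → return (inj₁ (≋-trans e z))
        (inj₂ s) → let open ScaledMonic s in return (inj₂ record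
          { lower = lower ; scale = scale ; unscale = unscale ; inverse = inverse
          ; shorter = ℕₚ.<-≤-trans shorter (ℕₚ.≤-trans (ℕₚ.n≤1+n _) (ℕₚ.≤-reflexive (≡.sym (length-∷ʳ p′ x))))
          ; p≋ = ≋-trans e p≋ })

  record ExtendedGCD (a b : Poly) : Set (c ⊔ ℓ) where
    field
      gcd x y : Poly
      bezout  : gcd ≋ x *ₚ a +ₚ y *ₚ b
      gcd∣a   : gcd ∣ a
      gcd∣b   : gcd ∣ b

  extendedGCD : ∀ a b → ¬ ¬ ExtendedGCD a b
  extendedGCD a b = go (length b) a b ℕₚ.≤-refl
    where
    go : ∀ n a b → length b ≤ n → ¬ ¬ ExtendedGCD a b
    go n a b l = normalise b >>= λ where
        (inj₁ b≋0) → return record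
          { gcd = a ; x = const 1# ; y = []
          ; bezout = ≋-sym (≋-trans (+ₚ-identityʳ (const 1# *ₚ a)) (*ₚ-identityˡ a))
          ; gcd∣a = const 1# , ≋-sym (*ₚ-identityˡ a) ; gcd∣b = [] , b≋0 }
        (inj₂ s) → step n l s
      where
      step : ∀ n → length b ≤ n → ScaledMonic b → ¬ ¬ ExtendedGCD a b
      step zero    l s = contradiction (ℕₚ.<-≤-trans (ScaledMonic.shorter s) l) λ ()
      step (suc n) l s with division (ScaledMonic.lower s) a
      ... | q , r , a≋ , len-r = go n b r (ℕₚ.≤-trans len-r (ℕ.s≤s⁻¹ (ℕₚ.<-≤-trans (ScaledMonic.shorter s) l))) >>= λ G →
            let open ScaledMonic s
                open ExtendedGCD G renaming (gcd∣a to g∣b; gcd∣b to g∣r)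
                w , b≋wg = g∣b
                w′ , r≋w′g = g∣r
                t = q *ₚ const unscale
                a≋′ : a ≋ t *ₚ b +ₚ r
                a≋′ = ≋-trans a≋ (+ₚ-cong (≋-trans (*ₚ-cong (≋-refl {q}) monic≋) (≋-sym (*ₚ-assoc q (const unscale) b))) (≋-refl {r}))
            in return record
            { gcd = gcd ; x = y ; y = x +ₚ map -_ (y *ₚ t)
            ; bezout = ≋-trans bezout (≋-trans
                (solve 5 (λ x y b r t → x :* b :+ y :* r := y :* (t :* b :+ r) :+ (x :- y :* t) :* b) ≋-refl x y b r t)
                (+ₚ-cong (*ₚ-cong (≋-refl {y}) (≋-sym a≋′)) (≋-refl {(x +ₚ map -_ (y *ₚ t)) *ₚ b})))
            ; gcd∣a = (t *ₚ w +ₚ w′) , ≋-trans a≋′ (≋-trans (+ₚ-cong (*ₚ-cong (≋-refl {t}) b≋wg) r≋w′g)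
                (solve 4 (λ t w w′ g → t :* (w :* g) :+ w′ :* g := (t :* w :+ w′) :* g) ≋-refl t w w′ gcd))
            ; gcd∣b = g∣b }

  reduced-multiple : ∀ r w low → length r ≤ length low → r ≋ w *ₚ monic low → ¬ ¬ (r ≋ [])
  reduced-multiple r w low l e = cancel-monic low w (λ i l′ → trans (sym (coeffs e i)) (coeff-beyond r i (ℕₚ.≤-trans l l′))) >>= λ w≋0 →
    return (≋-trans e (*ₚ-zeroˡ (monic low) w≋0))

  Coprime : Poly → Poly → Set (c ⊔ ℓ)
  Coprime a b = ∃[ x ] ∃[ y ] x *ₚ a +ₚ y *ₚ b ≋ const 1#

  -- A common monic factor of positive, and then least possible, degree is irreducible.
  record LeastCommonFactor (a b : Poly) : Set (c ⊔ ℓ) where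
    field
      lower       : Poly
      nonconstant : 0 < length lower
      ∣a          : monic lower ∣ a
      ∣b          : monic lower ∣ b
      minimal     : ∀ low → 0 < length low → monic low ∣ a → monic low ∣ b → length lower ≤ length low

  private
    constant-factor : ∀ {g} (s : ScaledMonic g) → length (ScaledMonic.lower s) ≡ 0 → const 1# ≋ const (ScaledMonic.unscale s) *ₚ g
    constant-factor s e = ≋-trans (≋-sym (is-one (ScaledMonic.lower s) e)) (ScaledMonic.monic≋ s)
      where
      is-one : ∀ low → length low ≡ 0 → monic low ≋ const 1#
      is-one [] _ = ≋-refl

    coprime-from : ∀ {a b} (G : ExtendedGCD a b) (s : ScaledMonic (ExtendedGCD.gcd G)) → length (ScaledMonic.lower s) ≡ 0 → Coprime a b
    coprime-from {a} {b} G s e = t *ₚ x , t *ₚ y , ≋-sym (≋-trans (constant-factor s e) (≋-trans (*ₚ-cong (≋-refl {t}) bezout)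
      (solve 5 (λ t x a y b → t :* (x :* a :+ y :* b) := (t :* x) :* a :+ (t :* y) :* b) ≋-refl t x a y b)))
      where
      open ExtendedGCD G
      t = const (ScaledMonic.unscale s)

  leastCommonFactor : ∀ a b → ¬ a ≋ [] → ¬ Coprime a b → ¬ ¬ LeastCommonFactor a b
  leastCommonFactor a b a≉0 ¬coprime = extendedGCD a b >>= λ G → normalise (ExtendedGCD.gcd G) >>= λ where
      (inj₁ g≋0) → let w , e = ExtendedGCD.gcd∣a G in
        contradiction (≋-trans e (≋-trans (*ₚ-cong (≋-refl {w}) g≋0) (*ₚ-zeroʳ w))) a≉0
      (inj₂ s) → pick G s (length (ScaledMonic.lower s)) ≡.refl
    where
    CommonFactorOfDegree : ℕ → Set (c ⊔ ℓ)
    CommonFactorOfDegree n = ∃[ low ] length low ≡ n × 0 < n × monic low ∣ a × monic low ∣ b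
    pick : (G : ExtendedGCD a b) (s : ScaledMonic (ExtendedGCD.gcd G)) → ∀ n → length (ScaledMonic.lower s) ≡ n → ¬ ¬ LeastCommonFactor a b
    pick G s zero    e = contradiction (coprime-from G s e) ¬coprime
    pick G s (suc n) e = least CommonFactorOfDegree (suc n)
        (ScaledMonic.lower s , e , s≤s z≤n , ∣-trans (ScaledMonic.monic∣ s) (ExtendedGCD.gcd∣a G) , ∣-trans (ScaledMonic.monic∣ s) (ExtendedGCD.gcd∣b G))
      >>= λ { (m , (low , ≡.refl , pos , ∣a , ∣b) , min) → return record
        { lower = low ; nonconstant = pos ; ∣a = ∣a ; ∣b = ∣b
        ; minimal = λ low′ pos′ ∣a′ ∣b′ → ℕₚ.≮⇒≥ λ l → min (length low′) l (low′ , ≡.refl , pos′ , ∣a′ , ∣b′) } }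

  record ResidueField (q : Poly) : Set (Level.suc (c ⊔ ℓ)) where
    field
      residueRing      : CommutativeRing c (c ⊔ ℓ)
      isClassicalField : IsClassicalField residueRing
      π                : Hom R[X].rawRing residueRing
    open CommutativeRing residueRing using () renaming (_≈_ to _≈ᴱ_; 0# to 0ᴱ)
    field
      ∣-from : ∀ {p} → Hom.⟦_⟧ π p ≈ᴱ 0ᴱ → q ∣ p
      ∣-to   : ∀ {p} → q ∣ p → Hom.⟦_⟧ π p ≈ᴱ 0ᴱ

  module _ {a b : Poly} (factor : LeastCommonFactor a b) where
    open LeastCommonFactor factor
    private
      q = monic lower
    open QuotientRing polyRing q using (quotientRing; projection; _,_; ∣⇒~0; ~0⇒∣)

    -- A nonconstant gcd of q and a remainder r is again a common factor of a and b, so by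
    -- minimality it is at least as long as q, and its multiple r must vanish. For nonzero r the gcd
    -- is therefore constant, and its Bezout identity supplies the inverse.
    residueField : ResidueField (monic lower)
    residueField = record
      { residueRing = quotientRing ; isClassicalField = record { nontrivial = nontrivial′ ; invertible = invertible′ }
      ; π = projection ; ∣-from = ~0⇒∣ ; ∣-to = ∣⇒~0 }
      where
      module E = CommutativeRing quotientRing
      nontrivial′ : ¬ E.1# E.≈ E.0#
      nontrivial′ z = reduced-multiple (const 1#) (proj₁ (~0⇒∣ z)) lower nonconstant (proj₂ (~0⇒∣ z)) λ e → nontrivial (coeffs e 0)
      invertible′ : ∀ x → ¬ x E.≈ E.0# → ¬ ¬ (∃[ y ] x E.* y E.≈ E.1#)
      invertible′ x x≉0 with division lower x
      ... | s , r , x≋ , len-r = extendedGCD q r >>= λ G → normalise (ExtendedGCD.gcd G) >>= λ where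
            (inj₁ g≋0) → let w , e = ExtendedGCD.gcd∣a G in
              contradiction (coeffs (≋-trans e (≋-trans (*ₚ-cong (≋-refl {w}) g≋0) (*ₚ-zeroʳ w))) (length lower))
                (λ z → nontrivial (trans (sym (monic-top lower)) z))
            (inj₂ t) → pick G t (length (ScaledMonic.lower t)) ≡.refl
        where
        pick : (G : ExtendedGCD q r) (t : ScaledMonic (ExtendedGCD.gcd G)) → ∀ n → length (ScaledMonic.lower t) ≡ n →
          ¬ ¬ (∃[ y ] x E.* y E.≈ E.1#)
        pick G t zero e = let y , z , yq+zr≋1 = coprime-from G t e in return (z , ((z *ₚ s +ₚ map -_ y) ,
          ≋-trans (*ₚ-cong x≋ (≋-refl {z})) (≋-trans
            (solve 5 (λ s q r y z → (s :* q :+ r) :* z := (y :* q :+ z :* r) :+ (z :* s :- y) :* q) ≋-refl s q r y z)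
            (+ₚ-cong yq+zr≋1 ≋-refl))))
        pick G t (suc n) e =
          let g∣q = ∣-trans (ScaledMonic.monic∣ t) (ExtendedGCD.gcd∣a G)
              w , r≋ = ∣-trans (ScaledMonic.monic∣ t) (ExtendedGCD.gcd∣b G)
              low = ScaledMonic.lower t
              d≤ = minimal low (≡.subst (0 <_) (≡.sym e) (s≤s z≤n)) (∣-trans g∣q ∣a) (∣-trans g∣q ∣b)
          in reduced-multiple r w low (ℕₚ.≤-trans len-r d≤) r≋ >>= λ r≋0 →
             contradiction (∣⇒~0 (s , ≋-trans x≋ (≋-trans (+ₚ-cong (≋-refl {s *ₚ q}) r≋0) (+ₚ-identityʳ (s *ₚ q))))) x≉0

-- The multiplier polynomial of period 3

-- Makes equality decidable in iterated polynomial rings over ℤ, so that closed identities are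
-- proved by evaluation through `toWitness`.
module DecidableEquality (A : RawRing c ℓ) (0≈0 : RawRing._≈_ A (RawRing.0# A) (RawRing.0# A))
  (_≟_ : Decidable (RawRing._≈_ A)) where
  open RawRing A
  open Polynomial A

  private
    both : ∀ {p q} → Dec (coeff p 0 ≈ coeff q 0) → Dec (∀ i → coeff p (suc i) ≈ coeff q (suc i)) → Dec (p ≈ₚ q)
    both (yes e) (yes f) = yes λ { zero → e ; (suc i) → f i }
    both (no ¬e) _       = no λ e → ¬e (e 0)
    both (yes _) (no ¬f) = no λ e → ¬f (λ i → e (suc i))

  infix 4 _≟ₚ_
  _≟ₚ_ : Decidable _≈ₚ_
  []      ≟ₚ []      = yes λ i → 0≈0
  []      ≟ₚ (y ∷ q) = both {[]} {y ∷ q} (0# ≟ y) ([] ≟ₚ q)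
  (x ∷ p) ≟ₚ []      = both {x ∷ p} {[]} (x ≟ 0#) (p ≟ₚ [])
  (x ∷ p) ≟ₚ (y ∷ q) = both {x ∷ p} {y ∷ q} (x ≟ y) (p ≟ₚ q)

private
  module Dec-ℤ[c]       = DecidableEquality ℤ-rawRing ≡.refl ℤₚ._≟_
  module Dec-ℤ[c][z]    = DecidableEquality ℤ[c] (λ _ → ≡.refl) Dec-ℤ[c]._≟ₚ_
  module Dec-ℤ[c][x][z] = DecidableEquality ℤ[c][z] (λ _ _ → ≡.refl) Dec-ℤ[c][z]._≟ₚ_

fromℤHom : (S : CommutativeRing c ℓ) → Hom ℤ-rawRing S
fromℤHom S = record
  { ⟦_⟧ = fromℤ ; ⟦⟧-cong = λ { ≡.refl → refl } ; +-homo = fromℤ-+ ; *-homo = fromℤ-*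
  ; neg-homo = fromℤ-neg ; 0-homo = refl ; 1-homo = refl }
  where
  open FromIntegers S
  open CommutativeRing S using (refl)

-- The quotient (f³(z) - z)/(f(z) - z). The outer list runs over powers of z, the inner lists over
-- powers of c.
Φ₃ : Pℤ[c].Poly
Φ₃ = (+ 1 ∷ + 1 ∷ + 2 ∷ + 1 ∷ []) ∷ (+ 1 ∷ + 2 ∷ + 1 ∷ []) ∷ (+ 1 ∷ + 3 ∷ + 3 ∷ []) ∷ (+ 1 ∷ + 2 ∷ []) ∷
  (+ 1 ∷ + 3 ∷ []) ∷ (+ 1 ∷ []) ∷ (+ 1 ∷ []) ∷ []

-- δ₃(x, c) = x² - (8c + 16)x + 64c³ + 128c² + 64c + 64
δ₃ : Pℤ[c].Poly
δ₃ = (+ 64 ∷ + 64 ∷ + 128 ∷ + 64 ∷ []) ∷ (-[1+ 15 ] ∷ -[1+ 7 ] ∷ []) ∷ (+ 1 ∷ []) ∷ []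

x-f₃′ : Pℤ[c][x].Poly
x-f₃′ = Pℤ[c][x].const Pℤ[c].X Pℤ[c][x].+ₚ map (Rℤ[c][z].-_ ∘ Pℤ[c].const) (Pℤ[c].derivative (iterate-f 3))

-- With g = (f³)′, the remainder of δ₃(x) - δ₃(g) = (x - g)(x + g - 8c - 16) is δ₃(g), a multiple of Φ₃.
bezoutΦ bezout-f′ : Pℤ[c][x].Poly
bezoutΦ = map Pℤ[c].const
  ((+ 64 ∷ []) ∷ (-[1+ 63 ] ∷ -[1+ 63 ] ∷ []) ∷ (+ 0 ∷ + 0 ∷ + 0 ∷ + 64 ∷ []) ∷ (+ 0 ∷ + 0 ∷ -[1+ 63 ] ∷ []) ∷
   (+ 0 ∷ + 0 ∷ + 192 ∷ []) ∷ (+ 0 ∷ -[1+ 127 ] ∷ []) ∷ (+ 0 ∷ + 192 ∷ []) ∷ (-[1+ 63 ] ∷ []) ∷ (+ 64 ∷ []) ∷ [])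
bezout-f′ = Pℤ[c][x].const ((-[1+ 15 ] ∷ -[1+ 7 ] ∷ []) ∷ (+ 1 ∷ []) ∷ []) Pℤ[c][x].+ₚ
  map Pℤ[c].const (Pℤ[c].derivative (iterate-f 3))

bezout-Φ₃ : (bezoutΦ Pℤ[c][x].*ₚ map Pℤ[c].const Φ₃) Pℤ[c][x].+ₚ (bezout-f′ Pℤ[c][x].*ₚ x-f₃′)
  Pℤ[c][x].≈ₚ Pℤ[c][x].const δ₃
bezout-Φ₃ = toWitness
  {a? = (bezoutΦ Pℤ[c][x].*ₚ map Pℤ[c].const Φ₃) Pℤ[c][x].+ₚ (bezout-f′ Pℤ[c][x].*ₚ x-f₃′) Dec-ℤ[c][x][z].≟ₚ Pℤ[c][x].const δ₃} _

f-z f³-z : Pℤ[c].Poly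
f-z  = iterate-f 1 Rℤ[c][z].+ (Rℤ[c][z].- Pℤ[c].X)
f³-z = iterate-f 3 Rℤ[c][z].+ (Rℤ[c][z].- Pℤ[c].X)

Φ₃-dynatomic : IsDynatomic 3 Φ₃
Φ₃-dynatomic = toWitness {a? = Φ₃ Rℤ[c][z].* (f-z Rℤ[c][z].* Rℤ[c][z].1#) Dec-ℤ[c][z].≟ₚ f³-z Rℤ[c][z].* Rℤ[c][z].1#} _

-- The defining relation multiplies Φ by f(z) - z = z² - z + c, which is monic in z and can be
-- cancelled. This happens in the ring `ℤ[C][Z]`, and decidability of equality in ℤ removes the
-- double negation.
Φ₃-unique : ∀ Φ → IsDynatomic 3 Φ → Φ Rℤ[c][z].≈ Φ₃
Φ₃-unique Φ dyn i j = decidable-stable (_ ℤₚ.≟ _) (cancel-regular 2 f regular vanishes d (λ i _ → coeffs product i) >>= λ d≋[] →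
    return (equal d≋[]))
  where
  module ℤ[C]    = PolynomialRing ℤₚ.+-*-commutativeRing
  module ℤ[C][Z] = PolynomialRing ℤ[C].polyRing
  open ℤ[C][Z]
  open PolynomialCancellation ℤ[C].polyRing
  open FromIntegers polyRing using (solve; _:=_; _:+_; _:*_; _:-_; :-_)
  idℤ : Hom ℤ-rawRing ℤₚ.+-*-commutativeRing
  idℤ = record { ⟦_⟧ = λ i → i ; ⟦⟧-cong = λ e → e ; +-homo = λ _ _ → ≡.refl ; *-homo = λ _ _ → ≡.refl
    ; neg-homo = λ _ → ≡.refl ; 0-homo = ≡.refl ; 1-homo = ≡.refl }
  κ : Hom ℤ[c] ℤ[C].polyRing
  κ = mapHom idℤ
  module κ = Hom κ
  module κ₂ = Hom (mapHom κ)
  f-z·1 = f-z Rℤ[c][z].* Rℤ[c][z].1#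
  f³-z·1 = f³-z Rℤ[c][z].* Rℤ[c][z].1#
  f = κ₂.⟦ f-z·1 ⟧
  d = κ₂.⟦ Φ ⟧ +ₚ R[X].- κ₂.⟦ Φ₃ ⟧
  regular : ∀ x → x ℤ[C].*ₚ coeff f 2 ℤ[C].≋ [] → ¬ ¬ (x ℤ[C].≋ [])
  regular x e = return (ℤ[C].≋-trans (ℤ[C].≋-sym (ℤ[C].≋-trans
    (ℤ[C].*ₚ-cong {x} {x} {coeff f 2} {ℤ[C].const (+ 1)} ℤ[C].≋-refl (ℤ[C].mk (toWitness {a? = coeff f 2 Dec-ℤ[c].≟ₚ ℤ[C].const (+ 1)} _)))
    (CommutativeRing.*-identityʳ ℤ[C].polyRing x))) e)
  vanishes : VanishesAbove 2 f
  vanishes 0 ()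
  vanishes 1 (s≤s ())
  vanishes 2 (s≤s (s≤s ()))
  vanishes 3 _ = ℤ[C].mk (toWitness {a? = coeff f 3 Dec-ℤ[c].≟ₚ []} _)
  vanishes (suc (suc (suc (suc i)))) _ = ℤ[C].≋-refl
  product : d *ₚ f ≋ []
  product = ≋-trans (solve 3 (λ a b f → (a :- b) :* f := a :* f :- b :* f) ≋-refl κ₂.⟦ Φ ⟧ κ₂.⟦ Φ₃ ⟧ f)
    (≋-trans (+ₚ-cong (≋-trans (≋-sym (κ₂.*-homo Φ f-z·1)) (κ₂.⟦⟧-cong {Φ Rℤ[c][z].* f-z·1} {f³-z·1} dyn))
                      (negₚ-cong (≋-trans (≋-sym (κ₂.*-homo Φ₃ f-z·1)) (κ₂.⟦⟧-cong {Φ₃ Rℤ[c][z].* f-z·1} {f³-z·1} Φ₃-dynatomic))))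
      (R[X].-‿inverseʳ κ₂.⟦ f³-z·1 ⟧))
  coeff-κ : ∀ Φ → Pℤ.coeff (Pℤ[c].coeff Φ i) j ≡ ℤ[C].coeff (coeff κ₂.⟦ Φ ⟧ i) j
  coeff-κ Φ = ≡.sym (≡.trans (ℤ[C].coeffs (coeff-map κ Φ i) j) (coeff-map idℤ (Pℤ[c].coeff Φ i) j))
  equal : d ≋ [] → Pℤ.coeff (Pℤ[c].coeff Φ i) j ≡ Pℤ.coeff (Pℤ[c].coeff Φ₃ i) j
  equal d≋[] = ≡.trans (coeff-κ Φ) (≡.trans (ℤ[C].coeffs (coeffs
    (≋-trans (solve 2 (λ a b → a := (a :- b) :+ b) ≋-refl κ₂.⟦ Φ ⟧ κ₂.⟦ Φ₃ ⟧) (+ₚ-cong {d} d≋[] (≋-refl {κ₂.⟦ Φ₃ ⟧}))) i) j) (≡.sym (coeff-κ Φ₃)))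

module _ {A : RawRing r₁ ℓ₁} {S : CommutativeRing r₂ ℓ₂} (ψ : Hom A S) where
  private
    module A = RawRing A
    module S = CommutativeRing S
    module PA = Polynomial A
    module PS = PolynomialRing S
  open Hom ψ

  coeff-shift-map : ∀ e p k → PS.coeff (PS.shift e (map ⟦_⟧ p)) k S.≈ ⟦ PA.coeff (PA.shift e p) k ⟧
  coeff-shift-map zero    p k       = coeff-map ψ p k
  coeff-shift-map (suc e) p zero    = S.sym 0-homo
  coeff-shift-map (suc e) p (suc k) = coeff-shift-map e p k

  resultant-homo : ∀ m n p q →
    Determinant.det S.rawRing (PS.sylvester m n (map ⟦_⟧ p) (map ⟦_⟧ q)) S.≈ ⟦ Determinant.det A (PA.sylvester m n p q) ⟧
  resultant-homo m n p q = S.trans (DeterminantProperties.det-cong S λ i j → entry i j) (det-homo ψ (PA.sylvester m n p q))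
    where
    entry : ∀ i j → PS.sylvester m n (map ⟦_⟧ p) (map ⟦_⟧ q) i j S.≈ ⟦ PA.sylvester m n p q i j ⟧
    entry i j with splitAt n i
    ... | inj₁ r = coeff-shift-map (toℕ (opposite r)) p (toℕ (opposite j))
    ... | inj₂ r = coeff-shift-map (toℕ (opposite r)) q (toℕ (opposite j))

  vanishes-map : ∀ n p → (∀ i → n < i → PA.coeff p i A.≈ A.0#) → PS.VanishesAbove n (map ⟦_⟧ p)
  vanishes-map n p v i l = S.trans (coeff-map ψ p i) (S.trans (⟦⟧-cong (v i l)) 0-homo)

module _ {E : CommutativeRing c ℓ} (field′ : IsClassicalField E) (ψ : Hom ℤ[c][z] E) where
  open CommutativeRing E hiding (zero; _-_)
  open IsClassicalField field′
  open PolynomialRing E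
  open ClassicalPolynomials field′
  open Hom ψ

  -- δ is known only through δ³ being the resultant of Φ and x - (f³)′. Where δ vanishes, so does
  -- the resultant, whereas `bezout-Φ₃` makes it nonzero at points where δ₃ does not vanish. Only
  -- zeros are compared: δ = δ₃ is never established.
  multiplier-root : ∀ δ → IsMultiplierPolynomial 3 δ → ⟦ δ ⟧ ≈ 0# → ¬ ¬ (⟦ δ₃ ⟧ ≈ 0#)
  multiplier-root δ (_ , Φ , dyn , m , n , (m-top , m-deg) , (_ , n-deg) , δ³≈det) δ≈0 δ₃≉0 =
    bezout⇒det≉0 m n (map ⟦_⟧ Φ′) (map ⟦_⟧ x-f₃′) top (vanishes-map ψ m Φ′ m-deg) (vanishes-map ψ n x-f₃′ n-deg)
      (map ⟦_⟧ bezoutΦ) (map ⟦_⟧ bezout-f′) ⟦ δ₃ ⟧ bezout δ₃≉0 det≈0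
    where
    Φ′ = map Pℤ[c].const Φ
    module Ψ = Hom (mapHom ψ)
    coeff-const : ∀ (p : Pℤ[c].Poly) i → Pℤ[c][x].coeff (map Pℤ[c].const p) i Rℤ[c][z].≈ Pℤ[c].const (Pℤ[c].coeff p i)
    coeff-const []      i       zero    j = ≡.refl
    coeff-const []      i       (suc _) j = ≡.refl
    coeff-const (x ∷ p) zero    k       j = ≡.refl
    coeff-const (x ∷ p) (suc i) k       j = coeff-const p i k j
    Φ′≈ : ∀ i → Pℤ[c][x].coeff Φ′ i Rℤ[c][z].≈ Pℤ[c].const (Pℤ[c].coeff Φ₃ i)
    Φ′≈ i zero    j = ≡.trans (coeff-const Φ i zero j) (Φ₃-unique Φ dyn i j)
    Φ′≈ i (suc k) j = coeff-const Φ i (suc k) j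
    beyond : ∀ m → 6 < m → Pℤ[c].const (Pℤ[c].coeff Φ₃ m) Rℤ[c][z].≈ []
    beyond (suc (suc (suc (suc (suc (suc (suc m))))))) _ zero    j = ≡.refl
    beyond (suc (suc (suc (suc (suc (suc (suc m))))))) _ (suc k) j = ≡.refl
    beyond 0 ()
    beyond 1 (s≤s ())
    beyond 2 (s≤s (s≤s ()))
    beyond 3 (s≤s (s≤s (s≤s ())))
    beyond 4 (s≤s (s≤s (s≤s (s≤s ()))))
    beyond 5 (s≤s (s≤s (s≤s (s≤s (s≤s ())))))
    beyond 6 (s≤s (s≤s (s≤s (s≤s (s≤s (s≤s ()))))))
    -- The degree in `IsResultant` is existentially quantified. Comparison with `Φ₃` pins it to 6,
    -- where the coefficient is 1 and survives the specialisation.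
    m≡6 : m ≡ 6
    m≡6 with ℕₚ.<-cmp m 6
    ... | tri≈ _ e _ = e
    ... | tri< l _ _ = contradiction (≡.trans (≡.sym (m-deg 6 l 0 0)) (Φ′≈ 6 0 0)) λ ()
    ... | tri> _ _ l = contradiction (λ k j → ≡.trans (Φ′≈ m k j) (beyond m l k j)) m-top
    top : ¬ coeff (map ⟦_⟧ Φ′) m ≈ 0#
    top e = nontrivial (trans (sym 1-homo) (trans (sym (trans (coeff-map ψ Φ′ 6) (⟦⟧-cong (Φ′≈ 6))))
      (≡.subst (λ m → coeff (map ⟦_⟧ Φ′) m ≈ 0#) m≡6 e)))
    bezout : map ⟦_⟧ bezoutΦ *ₚ map ⟦_⟧ Φ′ +ₚ map ⟦_⟧ bezout-f′ *ₚ map ⟦_⟧ x-f₃′ ≋ const ⟦ δ₃ ⟧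
    bezout = ≋-trans (+ₚ-cong
        (≋-trans (*ₚ-cong (≋-refl {map ⟦_⟧ bezoutΦ}) (Ψ.⟦⟧-cong {Φ′} {map Pℤ[c].const Φ₃} λ i k j → ≡.trans (Φ′≈ i k j) (≡.sym (coeff-const Φ₃ i k j))))
                 (≋-sym (Ψ.*-homo bezoutΦ (map Pℤ[c].const Φ₃))))
        (≋-sym (Ψ.*-homo bezout-f′ x-f₃′)))
      (≋-trans (≋-sym (Ψ.+-homo (bezoutΦ Pℤ[c][x].*ₚ map Pℤ[c].const Φ₃) (bezout-f′ Pℤ[c][x].*ₚ x-f₃′))) (Ψ.⟦⟧-cong bezout-Φ₃))
    det≈0 : Determinant.det rawRing (sylvester m n (map ⟦_⟧ Φ′) (map ⟦_⟧ x-f₃′)) ≈ 0#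
    det≈0 = trans (resultant-homo ψ m n Φ′ x-f₃′) (trans (⟦⟧-cong (λ i j → ≡.sym (δ³≈det i j)))
      (trans (*-homo δ (δ ^ˣ 2)) (trans (*-congʳ δ≈0) (zeroˡ _))))

module _ {F : CommutativeRing c ℓ} (field′ : IsClassicalField F) where
  open CommutativeRing F hiding (zero; _-_)
  open IsClassicalField field′
  open PolynomialRing F
  open PolynomialCancellation F
  open ClassicalPolynomials field′
  open FromIntegers F using (fromℤ)
  open import Algebra.Definitions.RawSemiring (RawRing.rawSemiring R[X].rawRing) using (_^_)
  private
    module S = FromIntegers polyRing
    module ρ = Hom (mapHom (fromℤHom F))
  open import Data.List.Membership.Propositional using (_∈_)
  open import Data.List.Membership.Propositional.Properties using (∈-filter⁺; ∈-map⁺; ∈-applyUpTo⁺)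
  open import Data.List.Relation.Unary.Any using (here; there)
  open import Data.Nat.Divisibility using (_∣?_; ∣-refl; 1∣_)
  open DivisorProducts ℤ[c] using (∏)

  X*ₚ : ∀ p → X *ₚ p ≋ 0# ∷ p
  X*ₚ p = ≋-trans (0∷-*ₚ (const 1#) p) (∷-cong refl (*ₚ-identityˡ p))

  geometric : ∀ k → (X +ₚ R[X].- const 1#) *ₚ replicate k 1# ≋ X ^ k +ₚ R[X].- const 1#
  geometric zero    = ≋-trans (*ₚ-zeroʳ (X +ₚ R[X].- const 1#)) (≋-sym (R[X].-‿inverseʳ (const 1#)))
  geometric (suc k) = ≋-trans (*ₚ-cong (≋-refl {X-1}) (≋-trans (∷-cong (sym (+-identityʳ 1#)) ≋-refl) (+ₚ-cong (≋-refl {const 1#}) (≋-sym (X*ₚ g)))))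
    (≋-trans (S.solve 2 (λ x g → (x S.:- S.con (+ 1)) S.:* (S.con (+ 1) S.:+ x S.:* g) S.:=
                 (x S.:- S.con (+ 1)) S.:+ x S.:* ((x S.:- S.con (+ 1)) S.:* g)) ≋-refl X g)
      (≋-trans (+ₚ-cong (≋-refl {X-1}) (*ₚ-cong (≋-refl {X}) (geometric k)))
        (S.solve 2 (λ x y → (x S.:- S.con (+ 1)) S.:+ x S.:* (y S.:- S.con (+ 1)) S.:= x S.:* y S.:- S.con (+ 1)) ≋-refl X (X ^ k))))
    where
    g = replicate k 1#
    X-1 = X +ₚ R[X].- const 1#

  factor-∏ : ∀ (Ψ : ℕ → Pℤ.Poly) {d ds} → d ∈ ds → ∃[ r ] ρ.⟦ ∏ (map Ψ ds) ⟧ ≋ r *ₚ ρ.⟦ Ψ d ⟧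
  factor-∏ Ψ {ds = d ∷ ds} (here ≡.refl) = ρ.⟦ ∏ (map Ψ ds) ⟧ ,
    ≋-trans (ρ.*-homo (Ψ d) (∏ (map Ψ ds))) (*ₚ-comm ρ.⟦ Ψ d ⟧ ρ.⟦ ∏ (map Ψ ds) ⟧)
  factor-∏ Ψ {d} {e ∷ ds} (there d∈) = let r , eq = factor-∏ Ψ d∈ in ρ.⟦ Ψ e ⟧ *ₚ r ,
    ≋-trans (ρ.*-homo (Ψ e) (∏ (map Ψ ds))) (≋-trans (*ₚ-cong (≋-refl {ρ.⟦ Ψ e ⟧}) eq) (≋-sym (*ₚ-assoc ρ.⟦ Ψ e ⟧ r ρ.⟦ Ψ d ⟧)))

  -- For k ≥ 2 both Ψ₁ = x - 1 and Ψₖ occur in the factorisation of xᵏ - 1.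
  cyclotomic∣geometric : ∀ Ψ → IsCyclotomicFamily Ψ → ∀ k → 2 ≤ k → ¬ ¬ (map fromℤ (Ψ k) ∣ replicate k 1#)
  cyclotomic∣geometric Ψ cyc 1 (s≤s ())
  cyclotomic∣geometric Ψ cyc k@(suc (suc k′)) _ =
    -- Both products with the monic polynomial X - 1 are Xᵏ - 1, so X - 1 cancels.
    cancel-monic low (r *ₚ Ψₖ +ₚ R[X].- G) (λ i _ → coeffs zero-product i) >>= λ e → return (r ,
      ≋-trans (S.solve 2 (λ a b → a S.:= b S.:- (b S.:- a)) ≋-refl G (r *ₚ Ψₖ))
        (≋-trans (+ₚ-cong (≋-refl {r *ₚ Ψₖ}) (negₚ-cong e)) (+ₚ-identityʳ (r *ₚ Ψₖ))))
    where
    G = replicate k 1#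
    Ψₖ = ρ.⟦ Ψ k ⟧
    X-1 = X +ₚ R[X].- const 1#
    low = (- 1#) ∷ []
    X-1≋monic : X-1 ≋ monic low
    X-1≋monic = ∷-cong (+-identityˡ _) ≋-refl
    rest = filter (_∣? k) (map suc (applyUpTo suc (suc k′)))
    divisors : filter (_∣? k) (map suc (upTo k)) ≡ 1 ∷ rest
    divisors = Listₚ.filter-accept (_∣? k) (1∣ k)
    factor : ∃[ r ] ρ.⟦ ∏ (map Ψ rest) ⟧ ≋ r *ₚ Ψₖ
    factor = factor-∏ Ψ (∈-filter⁺ (_∣? k) (∈-map⁺ suc (∈-applyUpTo⁺ suc (ℕₚ.n<1+n k′))) ∣-refl)
    r = proj₁ factor
    ρ-power : ∀ n → ρ.⟦ (Pℤ.X ^ᶜ n) Rℤ[c].+ (Rℤ[c].- Rℤ[c].1#) ⟧ ≋ X ^ n +ₚ R[X].- const 1#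
    ρ-power n = ≋-trans (ρ.+-homo (Pℤ.X ^ᶜ n) (Rℤ[c].- Rℤ[c].1#)) (+ₚ-cong (^-homo (mapHom (fromℤHom F)) Pℤ.X n) ≋-refl)
    Ψ₁ : ρ.⟦ Ψ 1 ⟧ ≋ X-1
    Ψ₁ = ≋-trans (≋-sym (R[X].*-identityʳ ρ.⟦ Ψ 1 ⟧)) (≋-trans (≋-sym (ρ.*-homo (Ψ 1) Rℤ[c].1#))
      (≋-trans (ρ.⟦⟧-cong (cyc 1)) (≋-trans (ρ-power 1) (+ₚ-cong (R[X].*-identityʳ X) (≋-refl {R[X].- const 1#})))))
    product : X-1 *ₚ (r *ₚ Ψₖ) ≋ X-1 *ₚ G
    product = ≋-trans (*ₚ-cong (≋-sym Ψ₁) (≋-sym (proj₂ factor))) (≋-trans (≋-sym (ρ.*-homo (Ψ 1) (∏ (map Ψ rest))))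
      (≋-trans (R[X].reflexive (≡.cong (λ ds → ρ.⟦ ∏ (map Ψ ds) ⟧) (≡.sym divisors)))
        (≋-trans (ρ.⟦⟧-cong (cyc k)) (≋-trans (ρ-power k) (≋-sym (geometric k))))))
    zero-product : (r *ₚ Ψₖ +ₚ R[X].- G) *ₚ monic low ≋ []
    zero-product = ≋-trans (*ₚ-cong (≋-refl {r *ₚ Ψₖ +ₚ R[X].- G}) (≋-sym X-1≋monic))
      (≋-trans (S.solve 3 (λ a g x → (a S.:- g) S.:* x S.:= x S.:* a S.:- x S.:* g) ≋-refl (r *ₚ Ψₖ) G X-1)
        (≋-trans (+ₚ-cong product ≋-refl) (R[X].-‿inverseʳ (X-1 *ₚ G))))

  module _ (characteristic-0 : ∀ i → i ≢ + 0 → ¬ fromℤ i ≈ 0#) (c : Carrier) where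

    evalAt : Hom ℤ[c] F
    evalAt = evalHom c ∘ʰ mapHom (fromℤHom F)

    private
      module c = Hom evalAt

    evalAt-const : ∀ (p : Pℤ.Poly) → map c.⟦_⟧ (map Pℤ.const p) ≋ map fromℤ p
    evalAt-const []      = ≋-refl
    evalAt-const (i ∷ p) = ∷-cong (eval-const c (fromℤ i)) (evalAt-const p)

    -- This is `bezout⇒det≉0` with right-hand side 1. Characteristic 0 keeps the integral leading
    -- coefficient of p from vanishing in F.
    resultant⇒¬Coprime : ∀ p q Δ → Pℤ[c].IsResultant (map Pℤ.const p) q Δ → c.⟦ Δ ⟧ ≈ 0# →
      ¬ map fromℤ p ≋ [] × ¬ Coprime (map fromℤ p) (map c.⟦_⟧ q)
    resultant⇒¬Coprime p q Δ (m , n , (m-top , m-deg) , (_ , n-deg) , Δ≈) Δ≈0 =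
        (λ p≋[] → top (trans (coeffs (evalAt-const p) m) (coeffs p≋[] m)))
      , λ (a , b , e) → bezout⇒det≉0 m n (map c.⟦_⟧ (map Pℤ.const p)) (map c.⟦_⟧ q) top
          (vanishes-map evalAt m (map Pℤ.const p) m-deg) (vanishes-map evalAt n q n-deg) a b 1#
          (≋-trans (+ₚ-cong (*ₚ-cong (≋-refl {a}) (evalAt-const p)) (≋-refl {b *ₚ map c.⟦_⟧ q})) e) nontrivial
          (trans (resultant-homo evalAt m n (map Pℤ.const p) q) (trans (c.⟦⟧-cong {Determinant.det ℤ[c] (Pℤ[c].sylvester m n (map Pℤ.const p) q)} {Δ} (λ i → ≡.sym (Δ≈ i))) Δ≈0))
      where
      coeff-const : ∀ (p : Pℤ.Poly) i → Pℤ[c].coeff (map Pℤ.const p) i Rℤ[c].≈ Pℤ.const (Pℤ.coeff p i)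
      coeff-const []      i       zero    = ≡.refl
      coeff-const []      i       (suc _) = ≡.refl
      coeff-const (x ∷ p) zero    k       = ≡.refl
      coeff-const (x ∷ p) (suc i) k       = coeff-const p i k
      const≈0 : ∀ {i} → i ≡ + 0 → Pℤ.const i Rℤ[c].≈ []
      const≈0 ≡.refl zero    = ≡.refl
      const≈0 ≡.refl (suc k) = ≡.refl
      top : ¬ coeff (map c.⟦_⟧ (map Pℤ.const p)) m ≈ 0#
      top e = characteristic-0 (Pℤ.coeff p m)
        (λ z → m-top λ k → ≡.trans (coeff-const p m k) (const≈0 z k))
        (trans (sym (coeff-map (fromℤHom F) p m)) (trans (sym (coeffs (evalAt-const p) m)) e))

-- Integrality

Characteristic0 : CommutativeRing c ℓ → Set ℓ
Characteristic0 R = ∀ i → i ≢ + 0 → ¬ fromℤ i ≈ 0#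
  where
  open CommutativeRing R
  open FromIntegers R

characteristic-0-extension : ∀ {c₁ ℓ₁ c₂ ℓ₂} {F : CommutativeRing c₁ ℓ₁} {E : CommutativeRing c₂ ℓ₂} →
  IsClassicalField F → Characteristic0 F → Hom (CommutativeRing.rawRing F) E →
  ¬ CommutativeRing._≈_ E (CommutativeRing.1# E) (CommutativeRing.0# E) → Characteristic0 E
characteristic-0-extension {F = F} {E} F-field char-0 φ 1≉0 i i≢0 i≈0 =
  IsClassicalField.invertible F-field (FromIntegers.fromℤ F i) (char-0 i i≢0) λ (y , iy≈1) →
    1≉0 (trans (sym 1-homo) (trans (⟦⟧-cong (F.sym iy≈1)) (trans (*-homo _ y)
      (trans (*-congʳ (trans (fromℤ-homo {R = F} φ i) i≈0)) (zeroˡ _)))))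
  where
  open Hom φ
  open CommutativeRing E
  module F = CommutativeRing F

module _ {R : CommutativeRing c ℓ} (characteristic-0 : Characteristic0 R) where
  open CommutativeRing R hiding (zero)
  open FromIntegers R
  open import Algebra.Definitions.RawSemiring (RawRing.rawSemiring rawRing) using (_^_)

  integer-not-rootOfUnity : ∀ b k → 2 ≤ b → 0 < k → ¬ fromℤ (+ b) ^ k ≈ 1#
  integer-not-rootOfUnity b k 2≤b 0<k e = characteristic-0 ((+ b) ℤ.^ k ℤ.- + 1) (b^k≢1 k 0<k)
    (trans (fromℤ-+ ((+ b) ℤ.^ k) -[1+ 0 ]) (trans (+-congʳ (trans (sym (fromℤ-^ k)) e)) (-‿inverseʳ 1#)))
    where
    fromℤ-^ : ∀ n → fromℤ (+ b) ^ n ≈ fromℤ ((+ b) ℤ.^ n)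
    fromℤ-^ zero    = refl
    fromℤ-^ (suc n) = trans (*-congˡ (fromℤ-^ n)) (sym (fromℤ-* (+ b) ((+ b) ℤ.^ n)))
    b^k≢1 : ∀ k → 0 < k → (+ b) ℤ.^ k ℤ.- + 1 ≢ + 0
    b^k≢1 (suc k) _ eq = contradiction (≡.subst (2 ≤_) (ℕₚ.m*n≡1⇒m≡1 b ℤ.∣ (+ b) ℤ.^ k ∣
      (≡.trans (≡.sym (ℤₚ.abs-* (+ b) ((+ b) ℤ.^ k))) (≡.cong ℤ.∣_∣ (ℤₚ.i-j≡0⇒i≡j ((+ b) ℤ.^ suc k) (+ 1) eq)))) 2≤b) λ { (s≤s ()) }

module Lattices (R : CommutativeRing c ℓ) where
  open CommutativeRing R hiding (zero)
  open FromIntegers R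
  open import Algebra.Definitions.RawSemiring (RawRing.rawSemiring rawRing) using (_^_)

  data Span : List Carrier → Carrier → Set (c ⊔ ℓ) where
    nil  : ∀ {x} → x ≈ 0# → Span [] x
    cons : ∀ {v V x} m y → Span V y → x ≈ fromℤ m * v + y → Span (v ∷ V) x

  span-cong : ∀ {V x y} → x ≈ y → Span V x → Span V y
  span-cong e (nil f)        = nil (trans (sym e) f)
  span-cong e (cons m y s f) = cons m y s (trans (sym e) f)

  span-weaken : ∀ {v V x} → Span V x → Span (v ∷ V) x
  span-weaken {v} {V} {x} s = cons (+ 0) x s (sym (trans (+-congʳ (zeroˡ v)) (+-identityˡ x)))

  span-0 : ∀ {V} → Span V 0#
  span-0 {[]}    = nil refl
  span-0 {v ∷ V} = span-weaken span-0

  span-head : ∀ {v V} → Span (v ∷ V) v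
  span-head {v} = cons (+ 1) 0# span-0 (sym (trans (+-identityʳ _) (*-identityˡ v)))

  span-+ : ∀ {V x y} → Span V x → Span V y → Span V (x + y)
  span-+ (nil e) (nil f) = nil (trans (+-cong e f) (+-identityʳ 0#))
  span-+ {v ∷ V} (cons m y s e) (cons m′ y′ s′ e′) = cons (m ℤ.+ m′) (y + y′) (span-+ s s′)
    (trans (+-cong e e′) (trans
      (solve 5 (λ m m′ v y y′ → (m :* v :+ y) :+ (m′ :* v :+ y′) := (m :+ m′) :* v :+ (y :+ y′)) refl (fromℤ m) (fromℤ m′) v y y′)
      (+-congʳ (*-congʳ (sym (fromℤ-+ m m′))))))

  span-scale : ∀ {V x} n → Span V x → Span V (fromℤ n * x)
  span-scale n (nil e) = nil (trans (*-congˡ e) (zeroʳ _))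
  span-scale {v ∷ V} n (cons m y s e) = cons (n ℤ.* m) (fromℤ n * y) (span-scale n s)
    (trans (*-congˡ e) (trans (solve 4 (λ n m v y → n :* (m :* v :+ y) := (n :* m) :* v :+ n :* y) refl (fromℤ n) (fromℤ m) v y)
      (+-congʳ (*-congʳ (sym (fromℤ-* n m))))))

  span-++ˡ : ∀ {V x} W → Span V x → Span (V ++ W) x
  span-++ˡ W (nil e)        = span-cong (sym e) span-0
  span-++ˡ W (cons m y s e) = cons m y (span-++ˡ W s) e

  span-++ʳ : ∀ V {W x} → Span W x → Span (V ++ W) x
  span-++ʳ []      s = s
  span-++ʳ (v ∷ V) s = span-weaken (span-++ʳ V s)

  span-map : ∀ {V x} y → Span V x → Span (map (y *_) V) (y * x)
  span-map y (nil e) = nil (trans (*-congˡ e) (zeroʳ y))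
  span-map {v ∷ V} y (cons m z s e) = cons m (y * z) (span-map y s)
    (trans (*-congˡ e) (solve 4 (λ y m v z → y :* (m :* v :+ z) := m :* (y :* v) :+ y :* z) refl y (fromℤ m) v z))

  span-map⁻ : ∀ V {x} y → Span (map (y *_) V) x → ∃[ z ] Span V z × x ≈ y * z
  span-map⁻ []      y (nil e) = 0# , nil refl , trans e (sym (zeroʳ y))
  span-map⁻ (v ∷ V) y (cons m w s e) with span-map⁻ V y s
  ... | z , t , w≈ = fromℤ m * v + z , cons m z t refl , trans e (trans (+-congˡ w≈)
        (solve 4 (λ y m v z → m :* (y :* v) :+ y :* z := y :* (m :* v :+ z)) refl y (fromℤ m) v z))

  span-++⁻ : ∀ V {W x} → Span (V ++ W) x → ∃[ y ] ∃[ z ] Span V y × Span W z × x ≈ y + z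
  span-++⁻ []      {x = x} s = 0# , x , nil refl , s , sym (+-identityˡ x)
  span-++⁻ (v ∷ V) (cons m w s e) with span-++⁻ V s
  ... | y , z , s₁ , s₂ , w≈ = fromℤ m * v + y , z , cons m y s₁ refl , s₂ ,
        trans e (trans (+-congˡ w≈) (sym (+-assoc _ y z)))

  Stable : List Carrier → Carrier → Set (c ⊔ ℓ)
  Stable V a = ∀ {x} → Span V x → Span V (a * x)

  stable-cong : ∀ {V a b} → a ≈ b → Stable V a → Stable V b
  stable-cong e s t = span-cong (*-congʳ e) (s t)

  stable-+ : ∀ {V a b} → Stable V a → Stable V b → Stable V (a + b)
  stable-+ s t u = span-cong (sym (distribʳ _ _ _)) (span-+ (s u) (t u))

  stable-* : ∀ {V a b} → Stable V a → Stable V b → Stable V (a * b)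
  stable-* s t u = span-cong (sym (*-assoc _ _ _)) (s (t u))

  stable-fromℤ : ∀ {V} i → Stable V (fromℤ i)
  stable-fromℤ i = span-scale i

  stable-neg : ∀ {V a} → Stable V a → Stable V (- a)
  stable-neg {a = a} s u = span-cong (solve 2 (λ a x → (:- con (+ 1)) :* (a :* x) := (:- a) :* x) refl a _) (span-scale -[1+ 0 ] (s u))

  stable-^ : ∀ {V a} n → Stable V a → Stable V (a ^ n)
  stable-^ zero    s = stable-fromℤ (+ 1)
  stable-^ (suc n) s = stable-* s (stable-^ n s)

  -- Generators of V + yV + ... + yᵈ⁻¹V.
  adjoin : List Carrier → Carrier → ℕ → List Carrier
  adjoin V y zero    = []
  adjoin V y (suc d) = V ++ map (y *_) (adjoin V y d)

  module _ {V : List Carrier} {y : Carrier} where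

    adjoin-power : ∀ {d e x} → e < d → Span V x → Span (adjoin V y d) (y ^ e * x)
    adjoin-power {suc d} {zero}  l       s = span-++ˡ _ (span-cong (sym (*-identityˡ _)) s)
    adjoin-power {suc d} {suc e} (s≤s l) s = span-++ʳ V (span-cong (sym (*-assoc _ _ _)) (span-map y (adjoin-power l s)))

    adjoin-elim : ∀ {p} d (P : Carrier → Set p) → (∀ {x z} → x ≈ z → P x → P z) → P 0# → (∀ {x z} → P x → P z → P (x + z)) →
      (∀ {e x} → e < d → Span V x → P (y ^ e * x)) → ∀ {x} → Span (adjoin V y d) x → P x
    adjoin-elim zero    P resp P0 P+ Py (nil e) = resp (sym e) P0
    adjoin-elim (suc d) P resp P0 P+ Py s with span-++⁻ V s
    ... | x₁ , x₂ , s₁ , s₂ , x≈ with span-map⁻ (adjoin V y d) y s₂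
    ... | z , t , x₂≈ = resp (sym (trans x≈ (+-congˡ x₂≈))) (P+ (resp (*-identityˡ x₁) (Py (s≤s z≤n) s₁))
          (adjoin-elim d (λ w → P (y * w)) (λ e → resp (*-congˡ e)) (resp (sym (zeroʳ y)) P0)
            (λ p q → resp (sym (distribˡ _ _ _)) (P+ p q)) (λ l u → resp (*-assoc _ _ _) (Py (s≤s l) u)) t))

    adjoin-old : ∀ d {a} → Stable V a → Stable (adjoin V y d) a
    adjoin-old d {a} s = adjoin-elim d (λ x → Span (adjoin V y d) (a * x)) (λ e → span-cong (*-congˡ e))
      (span-cong (sym (zeroʳ a)) span-0) (λ p q → span-cong (sym (distribˡ _ _ _)) (span-+ p q))
      (λ {e} {x} l u → span-cong (solve 3 (λ a y x → y :* (a :* x) := a :* (y :* x)) refl a (y ^ e) x) (adjoin-power l (s u)))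

    adjoin-new : ∀ d → (∀ {x} → Span V x → Span (adjoin V y d) (y ^ d * x)) → Stable (adjoin V y d) y
    adjoin-new d relation = adjoin-elim d (λ x → Span (adjoin V y d) (y * x)) (λ e → span-cong (*-congˡ e))
      (span-cong (sym (zeroʳ y)) span-0) (λ p q → span-cong (sym (distribˡ _ _ _)) (span-+ p q))
      (λ {e} l u → span-cong (*-assoc _ _ _) (next (ℕₚ.m≤n⇒m<n∨m≡n l) u))
      where
      next : ∀ {e x} → suc e < d ⊎ suc e ≡ d → Span V x → Span (adjoin V y d) (y ^ suc e * x)
      next (inj₁ l)      u = adjoin-power l u
      next (inj₂ ≡.refl) u = relation u

  -- All listed elements preserve one finitely generated group that contains 1. Sums and products of
  -- them preserve it too, so these need no separate proof of integrality.
  Integral : List Carrier → Set (c ⊔ ℓ)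
  Integral as = ∃[ V ] Span V 1# × All (Stable V) as

  integral-[] : Integral []
  integral-[] = 1# ∷ [] , span-head , []

  adjoin-integral : ∀ {as} d y → (I : Integral as) → 0 < d →
    (∀ {x} → Span (proj₁ I) x → Span (adjoin (proj₁ I) y d) (y ^ d * x)) → Integral (y ∷ as)
  adjoin-integral (suc d) y (V , s , st) _ rel = adjoin V y (suc d) , span-cong (*-identityˡ 1#) (adjoin-power {d = suc d} {0} (s≤s z≤n) s) ,
    adjoin-new (suc d) rel ∷ All.map (λ {a} → adjoin-old (suc d) {a}) st

  adjoin-rootOfUnity : ∀ {as} n y → 0 < n → y ^ n ≈ 1# → Integral as → Integral (y ∷ as)
  adjoin-rootOfUnity n y 0<n e I = adjoin-integral n y I 0<n λ {x} s →
    span-cong (sym (*-congʳ e)) (adjoin-power {e = 0} 0<n s)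

  adjoin-cubic : ∀ {as} y a b d → (I : Integral as) → Stable (proj₁ I) a → Stable (proj₁ I) b → Stable (proj₁ I) d →
    y * y * y + a * (y * y) + b * y + d ≈ 0# → Integral (y ∷ as)
  adjoin-cubic y a b d I sa sb sd e = adjoin-integral 3 y I (s≤s z≤n) λ {x} s →
    span-cong (sym (trans (solve 5 (λ y a b d x → y :* (y :* (y :* con (+ 1))) :* x :=
          (y :* y :* y :+ a :* (y :* y) :+ b :* y :+ d) :* x :+
          (y :* (y :* con (+ 1)) :* ((:- a) :* x) :+ y :* con (+ 1) :* ((:- b) :* x) :+ con (+ 1) :* ((:- d) :* x))) refl y a b d x)
        (trans (+-congʳ (trans (*-congʳ e) (zeroˡ x))) (+-identityˡ _))))
      (span-+ (span-+ (adjoin-power {proj₁ I} {y} {3} {2} (s≤s (s≤s (s≤s z≤n))) (stable-neg {a = a} sa s))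
                      (adjoin-power {proj₁ I} {y} {3} {1} (s≤s (s≤s z≤n)) (stable-neg {a = b} sb s)))
              (adjoin-power {proj₁ I} {y} {3} {0} (s≤s z≤n) (stable-neg {a = d} sd s)))

module Divisibility {F : CommutativeRing c ℓ} (field′ : IsClassicalField F) (characteristic-0 : Characteristic0 F) where
  open CommutativeRing F hiding (zero)
  open IsClassicalField field′
  open FromIntegers F
  open Lattices F

  private
    -- Membership of v in b · Span V, after inverting an integer congruent to 1 modulo b.
    Divided : ℕ → List Carrier → Carrier → Set (c ⊔ ℓ)
    Divided b V v = ∃[ t ] ∃[ y ] Span V y × fromℤ (+ 1 ℤ.+ + b ℤ.* t) * v ≈ fromℤ (+ b) * y

    1+bt≢0 : ∀ b t → 2 ≤ b → + 1 ℤ.+ + b ℤ.* t ≢ + 0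
    1+bt≢0 b t 2≤b e = contradiction (ℕₚ.≤-trans 2≤b (ℕₚ.≤-reflexive b≡1)) λ { (s≤s ()) }
      where
      bt≡-1 : + b ℤ.* t ≡ -[1+ 0 ]
      bt≡-1 = ≡.trans (shift (+ b ℤ.* t)) (≡.cong (ℤ._+ -[1+ 0 ]) e)
        where
        shift : ∀ u → u ≡ (+ 1 ℤ.+ u) ℤ.+ -[1+ 0 ]
        shift = solve-∀
      b≡1 : b ≡ 1
      b≡1 = ℕₚ.m*n≡1⇒m≡1 b ℤ.∣ t ∣ (≡.trans (≡.sym (ℤₚ.abs-* (+ b) t)) (≡.cong ℤ.∣_∣ bt≡-1))

    -- Nakayama's lemma for multiplication by b, by eliminating one generator at a time.
    vanish : ∀ b → 2 ≤ b → ∀ V → All (Divided b V) V → ¬ ¬ (∀ {x} → Span V x → x ≈ 0#)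
    vanish b 2≤b [] _ = return λ { (nil e) → e }
    vanish b 2≤b (v ∷ V) ((t , _ , cons m y s y≈ , e) ∷ divided) =
      vanish b 2≤b V (All.map eliminate divided) >>= λ V≈0 →
      cancel (trans head-relation (trans (*-congˡ (V≈0 s)) (zeroʳ _))) (characteristic-0 _ (1+bt≢0 b (t ℤ.- m) 2≤b)) >>= λ v≈0 →
      return λ { (cons m′ z s′ e′) → trans e′ (trans (+-cong (trans (*-congˡ v≈0) (zeroʳ _)) (V≈0 s′)) (+-identityʳ 0#)) }
      where
      -- Moving the term b m v of (1 + b t) v = b (m v + y) to the left gives the coefficient 1 + b
      -- (t - m) and expresses a multiple of v through the other generators.
      e₁ = + 1 ℤ.+ + b ℤ.* (t ℤ.- m)
      fromℤ-1+ : ∀ t → fromℤ (+ 1 ℤ.+ + b ℤ.* t) ≈ 1# + fromℤ (+ b) * fromℤ t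
      fromℤ-1+ t = trans (fromℤ-+ (+ 1) (+ b ℤ.* t)) (+-congˡ (fromℤ-* (+ b) t))
      fromℤ-e₁ : fromℤ e₁ ≈ 1# + fromℤ (+ b) * (fromℤ t - fromℤ m)
      fromℤ-e₁ = trans (fromℤ-1+ (t ℤ.- m)) (+-congˡ (*-congˡ (trans (fromℤ-+ t (ℤ.- m)) (+-congˡ (fromℤ-neg m)))))
      head-relation : fromℤ e₁ * v ≈ fromℤ (+ b) * y
      head-relation = trans (*-congʳ fromℤ-e₁) (trans
        (solve 4 (λ b t m v → (con (+ 1) :+ b :* (t :- m)) :* v := (con (+ 1) :+ b :* t) :* v :- b :* (m :* v)) refl (fromℤ (+ b)) (fromℤ t) (fromℤ m) v)
        (trans (+-congʳ (trans (*-congʳ (sym (fromℤ-1+ t))) (trans e (*-congˡ y≈))))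
          (solve 4 (λ b m v y → b :* (m :* v :+ y) :- b :* (m :* v) := b :* y) refl (fromℤ (+ b)) (fromℤ m) v y)))
      eliminate : ∀ {w} → Divided b (v ∷ V) w → Divided b V w
      eliminate {w} (t′ , _ , cons m′ y′ s′ y′≈ , e′) = t″ , fromℤ (m′ ℤ.* + b) * y + fromℤ e₁ * y′ ,
        span-+ (span-scale (m′ ℤ.* + b) s) (span-scale e₁ s′) , relation
        where
        e₂ = + 1 ℤ.+ + b ℤ.* t′
        -- Chosen so that 1 + b t″ = (1 + b (t - m)) (1 + b t′). The first factor is the one that
        -- turns v into b y.
        t″ = (t ℤ.- m) ℤ.+ t′ ℤ.+ + b ℤ.* (t ℤ.- m) ℤ.* t′
        product : ∀ b u t′ → + 1 ℤ.+ b ℤ.* (u ℤ.+ t′ ℤ.+ b ℤ.* u ℤ.* t′) ≡ (+ 1 ℤ.+ b ℤ.* u) ℤ.* (+ 1 ℤ.+ b ℤ.* t′)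
        product = solve-∀
        relation : fromℤ (+ 1 ℤ.+ + b ℤ.* t″) * w ≈ fromℤ (+ b) * (fromℤ (m′ ℤ.* + b) * y + fromℤ e₁ * y′)
        relation = trans (*-congʳ (trans (reflexive (≡.cong fromℤ (product (+ b) (t ℤ.- m) t′))) (fromℤ-* e₁ e₂)))
          (trans (*-assoc _ _ _) (trans (*-congˡ (trans e′ (*-congˡ y′≈)))
            (trans (solve 5 (λ e b m v y → e :* (b :* (m :* v :+ y)) := b :* (m :* (e :* v) :+ e :* y)) refl
                      (fromℤ e₁) (fromℤ (+ b)) (fromℤ m′) v y′)
              (*-congˡ (+-congʳ (trans (*-congˡ head-relation) (trans (sym (*-assoc _ _ _)) (*-congʳ (sym (fromℤ-* m′ (+ b)))))))))))

  -- Given the equation, every generator v satisfies (1 + b t) v = b (a v) with a v in the lattice.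
  -- Then `vanish` annihilates a lattice that contains 1.
  not-divisible : ∀ b t {V a} → 2 ≤ b → Span V 1# → Stable V a → ¬ fromℤ (+ 1 ℤ.+ + b ℤ.* t) ≈ fromℤ (+ b) * a
  not-divisible b t {V} {a} 2≤b s1 stable e = vanish b 2≤b V (All.tabulate λ {v} v∈ → t , a * v , stable (∈-span v∈) ,
      trans (*-congʳ e) (*-assoc _ _ _)) λ V≈0 → nontrivial (V≈0 s1)
    where
    open import Data.List.Membership.Propositional using (_∈_)
    open import Data.List.Relation.Unary.Any using (here; there)
    ∈-span : ∀ {v V} → v ∈ V → Span V v
    ∈-span (here ≡.refl) = span-head
    ∈-span (there v∈)    = span-weaken (∈-span v∈)

module TwoAdic {F : CommutativeRing c ℓ} (field′ : IsClassicalField F) (characteristic-0 : Characteristic0 F) where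
  open CommutativeRing F hiding (zero)
  open IsClassicalField field′
  open FromIntegers F
  open Lattices F
  open Divisibility field′ characteristic-0
  open import Algebra.Definitions.RawSemiring (RawRing.rawSemiring rawRing) using (_^_)
  open import Algebra.Properties.Semiring.Exp semiring using (^-homo-*; ^-congˡ)

  private
    2# : Carrier
    2# = fromℤ (+ 2)

    2≉0 : ¬ 2# ≈ 0#
    2≉0 = characteristic-0 (+ 2) λ ()

    halve : ∀ n → ∃[ h ] (n ≡ h ℕ.+ h ⊎ n ≡ suc (h ℕ.+ h))
    halve zero    = 0 , inj₁ ≡.refl
    halve (suc n) with halve n
    ... | h , inj₁ e = h , inj₂ (≡.cong suc e)
    ... | h , inj₂ e = suc h , inj₁ (≡.trans (≡.cong suc e) (≡.cong suc (≡.sym (ℕₚ.+-suc h h))))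

  module _ {V : List Carrier} (1∈V : Span V 1#) where

    private
      -- Binomial expansion of (1 - 2β)ⁿ to first order. The factor β² of the error term is kept, so
      -- that β can be cancelled afterwards.
      expand : ∀ {β} → Stable V β → ∀ n → ∃[ r ] Stable V r ×
        (1# - 2# * β) ^ n ≈ 1# - 2# * (fromℤ (+ n) * β) + fromℤ (+ 4) * (β * β) * r
      expand {β} st zero = 0# , stable-fromℤ (+ 0) ,
        solve 1 (λ b → con (+ 1) := con (+ 1) :- con (+ 2) :* (con (+ 0) :* b) :+ con (+ 4) :* (b :* b) :* con (+ 0)) refl β
      expand {β} st (suc n) with expand st n
      ... | r , st-r , e = r + fromℤ (+ n) - 2# * (β * r) ,
            stable-+ {a = r + fromℤ (+ n)} { - (2# * (β * r))} (stable-+ {a = r} {fromℤ (+ n)} st-r (stable-fromℤ (+ n)))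
              (stable-neg {a = 2# * (β * r)} (stable-* {a = 2#} {β * r} (stable-fromℤ (+ 2)) (stable-* {a = β} {r} st st-r))) ,
            trans (*-congˡ e) (trans (solve 3 (λ b n r →
              (con (+ 1) :- con (+ 2) :* b) :* (con (+ 1) :- con (+ 2) :* (n :* b) :+ con (+ 4) :* (b :* b) :* r) :=
              con (+ 1) :- con (+ 2) :* ((con (+ 1) :+ n) :* b) :+ con (+ 4) :* (b :* b) :* (r :+ n :- con (+ 2) :* (b :* r))) refl β (fromℤ (+ n)) r)
              (+-congʳ (+-congˡ (-‿cong (*-congˡ (*-congʳ (sym (fromℤ-+ (+ 1) (+ n)))))))))

      -- With m the odd exponent, the expansion reads 2β(2βr - m) = 0. If β ≠ 0, then m = 2(βr) with
      -- βr integral, which is impossible for odd m.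
      odd : ∀ {β} → Stable V β → ∀ h → (1# - 2# * β) ^ suc (h ℕ.+ h) ≈ 1# → ¬ ¬ (β ≈ 0#)
      odd {β} st h e with expand st (suc (h ℕ.+ h))
      ... | r , st-r , e′ = cancel product 2≉0 >>= λ z → em {A = β ≈ 0#} >>= λ where
            (yes β≈0) → return β≈0
            (no β≉0) → cancel z β≉0 >>= λ w → contradiction (m≈2βr w)
              (not-divisible 2 (+ h) (s≤s (s≤s z≤n)) 1∈V (stable-* {a = β} {r} st st-r))
        where
        m = suc (h ℕ.+ h)
        m≡ : + m ≡ + 1 ℤ.+ + 2 ℤ.* + h
        m≡ = ≡.trans (≡.cong (λ m → + suc (h ℕ.+ m)) (≡.sym (ℕₚ.+-identityʳ h))) (≡.cong (λ i → + 1 ℤ.+ i) (ℤₚ.pos-* 2 h))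
        product : 2# * (β * (2# * (β * r) - fromℤ (+ m))) ≈ 0#
        product = trans (solve 3 (λ b n r → con (+ 2) :* (b :* (con (+ 2) :* (b :* r) :- n)) :=
            (con (+ 1) :- con (+ 2) :* (n :* b) :+ con (+ 4) :* (b :* b) :* r) :- con (+ 1)) refl β (fromℤ (+ m)) r)
          (trans (+-congʳ (trans (sym e′) e)) (-‿inverseʳ 1#))
        m≈2βr : 2# * (β * r) - fromℤ (+ m) ≈ 0# → fromℤ (+ 1 ℤ.+ + 2 ℤ.* + h) ≈ 2# * (β * r)
        m≈2βr w = trans (reflexive (≡.cong fromℤ (≡.sym m≡))) (trans (solve 2 (λ a n → n := a :- (a :- n)) refl (2# * (β * r)) (fromℤ (+ m)))
          (trans (+-congˡ (-‿cong w)) (solve 1 (λ a → a :- con (+ 0) := a) refl (2# * (β * r)))))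

    -- An even exponent is halved: (1 - 2β)² = 1 - 2β′ with β′ = 2β(1 - β). By induction β′ is 0,
    -- which gives β = 0 or β = 1, or it is 1, which would make 1 twice the integral element β(1 -
    -- β). `odd` ends the descent.
    rootOfUnity : ∀ n {β} → 0 < n → Stable V β → (1# - 2# * β) ^ n ≈ 1# → ¬ ¬ (β ≈ 0# ⊎ β ≈ 1#)
    rootOfUnity n = go n n ℕₚ.≤-refl
      where
      go : ∀ bound n → n ≤ bound → ∀ {β} → 0 < n → Stable V β → (1# - 2# * β) ^ n ≈ 1# → ¬ ¬ (β ≈ 0# ⊎ β ≈ 1#)
      go zero zero n≤ () st e
      go (suc bound) n n≤ {β} 0<n st e with halve n
      ... | h , inj₂ ≡.refl = odd st h e >>= λ β≈0 → return (inj₁ β≈0)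
      ... | zero , inj₁ ≡.refl = contradiction 0<n λ ()
      ... | h@(suc h′) , inj₁ ≡.refl = go bound h (ℕ.s≤s⁻¹ (ℕₚ.≤-trans (s≤s (ℕₚ.m≤m+n h h′)) (ℕₚ.≤-trans (ℕₚ.≤-reflexive (≡.sym (ℕₚ.+-suc h h′))) n≤)))
              {β′} (s≤s z≤n) st′ (trans (square h) e) >>= λ where
            (inj₁ z) → resolve z
            (inj₂ w) → contradiction (sym w) (not-divisible 2 (+ 0) (s≤s (s≤s z≤n)) 1∈V st-β-β²  ∘ λ u → trans u (*-assoc _ _ _))
        where
        β′ = 2# * β * (1# - β)
        st-β-β² : Stable V (β * (1# - β))
        st-β-β² = stable-* {a = β} {1# - β} st (stable-+ {a = 1#} { - β} (stable-fromℤ (+ 1)) (stable-neg {a = β} st))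
        st′ : Stable V β′
        st′ = stable-cong (sym (*-assoc _ _ _)) (stable-* {a = 2#} {β * (1# - β)} (stable-fromℤ (+ 2)) st-β-β²)
        square : ∀ h → (1# - 2# * β′) ^ h ≈ (1# - 2# * β) ^ (h ℕ.+ h)
        square h = trans (^-congˡ h (solve 1 (λ b → con (+ 1) :- con (+ 2) :* (con (+ 2) :* b :* (con (+ 1) :- b)) :=
            (con (+ 1) :- con (+ 2) :* b) :* (con (+ 1) :- con (+ 2) :* b)) refl β))
          (trans (powers h) (sym (^-homo-* (1# - 2# * β) h h)))
          where
          powers : ∀ h → ((1# - 2# * β) * (1# - 2# * β)) ^ h ≈ (1# - 2# * β) ^ h * (1# - 2# * β) ^ h
          powers zero    = sym (*-identityˡ 1#)
          powers (suc h) = trans (*-congˡ (powers h)) (solve 2 (λ x y → (x :* x) :* (y :* y) := (x :* y) :* (x :* y)) refl (1# - 2# * β) ((1# - 2# * β) ^ h))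
        resolve : β′ ≈ 0# → ¬ ¬ (β ≈ 0# ⊎ β ≈ 1#)
        resolve z = em {A = β ≈ 0#} >>= λ where
          (yes β≈0) → return (inj₁ β≈0)
          (no β≉0) → cancel (trans (sym (*-assoc _ _ _)) z) 2≉0 >>= λ z′ → cancel z′ β≉0 >>= λ z″ →
            return (inj₂ (trans (solve 1 (λ b → b := con (+ 1) :- (con (+ 1) :- b)) refl β) (trans (+-congˡ (-‿cong z″)) (solve 0 (con (+ 1) :- con (+ 0) := con (+ 1)) refl))))

  -- ζ₂/ζ₁ = - (1 - 2γ/ζ₁) is a root of unity
  midpoint : ∀ k → 0 < k → ∀ ζ₁ ζ₂ C → ζ₁ ^ k ≈ 1# → ζ₂ ^ k ≈ 1# → ζ₁ + ζ₂ ≈ 2# * (C + fromℤ (+ 8)) →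
    ζ₁ * ζ₂ ≈ C * C * C + fromℤ (+ 8) * (C * C) + fromℤ (+ 16) * C + fromℤ (+ 64) →
    ¬ ¬ (C + fromℤ (+ 8) ≈ 0# ⊎ C + fromℤ (+ 8) ≈ ζ₁)
  midpoint k@(suc k′) 0<k ζ₁ ζ₂ C e₁ e₂ sum product = conclude integral-C
    where
    γ = C + fromℤ (+ 8)
    -- Since ζ₁ to the power `k` is 1, the power `ζ₁ ^ k′` is the inverse of ζ₁ and β = γ/ζ₁.
    β = γ * ζ₁ ^ k′
    conclude : Integral (C ∷ ζ₁ ∷ []) → ¬ ¬ (γ ≈ 0# ⊎ γ ≈ ζ₁)
    conclude (V , 1∈V , st-C ∷ st-ζ ∷ []) = rootOfUnity 1∈V (k ℕ.+ k) (s≤s z≤n)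
        (stable-* {a = γ} {ζ₁ ^ k′} (stable-+ {a = C} st-C (stable-fromℤ (+ 8))) (stable-^ {a = ζ₁} k′ st-ζ)) power >>= λ where
          (inj₁ z) → return (inj₁ (trans γ≈ (trans (*-congʳ z) (zeroˡ ζ₁))))
          (inj₂ w) → return (inj₂ (trans γ≈ (trans (*-congʳ w) (*-identityˡ ζ₁))))
      where
      γ≈ : γ ≈ β * ζ₁
      γ≈ = trans (sym (*-identityʳ γ)) (trans (*-congˡ (sym e₁)) (solve 3 (λ g z w → g :* (z :* w) := (g :* w) :* z) refl γ ζ₁ (ζ₁ ^ k′)))
      ^-distrib : ∀ x y n → (x * y) ^ n ≈ x ^ n * y ^ n
      ^-distrib x y zero    = sym (*-identityˡ 1#)
      ^-distrib x y (suc n) = trans (*-congˡ (^-distrib x y n)) (solve 4 (λ x y p q → (x :* y) :* (p :* q) := (x :* p) :* (y :* q)) refl x y (x ^ n) (y ^ n))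
      τ = ζ₂ * ζ₁ ^ k′
      τ^k : τ ^ k ≈ 1#
      τ^k = trans (^-distrib ζ₂ (ζ₁ ^ k′) k) (trans (*-cong e₂ (power-swap k′)) (*-identityˡ 1#))
        where
        1^ : ∀ n → 1# ^ n ≈ 1#
        1^ zero    = refl
        1^ (suc n) = trans (*-identityˡ _) (1^ n)
        power-swap : ∀ n → (ζ₁ ^ n) ^ k ≈ 1#
        power-swap zero    = 1^ k
        power-swap (suc n) = trans (^-distrib ζ₁ (ζ₁ ^ n) k) (trans (*-cong e₁ (power-swap n)) (*-identityˡ 1#))
      1-2β : 1# - 2# * β ≈ - τ
      1-2β = trans (+-congˡ (-‿cong (trans (sym (*-assoc _ _ _)) (*-congʳ (sym sum))))) (trans
        (solve 3 (λ a b w → con (+ 1) :- (a :+ b) :* w := (con (+ 1) :- a :* w) :- b :* w) refl ζ₁ ζ₂ (ζ₁ ^ k′))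
        (trans (+-congʳ (trans (+-congˡ (-‿cong e₁)) (-‿inverseʳ 1#))) (+-identityˡ _)))
      -- The doubled exponent absorbs the sign in 1 - 2β = - τ.
      power : (1# - 2# * β) ^ (k ℕ.+ k) ≈ 1#
      power = trans (^-congˡ (k ℕ.+ k) 1-2β) (trans (^-homo-* (- τ) k k) (trans (neg-squared k) (trans (*-cong τ^k τ^k) (*-identityˡ 1#))))
        where
        neg-squared : ∀ n → (- τ) ^ n * (- τ) ^ n ≈ τ ^ n * τ ^ n
        neg-squared zero    = refl
        neg-squared (suc n) = trans (solve 2 (λ t p → ((:- t) :* p) :* ((:- t) :* p) := (t :* t) :* (p :* p)) refl τ ((- τ) ^ n))
          (trans (*-congˡ (neg-squared n)) (solve 2 (λ t p → (t :* t) :* (p :* p) := (t :* p) :* (t :* p)) refl τ (τ ^ n)))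
    integral-ζ : Integral (ζ₁ ∷ [])
    integral-ζ = adjoin-rootOfUnity k ζ₁ 0<k e₁ integral-[]
    -- Substituting ζ₂ = 2(C + 8) - ζ₁ into the formula for ζ₁ζ₂ leaves a monic cubic equation for C
    -- with coefficients in ℤ[ζ₁].
    integral-C : Integral (C ∷ ζ₁ ∷ [])
    integral-C = adjoin-cubic C (fromℤ (+ 8)) b d integral-ζ (stable-fromℤ (+ 8))
        (stable-+ {a = fromℤ (+ 16)} (stable-fromℤ (+ 16)) (stable-neg {a = 2# * ζ₁} (stable-* {a = 2#} (stable-fromℤ (+ 2)) st-ζ)))
        (stable-+ {a = fromℤ (+ 64) - fromℤ (+ 16) * ζ₁}
          (stable-+ {a = fromℤ (+ 64)} (stable-fromℤ (+ 64)) (stable-neg {a = fromℤ (+ 16) * ζ₁} (stable-* {a = fromℤ (+ 16)} (stable-fromℤ (+ 16)) st-ζ)))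
          (stable-* {a = ζ₁} st-ζ st-ζ))
        relation
      where
      b = fromℤ (+ 16) - 2# * ζ₁
      d = fromℤ (+ 64) - fromℤ (+ 16) * ζ₁ + ζ₁ * ζ₁
      st-ζ : Stable (proj₁ integral-ζ) ζ₁
      st-ζ = All.head (proj₂ (proj₂ integral-ζ))
      relation : C * C * C + fromℤ (+ 8) * (C * C) + b * C + d ≈ 0#
      relation = trans (solve 3 (λ C z w → C :* C :* C :+ con (+ 8) :* (C :* C) :+ (con (+ 16) :- con (+ 2) :* z) :* C :+ (con (+ 64) :- con (+ 16) :* z :+ z :* z) :=
          (C :* C :* C :+ con (+ 8) :* (C :* C) :+ con (+ 16) :* C :+ con (+ 64)) :- z :* w :- z :* (con (+ 2) :* (C :+ con (+ 8)) :- (z :+ w))) refl C ζ₁ ζ₂)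
        (trans (+-cong (trans (+-congˡ (-‿cong product)) (-‿inverseʳ _)) (-‿cong (trans (*-congˡ (trans (+-congˡ (-‿cong sum)) (-‿inverseʳ _))) (zeroʳ ζ₁))))
          (solve 0 (con (+ 0) :- con (+ 0) := con (+ 0)) refl))

-- A root of unity among the roots of Q

module RootOfUnity {F : CommutativeRing c ℓ} (field′ : IsClassicalField F) (characteristic-0 : Characteristic0 F)
  (c : CommutativeRing.Carrier F) where
  open CommutativeRing F hiding (zero)
  open IsClassicalField field′
  open FromIntegers F using (fromℤ)
  open PolynomialRing F
  open PolynomialCancellation F
  open ClassicalPolynomials field′
  private
    module S = FromIntegers F
    module P = FromIntegers polyRing
    module ρ = Hom (evalAt field′ characteristic-0 c)
  open import Algebra.Definitions.RawSemiring (RawRing.rawSemiring R[X].rawRing) using (_^_)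

  C : Carrier
  C = fromℤ (+ 4) * c

  RootOfQuadratic : Carrier → Set ℓ
  RootOfQuadratic ζ = ζ * ζ - fromℤ (+ 2) * (C + fromℤ (+ 8)) * ζ + (C * C * C + fromℤ (+ 8) * (C * C) + fromℤ (+ 16) * C + fromℤ (+ 64)) ≈ 0#

  private
    e = map ρ.⟦_⟧ δ₃

    γ : Carrier
    γ = C + fromℤ (+ 8)

  -- Q = x² - (2C + 16)x + C³ + 8C² + 16C + 64 has degree 2, so an irreducible common factor of Q and of
  -- 1 + x + … + xᵏ⁻¹ gives a root or is Q itself.  In the second case the other root 2(C + 8) - x is
  -- also a root of unity, with the impossible midpoint C + 8.
  module _ {k : ℕ} (0<k : 0 < k) {a b : Poly} (factor : LeastCommonFactor a b) where
    open LeastCommonFactor factor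
    private
      q = monic lower
      G = replicate k 1#
    module _ (q∣e : q ∣ e) (q∣G : q ∣ G) where
      private
        w = proj₁ q∣e

        linear : ∀ a → lower ≡ a ∷ [] → ∃[ ζ ] RootOfQuadratic ζ × eval G ζ ≈ 0#
        linear a ≡.refl = ζ , trans (S.solve 2 (λ z k → let open S in
              z :* z :- con (+ 2) :* (con (+ 4) :* k :+ con (+ 8)) :* z :+
                ((con (+ 4) :* k) :* (con (+ 4) :* k) :* (con (+ 4) :* k) :+ con (+ 8) :* ((con (+ 4) :* k) :* (con (+ 4) :* k)) :+
                 con (+ 16) :* (con (+ 4) :* k) :+ con (+ 64)) :=
              (con (+ 64) :+ k :* (con (+ 64) :+ k :* (con (+ 128) :+ k :* (con (+ 64) :+ k :* con (+ 0))))) :+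
                z :* ((con -[1+ 15 ] :+ k :* (con -[1+ 7 ] :+ k :* con (+ 0))) :+ z :* ((con (+ 1) :+ k :* con (+ 0)) :+ z :* con (+ 0)))) refl ζ c)
            (root q∣e) , root q∣G
          where
          ζ = - a
          root : ∀ {p} → q ∣ p → eval p ζ ≈ 0#
          root {p} (w , p≋) = trans (eval-cong ζ p≋) (trans (eval-* ζ w q) (trans (*-congˡ
            (S.solve 1 (λ a → let open S in a :+ (:- a) :* (con (+ 1) :+ (:- a) :* con (+ 0)) := con (+ 0)) refl a)) (zeroʳ _)))

        cubic : 3 ≤ length lower → ⊥
        cubic 3≤ = reduced-multiple e w lower 3≤ (proj₂ q∣e) λ e≋[] →
          nontrivial (trans (sym (trans (+-congˡ (zeroʳ c)) (+-identityʳ 1#))) (coeffs e≋[] 2))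

        module Quadratic (degree : length lower ≡ 2) (E-residue : ResidueField q) where
          open ResidueField E-residue using (∣-from; ∣-to; π) renaming (residueRing to E-ring; isClassicalField to E-field)
          module E = CommutativeRing E-ring
          module EI = FromIntegers E-ring
          module PE = PolynomialRing E-ring
          module π = Hom π
          open import Algebra.Definitions.RawSemiring (RawRing.rawSemiring E.rawRing) using () renaming (_^_ to _^ᴱ_)

          F→E : Hom rawRing E-ring
          F→E = π ∘ʰ constHom
          module φ = Hom F→E

          E-characteristic-0 : Characteristic0 E-ring
          E-characteristic-0 = characteristic-0-extension {F = F} {E = E-ring} field′ characteristic-0 F→E (IsClassicalField.nontrivial E-field)

          -- Both polynomials are monic of degree 2, so (w - 1) q = e - q has degree below 2. Hence
          -- w = 1.
          q≋e : ¬ ¬ (q ≋ e)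
          q≋e = cancel-monic lower (w +ₚ R[X].- const 1#) top >>= λ w≋1 → return (≋-sym (≋-trans (proj₂ q∣e)
              (≋-trans (P.solve 2 (λ w q → let open P in w :* q := (w :- con (+ 1)) :* q :+ q) ≋-refl w q)
                (+ₚ-cong (*ₚ-zeroˡ q w≋1) (≋-refl {q})))))
            where
            difference : (w +ₚ R[X].- const 1#) *ₚ q ≋ e +ₚ R[X].- q
            difference = ≋-trans (P.solve 2 (λ w q → let open P in (w :- con (+ 1)) :* q := w :* q :- q) ≋-refl w q)
              (+ₚ-cong (≋-sym (proj₂ q∣e)) (≋-refl {R[X].- q}))
            e₂ : coeff e 2 ≈ 1#
            e₂ = trans (+-congˡ (zeroʳ c)) (+-identityʳ 1#)
            q₂ : coeff q 2 ≈ 1#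
            q₂ = ≡.subst (λ d → coeff q d ≈ 1#) degree (monic-top lower)
            top : ∀ i → length lower ≤ i → coeff ((w +ₚ R[X].- const 1#) *ₚ q) i ≈ 0#
            top i l = trans (coeffs difference i) (trans (coeff-+ e (R[X].- q) i) (trans (+-congˡ (coeff-neg q i)) (cases i (≡.subst (_≤ i) degree l))))
              where
              cases : ∀ i → 2 ≤ i → coeff e i + - coeff q i ≈ 0#
              cases (suc (suc zero)) _ = trans (+-cong e₂ (-‿cong q₂)) (-‿inverseʳ 1#)
              cases i@(suc (suc (suc j))) _ = trans (+-congˡ (-‿cong (monic-vanishes lower i (≡.subst (_< i) (≡.sym degree) (s≤s (s≤s (s≤s z≤n)))))))
                (trans (+-identityˡ _) (S.solve 0 (let open S in :- con (+ 0) := con (+ 0)) refl))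
              cases 1 (s≤s ())

          x c′ K γ′ ζ₂ : E.Carrier
          x  = π.⟦ X ⟧
          c′ = φ.⟦ c ⟧
          K  = EI.fromℤ (+ 4) E.* c′
          γ′ = K E.+ EI.fromℤ (+ 8)
          ζ₂ = EI.fromℤ (+ 2) E.* γ′ E.- x

          at : E.Carrier → Hom R[X].rawRing E-ring
          at y = PE.evalHom y ∘ʰ onPolyRing (mapHom F→E)
          module at y = Hom (at y)

          Quadratic : E.Carrier → E.Carrier
          Quadratic y = y E.* y E.- EI.fromℤ (+ 2) E.* γ′ E.* y E.+
            (K E.* K E.* K E.+ EI.fromℤ (+ 8) E.* (K E.* K) E.+ EI.fromℤ (+ 16) E.* K E.+ EI.fromℤ (+ 64))

          φ-evalAt : ∀ p → φ.⟦ ρ.⟦ p ⟧ ⟧ E.≈ PE.eval (map EI.fromℤ p) c′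
          φ-evalAt []      = φ.0-homo
          φ-evalAt (i ∷ p) = E.trans (φ.+-homo (fromℤ i) (c * ρ.⟦ p ⟧)) (E.+-cong (fromℤ-homo {R = F} F→E i)
            (E.trans (φ.*-homo c ρ.⟦ p ⟧) (E.*-congˡ (φ-evalAt p))))

          e-at : ∀ y → at.⟦_⟧ y e E.≈ Quadratic y
          e-at y = E.trans (E.+-cong (φ-evalAt (+ 64 ∷ + 64 ∷ + 128 ∷ + 64 ∷ [])) (E.*-congˡ
              (E.+-cong (φ-evalAt (-[1+ 15 ] ∷ -[1+ 7 ] ∷ [])) (E.*-congˡ (E.+-congʳ (φ-evalAt (+ 1 ∷ [])))))))
            (EI.solve 2 (λ y k → let open EI in
              (con (+ 64) :+ k :* (con (+ 64) :+ k :* (con (+ 128) :+ k :* (con (+ 64) :+ k :* con (+ 0))))) :+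
                y :* ((con -[1+ 15 ] :+ k :* (con -[1+ 7 ] :+ k :* con (+ 0))) :+ y :* ((con (+ 1) :+ k :* con (+ 0)) :+ y :* con (+ 0))) :=
              y :* y :- con (+ 2) :* (con (+ 4) :* k :+ con (+ 8)) :* y :+
                ((con (+ 4) :* k) :* (con (+ 4) :* k) :* (con (+ 4) :* k) :+ con (+ 8) :* ((con (+ 4) :* k) :* (con (+ 4) :* k)) :+
                 con (+ 16) :* (con (+ 4) :* k) :+ con (+ 64))) E.refl y c′)

          at-x : ∀ p → at.⟦_⟧ x p E.≈ π.⟦ p ⟧
          at-x []      = E.sym π.0-homo
          at-x (a ∷ p) = E.trans (E.+-congˡ (E.*-congˡ (at-x p))) (E.sym (E.trans
            (π.⟦⟧-cong (≋-trans (∷-cong (sym (+-identityʳ a)) ≋-refl) (+ₚ-cong (≋-refl {const a}) (≋-sym (X*ₚ field′ p)))))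
            (E.trans (π.+-homo (const a) (X *ₚ p)) (E.+-congˡ (π.*-homo X p)))))

          at-X : ∀ y → at.⟦_⟧ y X E.≈ y
          at-X y = E.trans (E.+-cong φ.0-homo (E.*-congˡ (E.+-congʳ φ.1-homo)))
            (EI.solve 1 (λ y → let open EI in con (+ 0) :+ y :* (con (+ 1) :+ y :* con (+ 0)) := y) E.refl y)

          Quadratic-x : Quadratic x E.≈ E.0#
          Quadratic-x = E.trans (E.sym (e-at x)) (E.trans (at-x e) (∣-to q∣e))

          power : ∀ y → at.⟦_⟧ y q E.≈ E.0# → y ^ᴱ k E.≈ E.1#
          power y qy≈0 = E.trans (EI.solve 1 (λ p → let open EI in p := (p :- con (+ 1)) :+ con (+ 1)) E.refl (y ^ᴱ k))
              (E.trans (E.+-congʳ (E.trans (E.sym at-X^k-1) zero-at)) (E.+-identityˡ E.1#))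
            where
            module h = Hom (at y)
            pow : ∀ n → h.⟦ X ^ n ⟧ E.≈ y ^ᴱ n
            pow zero    = h.1-homo
            pow (suc n) = E.trans (h.*-homo X (X ^ n)) (E.*-cong (at-X y) (pow n))
            at-X^k-1 : h.⟦ X ^ k +ₚ R[X].- const 1# ⟧ E.≈ y ^ᴱ k E.- E.1#
            at-X^k-1 = E.trans (h.+-homo (X ^ k) (R[X].- const 1#)) (E.+-cong (pow k) (E.trans (h.neg-homo (const 1#)) (E.-‿cong h.1-homo)))
            zero-at : h.⟦ X ^ k +ₚ R[X].- const 1# ⟧ E.≈ E.0#
            zero-at = let u , G≋ = q∣G in E.trans (h.⟦⟧-cong (≋-sym (geometric field′ k)))
              (E.trans (h.*-homo (X +ₚ R[X].- const 1#) G) (E.trans (E.*-congˡ (E.trans (h.⟦⟧-cong G≋)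
                (E.trans (h.*-homo u q) (E.trans (E.*-congˡ qy≈0) (E.zeroʳ _))))) (E.zeroʳ _)))

          ζ₁^k : x ^ᴱ k E.≈ E.1#
          ζ₁^k = power x (E.trans (at-x q) (∣-to (const 1# , ≋-sym (*ₚ-identityˡ q))))

          ζ₂^k : q ≋ e → ζ₂ ^ᴱ k E.≈ E.1#
          ζ₂^k q≋e = power ζ₂ (E.trans (Hom.⟦⟧-cong (at ζ₂) q≋e) (E.trans (e-at ζ₂) (E.trans
            (EI.solve 2 (λ x k → let open EI ; g = k :+ con (+ 8) ; y = con (+ 2) :* g :- x ; p = k :* k :* k :+ con (+ 8) :* (k :* k) :+ con (+ 16) :* k :+ con (+ 64) in
              y :* y :- con (+ 2) :* g :* y :+ p := x :* x :- con (+ 2) :* g :* x :+ p) E.refl x K) Quadratic-x)))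

          product : x E.* ζ₂ E.≈ K E.* K E.* K E.+ EI.fromℤ (+ 8) E.* (K E.* K) E.+ EI.fromℤ (+ 16) E.* K E.+ EI.fromℤ (+ 64)
          product = E.trans (EI.solve 2 (λ x k → let open EI ; g = k :+ con (+ 8) ; p = k :* k :* k :+ con (+ 8) :* (k :* k) :+ con (+ 16) :* k :+ con (+ 64) in
              x :* (con (+ 2) :* g :- x) := p :- (x :* x :- con (+ 2) :* g :* x :+ p)) E.refl x K)
            (E.trans (E.+-congˡ (E.-‿cong Quadratic-x)) (EI.solve 1 (λ p → let open EI in p :- con (+ 0) := p) E.refl _))

          -- At C = - 8 the quadratic becomes x² - 64, and x² = 64 is not a root of unity.
          γ≉0 : ¬ γ′ E.≈ E.0#
          γ≉0 z = integer-not-rootOfUnity {R = E-ring} E-characteristic-0 64 k (s≤s (s≤s z≤n)) 0<k 64^k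
            where
            x²≈64 : x E.* x E.≈ EI.fromℤ (+ 64)
            x²≈64 = E.trans (EI.solve 2 (λ x k → let open EI ; g = k :+ con (+ 8) ; p = k :* k :* k :+ con (+ 8) :* (k :* k) :+ con (+ 16) :* k :+ con (+ 64) in
                x :* x := (x :* x :- con (+ 2) :* g :* x :+ p) :+ g :* (con (+ 2) :* x :- g :* g :+ con (+ 16) :* g :- con (+ 80)) :+ con (+ 64)) E.refl x K)
              (E.trans (E.+-congʳ (E.+-cong Quadratic-x (E.trans (E.*-congʳ z) (E.zeroˡ _)))) (E.trans (E.+-congʳ (E.+-identityʳ E.0#)) (E.+-identityˡ _)))
            powers : ∀ n → (x E.* x) ^ᴱ n E.≈ x ^ᴱ n E.* x ^ᴱ n
            powers zero    = E.sym (E.*-identityˡ E.1#)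
            powers (suc n) = E.trans (E.*-congˡ (powers n)) (EI.solve 2 (λ x y → let open EI in (x :* x) :* (y :* y) := (x :* y) :* (x :* y)) E.refl x (x ^ᴱ n))
            cong-^ : ∀ n {x y} → x E.≈ y → x ^ᴱ n E.≈ y ^ᴱ n
            cong-^ zero    eq = E.refl
            cong-^ (suc n) eq = E.*-cong eq (cong-^ n eq)
            64^k : EI.fromℤ (+ 64) ^ᴱ k E.≈ E.1#
            64^k = E.trans (E.sym (cong-^ k x²≈64)) (E.trans (powers k) (E.trans (E.*-cong ζ₁^k ζ₁^k) (E.*-identityˡ E.1#)))

          -- Otherwise the linear polynomial X - γ would be a multiple of q, which has degree 2.
          γ≉x : ¬ γ′ E.≈ x
          γ≉x z = reduced-multiple (X +ₚ R[X].- const γ) (proj₁ multiple) lower (ℕₚ.≤-reflexive (≡.sym degree)) (proj₂ multiple)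
              λ eq → nontrivial (coeffs eq 1)
            where
            φ-γ : φ.⟦ γ ⟧ E.≈ γ′
            φ-γ = E.trans (φ.+-homo C (fromℤ (+ 8))) (E.+-cong
              (E.trans (φ.*-homo (fromℤ (+ 4)) c) (E.*-congʳ (fromℤ-homo {R = F} F→E (+ 4)))) (fromℤ-homo {R = F} F→E (+ 8)))
            multiple : q ∣ (X +ₚ R[X].- const γ)
            multiple = ∣-from (E.trans (π.+-homo X (R[X].- const γ)) (E.trans (E.+-cong (E.sym z)
              (E.trans (π.neg-homo (const γ)) (E.-‿cong φ-γ))) (E.-‿inverseʳ γ′)))

          impossible : ⊥
          impossible = (q≋e >>= λ q≋e → TwoAdic.midpoint E-field E-characteristic-0 k 0<k x ζ₂ K ζ₁^k (ζ₂^k q≋e)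
              (EI.solve 2 (λ x t → let open EI in x :+ (t :- x) := t) E.refl x (EI.fromℤ (+ 2) E.* γ′)) product >>= λ where
                (inj₁ z) → contradiction z γ≉0
                (inj₂ z) → contradiction z γ≉x) λ x → x

      root : ∃[ ζ ] RootOfQuadratic ζ × eval G ζ ≈ 0#
      root = go lower ≡.refl
        where
        go : ∀ low → lower ≡ low → ∃[ ζ ] RootOfQuadratic ζ × eval G ζ ≈ 0#
        go []                  eq = contradiction (≡.subst (λ l → 0 < length l) eq nonconstant) λ ()
        go (a ∷ [])            eq = linear a eq
        go (a ∷ a′ ∷ [])       eq = contradiction (Quadratic.impossible (≡.cong length eq) (residueField factor)) λ ()
        go (a ∷ a′ ∷ a″ ∷ low) eq = contradiction (cubic (≡.subst (λ l → 3 ≤ length l) (≡.sym eq) (s≤s (s≤s (s≤s z≤n))))) λ ()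

  -- A zero of Δ forces a common factor of Ψₖ and δ. In the residue field of that factor δ vanishes
  -- at the class of X, so `multiplier-root` applies there and shows that the factor also divides
  -- the specialised δ₃.
  root-of-unity : ∀ k → 2 ≤ k → ∀ Ψ δ Δ → IsCyclotomicFamily Ψ → IsMultiplierPolynomial 3 δ →
    Pℤ[c].IsResultant (map Pℤ.const (Ψ k)) δ Δ → ρ.⟦ Δ ⟧ ≈ 0# →
    ¬ ¬ (∃[ ζ ] RootOfQuadratic ζ × eval (replicate k 1#) ζ ≈ 0#)
  root-of-unity k 2≤k Ψ δ Δ cyc mult res Δ≈0 =
    leastCommonFactor (map fromℤ (Ψ k)) (map ρ.⟦_⟧ δ) (proj₁ noncoprime) (proj₂ noncoprime) >>= λ factor →
    let open LeastCommonFactor factor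
        open ResidueField (residueField factor)
    in cyclotomic∣geometric field′ Ψ cyc k 2≤k >>= λ Ψ∣G →
       multiplier-root isClassicalField (π ∘ʰ mapHom (evalAt field′ characteristic-0 c)) δ mult (∣-to ∣b) >>= λ δ₃~0 →
       return (root (ℕₚ.≤-trans (s≤s z≤n) 2≤k) factor (∣-from δ₃~0) (∣-trans ∣a Ψ∣G))
    where
    noncoprime = resultant⇒¬Coprime field′ characteristic-0 c (Ψ k) δ Δ res Δ≈0

-- Interpolation

module Interpolation {F : CommutativeRing c ℓ} (field′ : IsClassicalField F)
  (stable : ∀ {x y} → ¬ ¬ (CommutativeRing._≈_ F x y) → CommutativeRing._≈_ F x y) where
  open CommutativeRing F hiding (zero)
  open IsClassicalField field′
  open PolynomialRing F
  open FromIntegers F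

  cancelˡ : ∀ {x y} → x * y ≈ 0# → ¬ x ≈ 0# → y ≈ 0#
  cancelˡ e x≉0 = stable (cancel e x≉0)

  difference≉0 : ∀ {x y} → ¬ x ≈ y → ¬ x - y ≈ 0#
  difference≉0 {x} {y} x≉y e = x≉y (trans (solve 2 (λ x y → x := (x :- y) :+ y) refl x y) (trans (+-congʳ e) (+-identityˡ y)))

  Distinct : ∀ {n} → (Fin n → Carrier) → Set ℓ
  Distinct x = ∀ i j → i ≢ j → ¬ x i ≈ x j

  distinct-suc : ∀ {n} {x : Fin (suc n) → Carrier} → Distinct x → Distinct (λ i → x (suc i))
  distinct-suc d i j i≢j = d (suc i) (suc j) (i≢j ∘ Finₚ.suc-injective)

  -- Synthetic division: the coefficients of (P(y) - P(x))/(y - x) for P = a + X p.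
  quotientAt : Carrier → Carrier → Poly → Poly
  quotientAt x a []      = []
  quotientAt x a (b ∷ p) = eval (b ∷ p) x ∷ quotientAt x b p

  length-quotientAt : ∀ x a p → length (quotientAt x a p) ≡ length p
  length-quotientAt x a []      = ≡.refl
  length-quotientAt x a (b ∷ p) = ≡.cong suc (length-quotientAt x b p)

  eval-quotientAt : ∀ x a p y → eval (a ∷ p) y ≈ (y - x) * eval (quotientAt x a p) y + eval (a ∷ p) x
  eval-quotientAt x a []      y = solve 3 (λ x a y → a :+ y :* con (+ 0) := (y :- x) :* con (+ 0) :+ (a :+ x :* con (+ 0))) refl x a y
  eval-quotientAt x a (b ∷ p) y = trans (+-congˡ (*-congˡ (eval-quotientAt x b p y)))
    (solve 5 (λ x a y g e → a :+ y :* ((y :- x) :* g :+ e) := (y :- x) :* (e :+ y :* g) :+ (a :+ x :* e)) refl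
      x a y (eval (quotientAt x b p) y) (eval (b ∷ p) x))

  quotientAt-zero : ∀ x a p → quotientAt x a p ≋ [] → eval (a ∷ p) x ≈ 0# → a ∷ p ≋ []
  quotientAt-zero x a []      z e = 0∷≋[] (trans (solve 2 (λ x a → a := a :+ x :* con (+ 0)) refl x a) e) ≋-refl
  quotientAt-zero x a (b ∷ p) z e = 0∷≋[]
    (trans (solve 3 (λ x a t → a := (a :+ x :* t) :- x :* t) refl x a (eval (b ∷ p) x))
      (trans (+-cong e (-‿cong (trans (*-congˡ (coeffs z 0)) (zeroʳ x)))) (-‿inverseʳ 0#)))
    (quotientAt-zero x b p (mk λ i → coeffs z (suc i)) (coeffs z 0))

  roots-unique : ∀ n (x : Fin n → Carrier) → Distinct x → ∀ f → length f ≤ n → (∀ i → eval f (x i) ≈ 0#) → f ≋ []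
  roots-unique n       x d []      l       z = ≋-refl
  roots-unique (suc n) x d (a ∷ p) (s≤s l) z = quotientAt-zero (x zero) a p
    (roots-unique n (λ i → x (suc i)) (distinct-suc d) (quotientAt (x zero) a p)
      (≡.subst (_≤ n) (≡.sym (length-quotientAt (x zero) a p)) l)
      (λ i → cancelˡ (trans (solve 2 (λ u v → u := (u :+ v) :- v) refl _ (eval (a ∷ p) (x zero)))
          (trans (+-cong (trans (sym (eval-quotientAt (x zero) a p (x (suc i)))) (z (suc i))) (-‿cong (z zero))) (-‿inverseʳ 0#)))
        (difference≉0 (d (suc i) zero λ ()))))
    (z zero)

  ∏ : ∀ {n} → (Fin n → Carrier) → Carrier
  ∏ {zero}  f = 1#
  ∏ {suc n} f = f zero * ∏ (λ i → f (suc i))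

  ∏≉0 : ∀ {n} (f : Fin n → Carrier) → (∀ i → ¬ f i ≈ 0#) → ¬ ∏ f ≈ 0#
  ∏≉0 {zero}  f nz = nontrivial
  ∏≉0 {suc n} f nz e = ∏≉0 (λ i → f (suc i)) (λ i → nz (suc i)) (cancelˡ e (nz zero))

  ∏-zero : ∀ {n} (f : Fin n → Carrier) i → f i ≈ 0# → ∏ f ≈ 0#
  ∏-zero f zero    e = trans (*-congʳ e) (zeroˡ _)
  ∏-zero f (suc i) e = trans (*-congˡ (∏-zero (λ j → f (suc j)) i e)) (zeroʳ _)

  productPolynomial : ∀ {n} (x : Fin n → Carrier) → ∃[ low ] length low ≡ n × (∀ y → eval (monic low) y ≈ ∏ (λ i → y - x i))
  productPolynomial {zero}  x = [] , ≡.refl , λ y → eval-const y 1#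
  productPolynomial {suc n} x with productPolynomial (λ i → x (suc i))
  ... | low , len , ev = low′ , len′ , λ y → trans (eval-low′ y) (*-congˡ (ev y))
    where
    a = x zero
    -- the lower coefficients of (X - a) · monic low
    step : Carrier → Poly → Poly
    step b []      = (b - a) ∷ []
    step b (d ∷ p) = (b - a * d) ∷ step d p
    low′ = step 0# low
    len′ : length low′ ≡ suc n
    len′ = ≡.trans (length-step 0# low) (≡.cong suc len)
      where
      length-step : ∀ b p → length (step b p) ≡ suc (length p)
      length-step b []      = ≡.refl
      length-step b (d ∷ p) = ≡.cong suc (length-step d p)
    eval-step : ∀ b p y → eval (monic (step b p)) y ≈ b + (y - a) * eval (monic p) y
    eval-step b []      y = solve 3 (λ a b y → (b :- a) :+ y :* (con (+ 1) :+ y :* con (+ 0)) := b :+ (y :- a) :* (con (+ 1) :+ y :* con (+ 0))) refl a b y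
    eval-step b (d ∷ p) y = trans (+-congˡ (*-congˡ (eval-step d p y)))
      (solve 5 (λ a b d y e → (b :- a :* d) :+ y :* (d :+ (y :- a) :* e) := b :+ (y :- a) :* (d :+ y :* e)) refl a b d y (eval (monic p) y))
    eval-low′ : ∀ y → eval (monic low′) y ≈ (y - a) * eval (monic low) y
    eval-low′ y = trans (eval-step 0# low y) (+-identityˡ _)

  interpolate : ∀ {n} (x : Fin n → Carrier) → Distinct x → (v : Fin n → Carrier) →
    ¬ ¬ (∃[ p ] length p ≤ n × (∀ i → eval p (x i) ≈ v i))
  interpolate {zero}  x d v = return ([] , z≤n , λ ())
  interpolate {suc n} x d v = interpolate (λ i → x (suc i)) (distinct-suc d) (λ i → v (suc i)) >>= λ (p , len , ev) →
    let low , len′ , prod = productPolynomial (λ i → x (suc i))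
        m = eval (monic low) (x zero)
    in invertible m (λ e → ∏≉0 (λ i → x zero - x (suc i)) (λ i → difference≉0 (d zero (suc i) λ ())) (trans (sym (prod (x zero))) e)) >>= λ (y , my≈1) →
    let a = (v zero - eval p (x zero)) * y in return
    ( p +ₚ map (a *_) (monic low)
    , length-+ₚ (suc n) p (map (a *_) (monic low)) (ℕₚ.m≤n⇒m≤1+n len)
        (length-map (a *_) (suc n) (monic low) (ℕₚ.≤-reflexive (≡.trans (length-∷ʳ low 1#) (≡.cong suc len′))))
    , λ { zero → trans (eval-+ (x zero) p (map (a *_) (monic low))) (trans (+-congˡ (eval-scale (x zero) a (monic low)))
            (trans (solve 4 (λ v e y m → e :+ ((v :- e) :* y) :* m := e :+ (v :- e) :* (m :* y)) refl (v zero) (eval p (x zero)) y m)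
              (trans (+-congˡ (*-congˡ my≈1)) (solve 2 (λ v e → e :+ (v :- e) :* con (+ 1) := v) refl (v zero) (eval p (x zero))))))
        ; (suc i) → trans (eval-+ (x (suc i)) p (map (a *_) (monic low))) (trans (+-cong (ev i)
            (trans (eval-scale (x (suc i)) a (monic low)) (trans (*-congˡ (trans (prod (x (suc i))) (vanishing i))) (zeroʳ a)))) (+-identityʳ _)) })
    where
    vanishing : ∀ i → ∏ (λ j → x (suc i) - x (suc j)) ≈ 0#
    vanishing i = ∏-zero (λ j → x (suc i) - x (suc j)) i (-‿inverseʳ _)

  -- Applying σ to the coefficients gives another short polynomial with the same values at the
  -- nodes, so the two agree by `roots-unique`. This plays the part of Galois descent: it puts
  -- coefficients into fixed fields.
  interpolant-invariant : ∀ {n} (x : Fin n → Carrier) → Distinct x → ∀ p → length p ≤ n → (σ : Hom rawRing F) →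
    (∀ j → ¬ ¬ (∃[ i ] Hom.⟦_⟧ σ (x i) ≈ x j × Hom.⟦_⟧ σ (eval p (x i)) ≈ eval p (x j))) →
    ∀ k → Hom.⟦_⟧ σ (coeff p k) ≈ coeff p k
  interpolant-invariant {n} x d p l σ permutes k = trans (sym (coeff-map σ p k))
    (trans (solve 2 (λ a b → a := (a :- b) :+ b) refl (coeff (map σ.⟦_⟧ p) k) (coeff p k))
      (trans (+-congʳ (trans (+-congˡ (sym (coeff-neg p k))) (trans (sym (coeff-+ (map σ.⟦_⟧ p) (map -_ p) k)) (coeffs zero-difference k)))) (+-identityˡ _)))
    where
    module σ = Hom σ
    zero-difference : map σ.⟦_⟧ p +ₚ map (λ y → - y) p ≋ []
    zero-difference = roots-unique n x d _ (length-+ₚ n (map σ.⟦_⟧ p) (map -_ p) (length-map σ.⟦_⟧ n p l) (length-map -_ n p l))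
      λ j → trans (eval-+ (x j) (map σ.⟦_⟧ p) (map -_ p)) (trans (+-congˡ (eval-neg (x j) p))
        (trans (+-congʳ (stable (permutes j >>= λ (i , σxᵢ , σp) → return
          (trans (eval-congʳ (map σ.⟦_⟧ p) (sym σxᵢ)) (trans (eval-map σ p (x i)) σp))))) (-‿inverseʳ _)))

  module PrimitiveRoot (ζ ζ̄ : Carrier) (n : ℕ) where
    open import Algebra.Definitions.RawSemiring (RawRing.rawSemiring rawRing) using (_^_) public
    open import Algebra.Properties.Semiring.Exp semiring using (^-homo-*; ^-assocʳ; ^-congˡ; ^-congʳ) public
    open import Algebra.Properties.CommutativeSemiring.Exp commutativeSemiring using (^-distrib-*) public
    open DeterminantProperties F using (sum; sum-cong-≋; ∑-distrib-+; *-distribˡ-sum; *-distribʳ-sum; ∑-comm; sum-zero) public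
    open import Relation.Binary.Reasoning.Setoid setoid

    1^ : ∀ m → 1# ^ m ≈ 1#
    1^ zero    = refl
    1^ (suc m) = trans (*-identityˡ _) (1^ m)

    module _ (0<n : 0 < n) (ζζ̄ : ζ * ζ̄ ≈ 1#) (ζ^n : ζ ^ n ≈ 1#) (order-n : ∀ m → 0 < m → m < n → ¬ ζ ^ m ≈ 1#) where

      ζ^mζ̄^m : ∀ m → ζ ^ m * ζ̄ ^ m ≈ 1#
      ζ^mζ̄^m m = trans (sym (^-distrib-* ζ ζ̄ m)) (trans (^-congˡ m ζζ̄) (1^ m))

      power≉ : ∀ i j → i < j → j < n → ¬ ζ ^ i ≈ ζ ^ j
      power≉ i j i<j j<n e = order-n (j ℕ.∸ i) (ℕₚ.m<n⇒0<n∸m i<j) (ℕₚ.≤-<-trans (ℕₚ.m∸n≤m j i) j<n) (begin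
        ζ ^ (j ℕ.∸ i)                          ≈⟨ *-identityˡ _ ⟨
        1# * ζ ^ (j ℕ.∸ i)                     ≈⟨ *-congʳ (ζ^mζ̄^m i) ⟨
        ζ ^ i * ζ̄ ^ i * ζ ^ (j ℕ.∸ i)          ≈⟨ solve 3 (λ a b d → a :* b :* d := (a :* d) :* b) refl (ζ ^ i) (ζ̄ ^ i) (ζ ^ (j ℕ.∸ i)) ⟩
        ζ ^ i * ζ ^ (j ℕ.∸ i) * ζ̄ ^ i          ≈⟨ *-congʳ (^-homo-* ζ i (j ℕ.∸ i)) ⟨
        ζ ^ (i ℕ.+ (j ℕ.∸ i)) * ζ̄ ^ i          ≡⟨ ≡.cong (λ m → ζ ^ m * ζ̄ ^ i) (ℕₚ.m+[n∸m]≡n (ℕₚ.<⇒≤ i<j)) ⟩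
        ζ ^ j * ζ̄ ^ i                          ≈⟨ *-congʳ e ⟨
        ζ ^ i * ζ̄ ^ i                          ≈⟨ ζ^mζ̄^m i ⟩
        1#                                     ∎)

      powers : Fin n → Carrier
      powers j = ζ ^ toℕ j

      powers-distinct : Distinct powers
      powers-distinct i j i≢j e with ℕₚ.<-cmp (toℕ i) (toℕ j)
      ... | tri< l _ _ = power≉ (toℕ i) (toℕ j) l (Finₚ.toℕ<n j) e
      ... | tri≈ _ p _ = i≢j (Finₚ.toℕ-injective p)
      ... | tri> _ _ l = power≉ (toℕ j) (toℕ i) l (Finₚ.toℕ<n i) (sym e)

      eval-shift : ∀ e p y → eval (shift e p) y ≈ y ^ e * eval p y
      eval-shift zero    p y = sym (*-identityˡ _)
      eval-shift (suc e) p y = trans (+-identityˡ _) (trans (*-congˡ (eval-shift e p y)) (sym (*-assoc _ _ _)))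

      ζ̄^n : ζ̄ ^ n ≈ 1#
      ζ̄^n = trans (sym (trans (*-congʳ ζ^n) (*-identityˡ _))) (ζ^mζ̄^m n)

      power^n : ∀ z → z ^ n ≈ 1# → ∀ m → (z ^ m) ^ n ≈ 1#
      power^n z e m = trans (^-assocʳ z m n) (trans (reflexive (≡.cong (z ^_) (ℕₚ.*-comm m n)))
        (trans (sym (^-assocʳ z n m)) (trans (^-congˡ m e) (1^ m))))

      -- Together with the n distinct powers of ζ, a further solution would give n + 1 roots of Xⁿ -
      -- 1.
      is-power : ∀ y → y ^ n ≈ 1# → ¬ ¬ (∃[ j ] y ≈ powers j)
      is-power y y^n none = go n ≡.refl 0<n
        where
        x : Fin (suc n) → Carrier
        x zero    = y
        x (suc j) = powers j
        distinct : Distinct x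
        distinct zero    zero    i≢j = contradiction ≡.refl i≢j
        distinct zero    (suc j) i≢j e = none (j , e)
        distinct (suc i) zero    i≢j e = none (i , sym e)
        distinct (suc i) (suc j) i≢j = powers-distinct i j (i≢j ∘ ≡.cong suc)
        root : ∀ i → x i ^ n ≈ 1#
        root zero    = y^n
        root (suc j) = power^n ζ ζ^n (toℕ j)
        go : ∀ m → m ≡ n → 0 < m → ⊥
        go (suc n′) n≡ _ = contradiction (coeffs (roots-unique (suc n) x distinct f (ℕₚ.≤-reflexive (≡.trans (len n′) (≡.cong suc n≡))) vanish) 0)
            λ e → nontrivial (trans (solve 1 (λ o → o := :- (:- o)) refl 1#) (trans (-‿cong e) (solve 0 (:- con (+ 0) := con (+ 0)) refl)))
          where
          f = (- 1#) ∷ shift n′ (const 1#)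
          len : ∀ m → length ((- 1#) ∷ shift m (const 1#)) ≡ suc (suc m)
          len zero    = ≡.refl
          len (suc m) = ≡.cong suc (len m)
          value : ∀ z → z ^ suc n′ ≈ 1# → eval f z ≈ 0#
          value z e = trans (+-congˡ (*-congˡ (trans (eval-shift n′ (const 1#) z) (trans (*-congˡ (eval-const z 1#)) (*-identityʳ _)))))
            (trans (+-congˡ e) (-‿inverseˡ 1#))
          vanish : ∀ i → eval f (x i) ≈ 0#
          vanish i = value (x i) (≡.subst (λ m → x i ^ m ≈ 1#) (≡.sym n≡) (root i))

      eval-sum : ∀ m p y → length p ≤ m → eval p y ≈ sum {m} (λ i → coeff p (toℕ i) * y ^ toℕ i)
      eval-sum m       []      y l       = sym (sum-zero {m} (λ i → 0# * y ^ toℕ i) λ i → zeroˡ _)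
      eval-sum (suc m) (a ∷ p) y (s≤s l) = +-cong (sym (*-identityʳ a)) (trans (*-congˡ (eval-sum m p y l))
        (trans (*-distribˡ-sum {m} y (λ i → coeff p (toℕ i) * y ^ toℕ i)) (sum-cong-≋ {m} λ i → solve 3 (λ a y z → y :* (a :* z) := a :* (y :* z)) refl (coeff p (toℕ i)) y (y ^ toℕ i))))

      sum-single : ∀ {m} (i : Fin m) (f : Fin m → Carrier) → (∀ j → j ≢ i → f j ≈ 0#) → sum f ≈ f i
      sum-single zero    f z = trans (+-congˡ (sum-zero (λ j → f (suc j)) λ j → z (suc j) λ ())) (+-identityʳ _)
      sum-single (suc i) f z = trans (+-cong (z zero λ ()) (sum-single i (λ j → f (suc j)) λ j j≢i → z (suc j) (j≢i ∘ Finₚ.suc-injective))) (+-identityˡ _)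

      geometric-sum : ∀ m u → (u - 1#) * sum {m} (λ j → u ^ toℕ j) ≈ u ^ m - 1#
      geometric-sum zero    u = trans (zeroʳ _) (sym (-‿inverseʳ 1#))
      geometric-sum (suc m) u = trans (*-congˡ (+-congˡ (sym (*-distribˡ-sum {m} u (λ j → u ^ toℕ j)))))
        (trans (solve 2 (λ u s → (u :- con (+ 1)) :* (con (+ 1) :+ u :* s) := (u :- con (+ 1)) :+ u :* ((u :- con (+ 1)) :* s)) refl u (sum {m} (λ j → u ^ toℕ j)))
          (trans (+-congˡ (*-congˡ (geometric-sum m u))) (solve 2 (λ u p → (u :- con (+ 1)) :+ u :* (p :- con (+ 1)) := u :* p :- con (+ 1)) refl u (u ^ m))))

      sum-1 : ∀ m → sum {m} (λ _ → 1#) ≈ fromℤ (+ m)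
      sum-1 zero    = refl
      sum-1 (suc m) = trans (+-congˡ (sum-1 m)) (sym (fromℤ-+ (+ 1) (+ m)))

      -- After expansion the sum over j is taken first. The powers of ζⁱ⁻ᵏ add up to n for i = k.
      -- Otherwise ζⁱ⁻ᵏ is an n-th root of unity different from 1 and the geometric sum vanishes.
      parseval : ∀ p → length p ≤ n →
        sum {n} (λ j → eval p (ζ ^ toℕ j) * eval p (ζ̄ ^ toℕ j)) ≈ fromℤ (+ n) * sum {n} (λ i → coeff p (toℕ i) * coeff p (toℕ i))
      parseval p l = begin
        sum {n} (λ j → eval p (ζ ^ toℕ j) * eval p (ζ̄ ^ toℕ j))
          ≈⟨ sum-cong-≋ {n} product ⟩
        sum {n} (λ j → sum {n} λ i → sum {n} λ k → a i * a k * u i k ^ toℕ j)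
          ≈⟨ ∑-comm {n} {n} (λ j i → sum {n} λ k → a i * a k * u i k ^ toℕ j) ⟩
        sum {n} (λ i → sum {n} λ j → sum {n} λ k → a i * a k * u i k ^ toℕ j)
          ≈⟨ sum-cong-≋ {n} (λ i → ∑-comm {n} {n} (λ j k → a i * a k * u i k ^ toℕ j)) ⟩
        sum {n} (λ i → sum {n} λ k → sum {n} λ j → a i * a k * u i k ^ toℕ j)
          ≈⟨ sum-cong-≋ {n} (λ i → sum-cong-≋ {n} (factor-out i)) ⟩
        sum {n} (λ i → sum {n} λ k → a i * a k * sum {n} (λ j → u i k ^ toℕ j))
          ≈⟨ sum-cong-≋ {n} (λ i → trans (sum-single i _ λ k k≢i → trans (*-congˡ (off-diagonal i k k≢i)) (zeroʳ _)) (*-congˡ (diagonal i))) ⟩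
        sum {n} (λ i → a i * a i * fromℤ (+ n))
          ≈⟨ *-distribʳ-sum {n} (fromℤ (+ n)) (λ i → a i * a i) ⟨
        sum {n} (λ i → a i * a i) * fromℤ (+ n)
          ≈⟨ *-comm _ _ ⟩
        fromℤ (+ n) * sum {n} (λ i → a i * a i) ∎
        where
        a : Fin n → Carrier
        a i = coeff p (toℕ i)
        u : Fin n → Fin n → Carrier
        u i k = ζ ^ toℕ i * ζ̄ ^ toℕ k
        swap : ∀ z i j → (z ^ i) ^ j ≈ (z ^ j) ^ i
        swap z i j = trans (^-assocʳ z i j) (trans (reflexive (≡.cong (z ^_) (ℕₚ.*-comm i j))) (sym (^-assocʳ z j i)))
        product : ∀ j → eval p (ζ ^ toℕ j) * eval p (ζ̄ ^ toℕ j) ≈ sum {n} λ i → sum {n} λ k → a i * a k * u i k ^ toℕ j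
        product j = trans (*-cong (eval-sum n p (ζ ^ toℕ j) l) (eval-sum n p (ζ̄ ^ toℕ j) l))
          (trans (*-distribʳ-sum {n} (sum {n} (λ k → a k * (ζ̄ ^ toℕ j) ^ toℕ k)) (λ i → a i * (ζ ^ toℕ j) ^ toℕ i)) (sum-cong-≋ {n} λ i →
            trans (*-distribˡ-sum {n} (a i * (ζ ^ toℕ j) ^ toℕ i) (λ k → a k * (ζ̄ ^ toℕ j) ^ toℕ k)) (sum-cong-≋ {n} λ k →
              trans (solve 4 (λ a b x y → (a :* x) :* (b :* y) := a :* b :* (x :* y)) refl (a i) (a k) ((ζ ^ toℕ j) ^ toℕ i) ((ζ̄ ^ toℕ j) ^ toℕ k))
                (*-congˡ {a i * a k} (trans (*-cong (swap ζ (toℕ j) (toℕ i)) (swap ζ̄ (toℕ j) (toℕ k))) (sym (^-distrib-* (ζ ^ toℕ i) (ζ̄ ^ toℕ k) (toℕ j))))))))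
        factor-out : ∀ i k → sum {n} (λ j → a i * a k * u i k ^ toℕ j) ≈ a i * a k * sum {n} (λ j → u i k ^ toℕ j)
        factor-out i k = sym (*-distribˡ-sum {n} (a i * a k) (λ j → u i k ^ toℕ j))
        diagonal : ∀ i → sum {n} (λ j → u i i ^ toℕ j) ≈ fromℤ (+ n)
        diagonal i = trans (sum-cong-≋ {n} λ j → trans (^-congˡ (toℕ j) (ζ^mζ̄^m (toℕ i))) (1^ (toℕ j))) (sum-1 n)
        off-diagonal : ∀ i k → k ≢ i → sum {n} (λ j → u i k ^ toℕ j) ≈ 0#
        off-diagonal i k k≢i = cancelˡ (trans (geometric-sum n (u i k)) (trans (+-congʳ u^n) (-‿inverseʳ 1#))) (difference≉0 u≉1)
          where
          u^n : u i k ^ n ≈ 1#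
          u^n = trans (^-distrib-* (ζ ^ toℕ i) (ζ̄ ^ toℕ k) n) (trans (*-cong (power^n ζ ζ^n (toℕ i)) (power^n ζ̄ ζ̄^n (toℕ k))) (*-identityˡ 1#))
          u≉1 : ¬ u i k ≈ 1#
          u≉1 e = powers-distinct i k (k≢i ∘ ≡.sym) (begin
            ζ ^ toℕ i                               ≈⟨ *-identityʳ _ ⟨
            ζ ^ toℕ i * 1#                          ≈⟨ *-congˡ (ζ^mζ̄^m (toℕ k)) ⟨
            ζ ^ toℕ i * (ζ ^ toℕ k * ζ̄ ^ toℕ k)     ≈⟨ solve 3 (λ a b d → a :* (b :* d) := b :* (a :* d)) refl (ζ ^ toℕ i) (ζ ^ toℕ k) (ζ̄ ^ toℕ k) ⟩
            ζ ^ toℕ k * u i k                       ≈⟨ *-congˡ e ⟩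
            ζ ^ toℕ k * 1#                          ≈⟨ *-identityʳ _ ⟩
            ζ ^ toℕ k                               ∎)
        only-diagonal : ∀ i → sum {n} (λ k → a i * a k * sum {n} (λ j → u i k ^ toℕ j)) ≈ a i * a i * fromℤ (+ n)
        only-diagonal i = trans (sum-single i (λ k → a i * a k * sum {n} (λ j → u i k ^ toℕ j))
          λ k k≢i → trans (*-congˡ {a i * a k} (off-diagonal i k k≢i)) (zeroʳ (a i * a k))) (*-congˡ {a i * a i} (diagonal i))

-- Positivity in the cyclotomic field

record AbelianAction (K : CommutativeRing c ℓ) ℓᵃ : Set (c ⊔ ℓ ⊔ lsuc ℓᵃ) where
  open CommutativeRing K
  open PolynomialRing K using (eval; _≋_)
  infix  10 _⁻¹
  infixr 9 _∙_
  infixr 8 _·_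
  field
    Aut       : Set ℓᵃ
    act       : Aut → Hom rawRing K
    _∙_       : Aut → Aut → Aut
    _⁻¹       : Aut → Aut
    identity  : Aut
    rational  : Hom ℚ.+-*-rawRing K
  _·_ : Aut → Carrier → Carrier
  σ · x = Hom.⟦_⟧ (act σ) x
  ι : ℚ → Carrier
  ι = Hom.⟦_⟧ rational
  field
    ∙-act     : ∀ σ τ x → (σ ∙ τ) · x ≈ σ · (τ · x)
    inverseʳ  : ∀ σ x → σ · (σ ⁻¹ · x) ≈ x
    inverseˡ  : ∀ σ x → σ ⁻¹ · (σ · x) ≈ x
    id-act    : ∀ x → identity · x ≈ x
    commutes  : ∀ σ τ x → σ · (τ · x) ≈ τ · (σ · x)
    act-ι     : ∀ σ q → σ · ι q ≈ ι q
    fixed     : ∀ x → (∀ σ → σ · x ≈ x) → ∃[ q ] x ≈ ι q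
    algebraic : ∀ x → ∃[ p ] ¬ map ι p ≋ [] × eval (map ι p) x ≈ 0#

  ·-cong : ∀ σ {x y} → x ≈ y → σ · x ≈ σ · y
  ·-cong σ = Hom.⟦⟧-cong (act σ)

  ·-injective : ∀ σ {x y} → σ · x ≈ σ · y → x ≈ y
  ·-injective σ {x} {y} e = trans (sym (inverseˡ σ x)) (trans (·-cong (σ ⁻¹) e) (inverseˡ σ y))

  Fixes : Aut → Carrier → Set ℓ
  Fixes σ x = σ · x ≈ x

  -- the fixed field of the stabiliser of x
  FixedBy : Carrier → Carrier → Set (ℓᵃ ⊔ ℓ)
  FixedBy x y = ∀ σ → Fixes σ x → Fixes σ y

  agree : ∀ {x y} → FixedBy x y → ∀ σ τ → σ · x ≈ τ · x → σ · y ≈ τ · y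
  agree {x} {y} fix σ τ e = trans (sym (inverseʳ τ (σ · y))) (·-cong τ (trans (sym (∙-act (τ ⁻¹) σ y)) (fix (τ ⁻¹ ∙ σ)
    (trans (∙-act (τ ⁻¹) σ x) (trans (·-cong (τ ⁻¹) e) (inverseˡ τ x))))))

  -- Fixed fields of stabilisers satisfy `S-act` because automorphisms commute. It is what lets
  -- positivity pass from an element to its conjugates.
  record IsSubfield (S : Carrier → Set (ℓᵃ ⊔ ℓ)) : Set (c ⊔ ℓᵃ ⊔ ℓ) where
    field
      S-cong    : ∀ {x y} → x ≈ y → S x → S y
      S-+       : ∀ {x y} → S x → S y → S (x + y)
      S-*       : ∀ {x y} → S x → S y → S (x * y)
      S-neg     : ∀ {x} → S x → S (- x)
      S-fromℤ   : ∀ i → S (FromIntegers.fromℤ K i)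
      S-inverse : ∀ {x y} → x * y ≈ 1# → S x → S y
      S-act     : ∀ σ {x} → S x → S (σ · x)

  fixedBy-isSubfield : ∀ x → IsSubfield (FixedBy x)
  fixedBy-isSubfield x = record
    { S-cong = λ e s σ f → trans (·-cong σ (sym e)) (trans (s σ f) e)
    ; S-+ = λ s t σ f → trans (Hom.+-homo (act σ) _ _) (+-cong (s σ f) (t σ f))
    ; S-* = λ s t σ f → trans (Hom.*-homo (act σ) _ _) (*-cong (s σ f) (t σ f))
    ; S-neg = λ s σ f → trans (Hom.neg-homo (act σ) _) (-‿cong (s σ f))
    ; S-fromℤ = λ i σ f → fromℤ-homo {R = K} (act σ) i
    ; S-inverse = λ {y} {z} e s σ f → inverse-unique y z (σ · z) e
        (trans (*-congʳ (sym (s σ f))) (trans (sym (Hom.*-homo (act σ) y z)) (trans (·-cong σ e) (Hom.1-homo (act σ)))))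
    ; S-act = λ σ s τ f → trans (commutes τ σ _) (·-cong σ (s τ f)) }
    where
    inverse-unique : ∀ y z w → y * z ≈ 1# → y * w ≈ 1# → w ≈ z
    inverse-unique y z w yz yw = trans (sym (*-identityˡ w)) (trans (*-congʳ (trans (sym yz) (*-comm y z)))
      (trans (*-assoc z y w) (trans (*-congˡ yw) (*-identityʳ z))))

  fixedBy-refl : ∀ x → FixedBy x x
  fixedBy-refl x σ f = f

module Positivity {K : CommutativeRing c ℓ} (field′ : IsClassicalField K)
  (stable : ∀ {x y} → ¬ ¬ (CommutativeRing._≈_ K x y) → CommutativeRing._≈_ K x y)
  (G : AbelianAction K ℓᵃ) where
  open CommutativeRing K
  open AbelianAction G
  open FromIntegers K using (fromℤ; fromℤ-+; solve; _:=_; _:+_; _:*_; _:-_; :-_)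

  data Pos (S : Carrier → Set (ℓᵃ ⊔ ℓ)) (J : Aut) : Carrier → Set (c ⊔ ℓᵃ ⊔ ℓ) where
    norm : ∀ {x} y → S y → x ≈ y * J · y → Pos S J x
    add  : ∀ {x y z} → Pos S J x → Pos S J y → z ≈ x + y → Pos S J z

  module _ {S : Carrier → Set (ℓᵃ ⊔ ℓ)} (S-sub : IsSubfield S) {J : Aut} (involutive : ∀ {x} → S x → J · (J · x) ≈ x) where
    open IsSubfield S-sub
    private
      module J = Hom (act J)

    pos-cong : ∀ {x y} → x ≈ y → Pos S J x → Pos S J y
    pos-cong e (norm y s f)  = norm y s (trans (sym e) f)
    pos-cong e (add p q f)   = add p q (trans (sym e) f)

    pos-+ : ∀ {x y} → Pos S J x → Pos S J y → Pos S J (x + y)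
    pos-+ p q = add p q refl

    pos-S : ∀ {x} → Pos S J x → S x
    pos-S (norm y s e) = S-cong (sym e) (S-* s (S-act J s))
    pos-S (add p q e)  = S-cong (sym e) (S-+ (pos-S p) (pos-S q))

    pos-fixed : ∀ {x} → Pos S J x → J · x ≈ x
    pos-fixed (norm y s e) = trans (·-cong J e) (trans (J.*-homo y (J · y)) (trans (*-congˡ (involutive s)) (trans (*-comm _ _) (sym e))))
    pos-fixed (add p q e)  = trans (·-cong J e) (trans (J.+-homo _ _) (trans (+-cong (pos-fixed p) (pos-fixed q)) (sym e)))

    pos-* : ∀ {x y} → Pos S J x → Pos S J y → Pos S J (x * y)
    pos-* (norm y s e) (norm z t f) = norm (y * z) (S-* s t) (trans (*-cong e f)
      (trans (solve 4 (λ y y′ z z′ → (y :* y′) :* (z :* z′) := (y :* z) :* (y′ :* z′)) refl y (J · y) z (J · z)) (*-congˡ (sym (J.*-homo y z)))))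
    pos-* p@(norm _ _ _) (add q r e) = add (pos-* p q) (pos-* p r) (trans (*-congˡ e) (distribˡ _ _ _))
    pos-* (add p q e) r = add (pos-* p r) (pos-* q r) (trans (*-congʳ e) (distribʳ _ _ _))

    pos-square : ∀ {x} → S x → J · x ≈ x → Pos S J (x * x)
    pos-square {x} s e = norm x s (*-congˡ (sym e))

    pos-ℕ : ∀ n → Pos S J (fromℤ (+ n))
    pos-ℕ zero    = norm 0# (S-fromℤ (+ 0)) (sym (zeroˡ _))
    pos-ℕ (suc n) = add (norm 1# (S-fromℤ (+ 1)) (sym (trans (*-identityˡ _) J.1-homo))) (pos-ℕ n) (fromℤ-+ (+ 1) (+ n))

    pos-act : ∀ σ {x} → Pos S J x → Pos S J (σ · x)
    pos-act σ (norm y s e) = norm (σ · y) (S-act σ s) (trans (·-cong σ e) (trans (Hom.*-homo (act σ) _ _) (*-congˡ (commutes σ J y))))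
    pos-act σ (add p q e)  = add (pos-act σ p) (pos-act σ q) (trans (·-cong σ e) (Hom.+-homo (act σ) _ _))

    module _ (proper : ¬ Pos S J (- 1#)) where

      -- If x had an inverse z, then z would be real and - 1 = y x z² would be a sum of norms.
      pos-cancel : ∀ {x y} → Pos S J x → Pos S J y → x + y ≈ 0# → x ≈ 0#
      pos-cancel {x} {y} p q e = stable λ x≉0 → IsClassicalField.invertible field′ x x≉0 λ (z , xz≈1) →
        let s-z = S-inverse xz≈1 (pos-S p)
            J-z = trans (sym (*-identityˡ _)) (trans (*-congʳ (trans (sym xz≈1) (*-comm x z))) (trans (*-assoc z x _)
                    (trans (*-congˡ (trans (*-congʳ (sym (pos-fixed p))) (trans (sym (J.*-homo x z)) (trans (·-cong J xz≈1) J.1-homo)))) (*-identityʳ z))))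
        in proper (pos-cong (trans (solve 3 (λ x y z → (y :* x) :* (z :* z) := ((x :+ y) :- x) :* z :* (x :* z)) refl x y z)
             (trans (*-cong (trans (*-congʳ (trans (+-congʳ e) (+-identityˡ _))) (trans (solve 2 (λ x z → (:- x) :* z := :- (x :* z)) refl x z) (-‿cong xz≈1))) xz≈1)
               (*-identityʳ _))) (pos-* (pos-* q p) (pos-square s-z J-z)))

  record NonNegative (x : Carrier) : Set (c ⊔ ℓ) where
    constructor nonNegative
    field
      value : ℚ
      0≤    : 0ℚ ℚ.≤ value
      x≈    : x ≈ ι value

  private
    module ι = Hom rational

    ι-injective-0 : ∀ q → ι q ≈ 0# → q ≡ 0ℚ
    ι-injective-0 q e with q ℚₚ.≟ 0ℚ
    ... | yes p = p
    ... | no ¬p = contradiction (trans (sym ι.1-homo) (trans (ι.⟦⟧-cong (≡.sym (ℚₚ.*-inverseʳ q {{ℚ.≢-nonZero ¬p}})))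
          (trans (ι.*-homo q _) (trans (*-congʳ e) (zeroˡ _))))) (IsClassicalField.nontrivial field′)

    square≥0 : ∀ q → 0ℚ ℚ.≤ q ℚ.* q
    square≥0 q with ℚₚ.≤-total 0ℚ q
    ... | inj₁ 0≤q = ℚₚ.nonNegative⁻¹ (q ℚ.* q) {{ℚₚ.nonNeg*nonNeg⇒nonNeg q {{ℚ.nonNegative 0≤q}} q {{ℚ.nonNegative 0≤q}}}}
    ... | inj₂ q≤0 = ≡.subst (0ℚ ℚ.≤_) square-neg
          (ℚₚ.nonNegative⁻¹ (ℚ.- q ℚ.* ℚ.- q) {{ℚₚ.nonNeg*nonNeg⇒nonNeg (ℚ.- q) {{ℚ.nonNegative 0≤-q}} (ℚ.- q) {{ℚ.nonNegative 0≤-q}}}})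
      where
      open import Algebra.Properties.Group ℚₚ.+-0-group using (⁻¹-involutive)
      0≤-q = ℚₚ.neg-antimono-≤ q≤0
      square-neg : ℚ.- q ℚ.* ℚ.- q ≡ q ℚ.* q
      square-neg = ≡.trans (≡.sym (ℚₚ.neg-distribˡ-* q (ℚ.- q))) (≡.trans (≡.cong ℚ.-_ (≡.sym (ℚₚ.neg-distribʳ-* q q))) (⁻¹-involutive (q ℚ.* q)))

  nonNegative-cong : ∀ {x y} → x ≈ y → NonNegative x → NonNegative y
  nonNegative-cong e (nonNegative q p f) = nonNegative q p (trans (sym e) f)

  nonNegative-+ : ∀ {x y} → NonNegative x → NonNegative y → NonNegative (x + y)
  nonNegative-+ (nonNegative p 0≤p e) (nonNegative q 0≤q f) = nonNegative (p ℚ.+ q) (ℚₚ.+-mono-≤ 0≤p 0≤q) (trans (+-cong e f) (sym (ι.+-homo p q)))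

  nonNegative-0 : NonNegative 0#
  nonNegative-0 = nonNegative 0ℚ ℚₚ.≤-refl (sym ι.0-homo)

  nonNegative-square : ∀ {x} q → x ≈ ι q → NonNegative (x * x)
  nonNegative-square q e = nonNegative (q ℚ.* q) (square≥0 q) (trans (*-cong e e) (sym (ι.*-homo q q)))

  nonNegative-ℕ* : ∀ n {x} → NonNegative x → NonNegative (fromℤ (+ n) * x)
  nonNegative-ℕ* zero    p = nonNegative-cong (sym (zeroˡ _)) nonNegative-0
  nonNegative-ℕ* (suc n) {x} p = nonNegative-cong (sym (trans (*-congʳ (fromℤ-+ (+ 1) (+ n))) (trans (distribʳ x 1# (fromℤ (+ n))) (+-congʳ (*-identityˡ x)))))
    (nonNegative-+ p (nonNegative-ℕ* n p))

  nonNegative-cancel : ∀ {x y} → NonNegative x → NonNegative y → x + y ≈ 0# → x ≈ 0#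
  nonNegative-cancel (nonNegative p 0≤p e) (nonNegative q 0≤q f) sum = trans e (trans (ι.⟦⟧-cong p≡0) ι.0-homo)
    where
    p+q≡0 : p ℚ.+ q ≡ 0ℚ
    p+q≡0 = ι-injective-0 (p ℚ.+ q) (trans (ι.+-homo p q) (trans (+-cong (sym e) (sym f)) sum))
    p≡0 : p ≡ 0ℚ
    p≡0 = ℚₚ.≤-antisym (≡.subst (p ℚ.≤_) p+q≡0 (≡.subst (ℚ._≤ p ℚ.+ q) (ℚₚ.+-identityʳ p) (ℚₚ.+-monoʳ-≤ p 0≤q))) 0≤p

module CyclotomicField {K : CommutativeRing c ℓ} (field′ : IsClassicalField K)
  (stable : ∀ {x y} → ¬ ¬ (CommutativeRing._≈_ K x y) → CommutativeRing._≈_ K x y)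
  (characteristic-0 : ∀ n → ¬ (CommutativeRing._≈_ K (FromIntegers.fromℤ K (+ suc n)) (CommutativeRing.0# K)))
  (G : AbelianAction K ℓᵃ)
  (ζ ζ̄ : CommutativeRing.Carrier K) (n : ℕ) where
  open CommutativeRing K hiding (zero)
  open AbelianAction G
  open FromIntegers K using (fromℤ; solve; _:=_; _:*_)
  open Interpolation field′ stable
  open Positivity field′ stable G
  open PolynomialRing K
  open PrimitiveRoot ζ ζ̄ n
  open import Relation.Binary.Reasoning.Setoid setoid

  module _ (0<n : 0 < n) (ζζ̄ : ζ * ζ̄ ≈ 1#) (ζ^n : ζ ^ n ≈ 1#) (order-n : ∀ m → 0 < m → m < n → ¬ ζ ^ m ≈ 1#) where

    private
      x : Fin n → Carrier
      x = powers 0<n ζζ̄ ζ^n order-n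
      x-distinct = powers-distinct 0<n ζζ̄ ζ^n order-n
      isPower = is-power 0<n ζζ̄ ζ^n order-n

    Conjugate : Fin n → Set (ℓᵃ ⊔ ℓ)
    Conjugate j = ∃[ σ ] σ · ζ ≈ x j

    -- A decision for each of the finitely many powers is a parameter, so that `val` is an actual
    -- function. It becomes available under a double negation.
    module Trace (conjugate? : ∀ j → Dec (Conjugate j)) where

      -- y ↦ (σ y)_j, where σ ζ = ζʲ, extended by 0 to the other powers of ζ
      val : Carrier → Fin n → Carrier
      val y j with conjugate? j
      ... | yes (σ , _) = σ · y
      ... | no _        = 0#

      val-conjugate : ∀ {y} → FixedBy ζ y → ∀ j σ → σ · ζ ≈ x j → val y j ≈ σ · y
      val-conjugate fix j σ e with conjugate? j
      ... | yes (τ , e′) = agree fix τ σ (trans e′ (sym e))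
      ... | no ¬conj     = contradiction (σ , e) ¬conj

      val-other : ∀ y j → ¬ Conjugate j → val y j ≈ 0#
      val-other y j ¬conj with conjugate? j
      ... | yes conj = contradiction conj ¬conj
      ... | no _     = refl

      val-homo : ∀ y z j → val (y + z) j ≈ val y j + val z j
      val-homo y z j with conjugate? j
      ... | yes (σ , _) = Hom.+-homo (act σ) y z
      ... | no _        = sym (+-identityʳ 0#)

      tr : Carrier → Carrier
      tr y = sum {n} (val y)

      tr-+ : ∀ y z → tr (y + z) ≈ tr y + tr z
      tr-+ y z = trans (sum-cong-≋ {n} (val-homo y z)) (∑-distrib-+ {n} (val y) (val z))

      val-cong : ∀ {y z} → y ≈ z → ∀ j → val y j ≈ val z j
      val-cong e j with conjugate? j
      ... | yes (σ , _) = ·-cong σ e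
      ... | no _        = refl

      tr-cong : ∀ {y z} → y ≈ z → tr y ≈ tr z
      tr-cong e = sum-cong-≋ {n} (val-cong e)

      nonNegative-sum : ∀ m {f : Fin m → Carrier} → (∀ i → NonNegative (f i)) → NonNegative (sum f)
      nonNegative-sum zero    nn = nonNegative-0
      nonNegative-sum (suc m) nn = nonNegative-+ (nn zero) (nonNegative-sum m λ i → nn (suc i))

      -- The polynomial of degree below n with value σ y at each conjugate σ ζ and 0 at the
      -- remaining n-th roots of unity. The extension by 0 makes Parseval's identity applicable
      -- without knowledge of which powers are conjugate. The coefficients are rational because
      -- every automorphism respects these data.
      record Interpolant (y : Carrier) : Set (c ⊔ ℓ) where
        field
          p           : Poly
          short       : length p ≤ n
          interpolates : ∀ j → eval p (x j) ≈ val y j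
          coefficient : ∀ k → ∃[ q ] coeff p k ≈ ι q

        squares : NonNegative (sum {n} λ i → coeff p (toℕ i) * coeff p (toℕ i))
        squares = nonNegative-sum n λ i → nonNegative-square _ (proj₂ (coefficient (toℕ i)))

        total : Carrier
        total = sum {n} λ j → eval p (ζ ^ toℕ j) * eval p (ζ̄ ^ toℕ j)

        total≥0 : NonNegative total
        total≥0 = nonNegative-cong (sym (parseval 0<n ζζ̄ ζ^n order-n p short)) (nonNegative-ℕ* n squares)

        total≈0⇒ : total ≈ 0# → ∀ j → val y j ≈ 0#
        total≈0⇒ e j = trans (sym (interpolates j)) (trans (eval-sum 0<n ζζ̄ ζ^n order-n n p (x j) short)
            (sum-zero {n} (λ i → coeff p (toℕ i) * x j ^ toℕ i) λ i → trans (*-congʳ (coefficients-0 i)) (zeroˡ _)))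
          where
          n≉0 : ¬ fromℤ (+ n) ≈ 0#
          n≉0 = positive n 0<n
            where
            positive : ∀ n → 0 < n → ¬ fromℤ (+ n) ≈ 0#
            positive (suc n) _ = characteristic-0 n
          squares≈0 : sum {n} (λ i → coeff p (toℕ i) * coeff p (toℕ i)) ≈ 0#
          squares≈0 = cancelˡ (trans (sym (parseval 0<n ζζ̄ ζ^n order-n p short)) e) n≉0
          terms-0 : ∀ m (f : Fin m → Carrier) → (∀ i → NonNegative (f i)) → sum f ≈ 0# → ∀ i → f i ≈ 0#
          terms-0 (suc m) f nn e = λ where
              zero    → head
              (suc i) → terms-0 m (λ i → f (suc i)) (λ i → nn (suc i)) (trans (sym (trans (+-congʳ head) (+-identityˡ _))) e) i
            where
            head : f zero ≈ 0#
            head = nonNegative-cancel (nn zero) (nonNegative-sum m (λ i → nn (suc i))) e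
          coefficients-0 : ∀ i → coeff p (toℕ i) ≈ 0#
          coefficients-0 i = stable λ ≉0 → ≉0 (cancelˡ (terms-0 n (λ i → coeff p (toℕ i) * coeff p (toℕ i))
            (λ i → nonNegative-square _ (proj₂ (coefficient (toℕ i)))) squares≈0 i) ≉0)

      interpolant : ∀ y → FixedBy ζ y → ¬ ¬ Interpolant y
      interpolant y fix = interpolate x x-distinct (val y) >>= λ (p , short , ev) → return record
          { p = p ; short = short ; interpolates = ev
          ; coefficient = λ k → fixed (coeff p k) λ τ → interpolant-invariant x x-distinct p short (act τ) (permutes p ev τ) k }
        where
        permutes : ∀ p → (∀ j → eval p (x j) ≈ val y j) → ∀ τ j → ¬ ¬ (∃[ i ] τ · x i ≈ x j × τ · eval p (x i) ≈ eval p (x j))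
        permutes p ev τ j = isPower (τ ⁻¹ · x j) root >>= λ (i , e) →
            let τx = trans (·-cong τ (sym e)) (inverseʳ τ (x j)) in
            return (i , τx , trans (·-cong τ (ev i)) (trans (moved i τx) (sym (ev j))))
          where
          root : (τ ⁻¹ · x j) ^ n ≈ 1#
          root = trans (sym (^-homo (act (τ ⁻¹)) (x j) n)) (trans (·-cong (τ ⁻¹) (power^n 0<n ζζ̄ ζ^n order-n ζ ζ^n (toℕ j))) (Hom.1-homo (act (τ ⁻¹))))
          moved : ∀ i → τ · x i ≈ x j → τ · val y i ≈ val y j
          moved i τx with conjugate? i
          ... | yes (σ , e) = trans (sym (∙-act τ σ y)) (sym (val-conjugate fix j (τ ∙ σ) (trans (∙-act τ σ ζ) (trans (·-cong τ e) τx))))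
          ... | no ¬conj = trans (Hom.0-homo (act τ)) (sym (val-other y j λ (σ , e) → ¬conj (τ ⁻¹ ∙ σ ,
                trans (∙-act (τ ⁻¹) σ ζ) (trans (·-cong (τ ⁻¹) (trans e (sym τx))) (inverseˡ τ (x i))))))

      1-fixed : FixedBy ζ 1#
      1-fixed σ _ = Hom.1-homo (act σ)

      ¬total-1≈0 : (I : Interpolant 1#) → ¬ Interpolant.total I ≈ 0#
      ¬total-1≈0 I e = isPower ζ ζ^n λ (j , ζ≈) → IsClassicalField.nontrivial field′
        (trans (sym (id-act 1#)) (trans (sym (val-conjugate 1-fixed j identity (trans (id-act ζ) ζ≈))) (Interpolant.total≈0⇒ I e j)))

      conjugate-inverse : ∀ j σ → σ · ζ ≈ x j → σ · ζ̄ ≈ ζ̄ ^ toℕ j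
      conjugate-inverse j σ e = begin
        σ · ζ̄                                  ≈⟨ *-identityʳ _ ⟨
        σ · ζ̄ * 1#                             ≈⟨ *-congˡ (ζ^mζ̄^m 0<n ζζ̄ ζ^n order-n (toℕ j)) ⟨
        σ · ζ̄ * (ζ ^ toℕ j * ζ̄ ^ toℕ j)        ≈⟨ solve 3 (λ a b d → a :* (b :* d) := (b :* a) :* d) refl (σ · ζ̄) (ζ ^ toℕ j) (ζ̄ ^ toℕ j) ⟩
        (ζ ^ toℕ j * σ · ζ̄) * ζ̄ ^ toℕ j        ≈⟨ *-congʳ (*-congʳ e) ⟨
        (σ · ζ * σ · ζ̄) * ζ̄ ^ toℕ j            ≈⟨ *-congʳ (trans (sym (Hom.*-homo (act σ) ζ ζ̄)) (trans (·-cong σ ζζ̄) (Hom.1-homo (act σ)))) ⟩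
        1# * ζ̄ ^ toℕ j                         ≈⟨ *-identityˡ _ ⟩
        ζ̄ ^ toℕ j                              ∎

      ζ̄-power : ∀ (j : Fin n) → ¬ ¬ (∃[ i ] ζ̄ ^ toℕ j ≈ x i)
      ζ̄-power j = isPower (ζ̄ ^ toℕ j) (power^n 0<n ζζ̄ ζ^n order-n ζ̄ (ζ̄^n 0<n ζζ̄ ζ^n order-n) (toℕ j))

      -- If ζ̄ were not a conjugate of ζ, the idempotent of the conjugates of ζ would be orthogonal to its own conjugate.
      conjugation : ¬ ¬ (∃[ σ ] σ · ζ ≈ ζ̄)
      conjugation none = interpolant 1# 1-fixed λ I → ¬total-1≈0 I (sum-zero {n} _ (zero-term I))
        where
        zero-term : (I : Interpolant 1#) → let open Interpolant I in ∀ j → eval p (ζ ^ toℕ j) * eval p (ζ̄ ^ toℕ j) ≈ 0#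
        zero-term I j = trans (*-congʳ (interpolates j)) (case (conjugate? j))
          where
          open Interpolant I
          case : Dec (Conjugate j) → val 1# j * eval p (ζ̄ ^ toℕ j) ≈ 0#
          case (no ¬conj)    = trans (*-congʳ (val-other 1# j ¬conj)) (zeroˡ _)
          case (yes (σ , e)) = stable (ζ̄-power j >>= λ (i , e′) → return (trans (*-congˡ (trans (eval-congʳ p e′) (trans (interpolates i)
            (val-other 1# i λ (τ , e″) → none (σ ⁻¹ ∙ τ , trans (∙-act (σ ⁻¹) τ ζ)
              (trans (·-cong (σ ⁻¹) (trans e″ (trans (sym e′) (sym (conjugate-inverse j σ e))))) (inverseˡ σ ζ̄))))))) (zeroʳ _)))

      module _ (J : Aut) (Jζ : J · ζ ≈ ζ̄) where

        -- For σ ζ = ζʲ the point ζ̄ʲ is σ (J ζ), where the interpolant has the value σ (J y). The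
        -- terms of Parseval's sum are therefore the conjugates of y · J y.
        trace-form : ∀ y → FixedBy ζ y → ¬ ¬ (Σ (Interpolant y) λ I → Interpolant.total I ≈ tr (y * J · y))
        trace-form y fix = interpolant y fix >>= λ I → return (I , sum-cong-≋ {n} (term I))
          where
          fix-norm : FixedBy ζ (y * J · y)
          fix-norm = IsSubfield.S-* (fixedBy-isSubfield ζ) fix (IsSubfield.S-act (fixedBy-isSubfield ζ) J fix)
          term : (I : Interpolant y) → let open Interpolant I in ∀ j → eval p (ζ ^ toℕ j) * eval p (ζ̄ ^ toℕ j) ≈ val (y * J · y) j
          term I j = trans (*-congʳ (interpolates j)) (case (conjugate? j))
            where
            open Interpolant I
            case : Dec (Conjugate j) → val y j * eval p (ζ̄ ^ toℕ j) ≈ val (y * J · y) j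
            case (no ¬conj)    = trans (*-congʳ (val-other y j ¬conj)) (trans (zeroˡ _) (sym (val-other (y * J · y) j ¬conj)))
            case (yes (σ , e)) = stable (ζ̄-power j >>= λ (i , e′) → return (
              trans (*-cong (val-conjugate fix j σ e) (trans (eval-congʳ p e′) (trans (interpolates i)
                (val-conjugate fix i (σ ∙ J) (trans (∙-act σ J ζ) (trans (·-cong σ Jζ) (trans (conjugate-inverse j σ e) e′)))))))
              (trans (*-congˡ (∙-act σ J y)) (trans (sym (Hom.*-homo (act σ) y (J · y))) (sym (val-conjugate fix-norm j σ e))))))

        pos-trace : ∀ {y} → Pos (FixedBy ζ) J y → ¬ ¬ NonNegative (tr y)
        pos-trace (norm y s e) = trace-form y s >>= λ (I , t) → return (nonNegative-cong (trans t (tr-cong (sym e))) (Interpolant.total≥0 I))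
        pos-trace (add p q e) = pos-trace p >>= λ u → pos-trace q >>= λ v → return (nonNegative-cong (sym (trans (tr-cong e) (tr-+ _ _))) (nonNegative-+ u v))

        -- By Parseval's identity sums of norms have non-negative rational trace. If - 1 were such a
        -- sum, the traces of 1 and - 1 would be non-negative with sum 0, and the trace of 1 would
        -- vanish, contrary to `¬total-1≈0`.
        cyclotomic-proper : ¬ Pos (FixedBy ζ) J (- 1#)
        cyclotomic-proper p = pos-trace p λ u → trace-form 1# 1-fixed λ (I , t) →
          let t′ = trans t (tr-cong (trans (*-identityˡ _) (Hom.1-homo (act J)))) in
          ¬total-1≈0 I (nonNegative-cancel (Interpolant.total≥0 I) u (trans (+-congʳ t′)
            (trans (sym (tr-+ 1# (- 1#))) (trans (tr-cong (-‿inverseʳ 1#)) tr-0))))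
          where
          tr-0 : tr 0# ≈ 0#
          tr-0 = sum-zero {n} (val 0#) λ j → val-0 j
            where
            val-0 : ∀ j → val 0# j ≈ 0#
            val-0 j with conjugate? j
            ... | yes (σ , _) = Hom.0-homo (act σ)
            ... | no _        = refl

-- Positivity in a cubic extension

module CubicExtension {K : CommutativeRing c ℓ} (field′ : IsClassicalField K)
  (stable : ∀ {x y} → ¬ ¬ (CommutativeRing._≈_ K x y) → CommutativeRing._≈_ K x y)
  (G : AbelianAction K ℓᵃ) (ζ ζ̄ : CommutativeRing.Carrier K) where
  open CommutativeRing K hiding (zero)
  open AbelianAction G
  open FromIntegers K using (fromℤ; solve; _:=_; con; _:+_; _:*_; _:-_; :-_)
  open Interpolation field′ stable
  open Positivity field′ stable G
  open PolynomialRing K using (eval; coeff; Poly; _≋_; coeffs; eval-cong)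

  IsRoot : Carrier → Set ℓ
  IsRoot s = s * s * s + s * s + fromℤ (+ 7) * s + (ζ - 1#) ≈ 0#

  -- Common outcome of the two cases of `classify`: S is ℚ(ζ) or ℚ(ζ, s), and s may be a root of the
  -- cubic other than the given one.
  record PositiveInvolution : Set (c ⊔ lsuc (ℓᵃ ⊔ ℓ)) where
    field
      S          : Carrier → Set (ℓᵃ ⊔ ℓ)
      S-sub      : IsSubfield S
      J          : Aut
      Jζ         : J · ζ ≈ ζ̄
      involutive : ∀ {x} → S x → J · (J · x) ≈ x
      proper     : ¬ Pos S J (- 1#)
      s          : Carrier
      s∈S        : S s
      s-root     : IsRoot s

  module _ (ζζ̄ : ζ * ζ̄ ≈ 1#) (conjugation : ∃[ σ ] σ · ζ ≈ ζ̄) (cyclotomic-proper : ∀ J → J · ζ ≈ ζ̄ → ¬ Pos (FixedBy ζ) J (- 1#)) where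

    swaps : ∀ J → J · ζ ≈ ζ̄ → J · ζ̄ ≈ ζ
    swaps J Jζ = begin
      J · ζ̄               ≈⟨ *-identityˡ _ ⟨
      1# * J · ζ̄          ≈⟨ *-congʳ ζζ̄ ⟨
      ζ * ζ̄ * J · ζ̄       ≈⟨ *-assoc _ _ _ ⟩
      ζ * (ζ̄ * J · ζ̄)     ≈⟨ *-congˡ (trans (*-congʳ (sym Jζ)) (trans (sym (Hom.*-homo (act J) ζ ζ̄)) (trans (·-cong J ζζ̄) (Hom.1-homo (act J))))) ⟩
      ζ * 1#              ≈⟨ *-identityʳ ζ ⟩
      ζ                   ∎
      where open import Relation.Binary.Reasoning.Setoid setoid

    J²ζ : ∀ J → J · ζ ≈ ζ̄ → J · (J · ζ) ≈ ζ
    J²ζ J Jζ = trans (·-cong J Jζ) (swaps J Jζ)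

    from-cyclotomic : ∀ s → IsRoot s → FixedBy ζ s → PositiveInvolution
    from-cyclotomic s root fix = record
      { S = FixedBy ζ ; S-sub = fixedBy-isSubfield ζ ; J = J ; Jζ = Jζ
      ; involutive = λ {x} f → trans (sym (∙-act J J x)) (f (J ∙ J) (trans (∙-act J J ζ) (J²ζ J Jζ)))
      ; proper = cyclotomic-proper J Jζ ; s = s ; s∈S = fix ; s-root = root }
      where
      J = proj₁ conjugation
      Jζ = proj₂ conjugation

    root-act : ∀ σ {s} → Fixes σ ζ → IsRoot s → IsRoot (σ · s)
    root-act σ {s} fix root = trans (sym (trans (h.+-homo _ _) (+-cong
        (trans (h.+-homo _ _) (+-cong (trans (h.+-homo _ _) (+-cong (trans (h.*-homo (s * s) s) (*-congʳ (h.*-homo s s))) (h.*-homo s s)))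
          (trans (h.*-homo (fromℤ (+ 7)) s) (*-congʳ (fromℤ-homo {R = K} (act σ) (+ 7))))))
        (trans (h.+-homo ζ (- 1#)) (+-cong fix (trans (h.neg-homo 1#) (-‿cong h.1-homo)))))))
      (trans (·-cong σ root) h.0-homo)
      where module h = Hom (act σ)

    -- the third root, by Vieta
    third : Carrier → Carrier → Carrier
    third s s′ = - 1# - s - s′

    module _ {s s′ : Carrier} (root : IsRoot s) (root′ : IsRoot s′) (s≉s′ : ¬ s ≈ s′) where
      private
        E = s * s + s * s′ + s′ * s′ + s + s′ + fromℤ (+ 7)
        E≈0 : E ≈ 0#
        E≈0 = cancelˡ (trans (solve 3 (λ s t z → (s :- t) :* (s :* s :+ s :* t :+ t :* t :+ s :+ t :+ con (+ 7)) :=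
            (s :* s :* s :+ s :* s :+ con (+ 7) :* s :+ (z :- con (+ 1))) :- (t :* t :* t :+ t :* t :+ con (+ 7) :* t :+ (z :- con (+ 1)))) refl s s′ ζ)
          (trans (+-cong root (-‿cong root′)) (-‿inverseʳ 0#))) (difference≉0 s≉s′)

        factored : ∀ r → (r - s) * ((r - s′) * (r - third s s′)) ≈ r * r * r + r * r + fromℤ (+ 7) * r + (ζ - 1#)
        factored r = trans (solve 4 (λ r s t z → (r :- s) :* ((r :- t) :* (r :- (:- con (+ 1) :- s :- t))) :=
              (r :* r :* r :+ r :* r :+ con (+ 7) :* r :+ (z :- con (+ 1))) :- (s :* s :* s :+ s :* s :+ con (+ 7) :* s :+ (z :- con (+ 1)))
                :- (r :- s) :* (s :* s :+ s :* t :+ t :* t :+ s :+ t :+ con (+ 7))) refl r s s′ ζ)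
          (trans (+-cong (+-congˡ (-‿cong root)) (-‿cong (trans (*-congˡ E≈0) (zeroʳ _))))
            (solve 1 (λ c → c :- con (+ 0) :- con (+ 0) := c) refl _))

      third-root : IsRoot (third s s′)
      third-root = trans (sym (factored (third s s′))) (trans (*-congˡ (trans (*-congˡ (-‿inverseʳ _)) (zeroʳ _))) (zeroʳ _))

      three-roots : ∀ r → IsRoot r → ¬ ¬ (r ≈ s ⊎ r ≈ s′ ⊎ r ≈ third s s′)
      three-roots r rt = em {A = r ≈ s} >>= λ where
          (yes e) → return (inj₁ e)
          (no ¬e) → em {A = r ≈ s′} >>= λ where
            (yes e′) → return (inj₂ (inj₁ e′))
            (no ¬e′) → return (inj₂ (inj₂ (equal (cancelˡ (cancelˡ (trans (factored r) rt) (difference≉0 ¬e)) (difference≉0 ¬e′)))))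
        where
        equal : ∀ {x y} → x - y ≈ 0# → x ≈ y
        equal {x} {y} e = trans (solve 2 (λ x y → x := (x :- y) :+ y) refl x y) (trans (+-congʳ e) (+-identityˡ y))

    record CyclicRoots (s : Carrier) : Set (c ⊔ ℓᵃ ⊔ ℓ) where
      field
        τ    : Aut
        τζ   : Fixes τ ζ
        root : IsRoot s
        s₁≉s : ¬ τ · s ≈ s
        s₂≉s : ¬ τ · (τ · s) ≈ s
        τ³s  : τ · (τ · (τ · s)) ≈ s
        all-roots : ∀ r → IsRoot r → ¬ ¬ (r ≈ s ⊎ r ≈ τ · s ⊎ r ≈ τ · (τ · s))

    -- If two roots are exchanged, the third one is fixed by the whole (abelian) stabiliser of ζ.
    classify : ∀ s → IsRoot s → ¬ ¬ ((∃[ r ] IsRoot r × FixedBy ζ r) ⊎ CyclicRoots s)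
    classify s root = em {A = ∃[ τ ] Fixes τ ζ × ¬ Fixes τ s} >>= λ where
        (no none)         → return (inj₁ (s , root , λ σ f → stable λ ¬fix → none (σ , f , ¬fix)))
        (yes (τ , f , ¬fix)) → orbit τ f ¬fix
      where
      orbit : ∀ τ → Fixes τ ζ → ¬ Fixes τ s → ¬ ¬ ((∃[ r ] IsRoot r × FixedBy ζ r) ⊎ CyclicRoots s)
      orbit τ τζ s₁≉s = em {A = τ · s₁ ≈ s} >>= λ where
          (yes e) → return (inj₁ (s₃ , third-root root root₁ (s₁≉s ∘ sym) , fixed-third e))
          (no ne) → three-roots root root₁ (s₁≉s ∘ sym) (τ · s₁) (root-act τ τζ root₁) >>= λ where
            (inj₁ e) → contradiction e ne
            (inj₂ (inj₁ e)) → contradiction (·-injective τ e) s₁≉s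
            (inj₂ (inj₂ e)) → return (inj₂ record { τ = τ ; τζ = τζ ; root = root ; s₁≉s = s₁≉s ; s₂≉s = ne
              ; τ³s = trans (·-cong τ e) (trans τ-third (trans (+-congˡ (-‿cong e)) (solve 2 (λ s t → :- con (+ 1) :- t :- (:- con (+ 1) :- s :- t) := s) refl s s₁)))
              ; all-roots = λ r rt → three-roots root root₁ (s₁≉s ∘ sym) r rt >>= λ where
                  (inj₁ e′) → return (inj₁ e′)
                  (inj₂ (inj₁ e′)) → return (inj₂ (inj₁ e′))
                  (inj₂ (inj₂ e′)) → return (inj₂ (inj₂ (trans e′ (sym e)))) })
        where
        module τ = Hom (act τ)
        s₁ = τ · s
        root₁ = root-act τ τζ root
        s₃ = third s s₁
        τ-third : τ · s₃ ≈ - 1# - s₁ - τ · s₁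
        τ-third = trans (τ.+-homo _ _) (+-cong (trans (τ.+-homo _ _) (+-cong (trans (τ.neg-homo 1#) (-‿cong τ.1-homo)) (τ.neg-homo s))) (τ.neg-homo s₁))
        fixed-third : τ · s₁ ≈ s → FixedBy ζ s₃
        fixed-third e σ σζ = stable (three-roots root root₁ (s₁≉s ∘ sym) (σ · s₃) (root-act σ σζ (third-root root root₁ (s₁≉s ∘ sym))) >>= λ where
            (inj₁ p) → contradiction (trans (·-cong τ (sym p)) (trans σs₃-fixed p)) s₁≉s
            (inj₂ (inj₁ p)) → contradiction (sym (trans (sym e) (trans (·-cong τ (sym p)) (trans σs₃-fixed p)))) s₁≉s
            (inj₂ (inj₂ p)) → return p)
          where
          τs₃ : τ · s₃ ≈ s₃
          τs₃ = trans τ-third (trans (+-congˡ (-‿cong e)) (solve 2 (λ s t → :- con (+ 1) :- t :- s := :- con (+ 1) :- s :- t) refl s s₁))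
          σs₃-fixed : τ · (σ · s₃) ≈ σ · s₃
          σs₃-fixed = trans (commutes τ σ s₃) (·-cong σ τs₃)

    module Cyclic (s : Carrier) (roots : CyclicRoots s) where
      open CyclicRoots roots
      private
        module τ = Hom (act τ)
        σ₀ = proj₁ conjugation

      rotation : Fin 3 → Aut
      rotation 0F = identity
      rotation 1F = τ
      rotation 2F = τ ∙ τ

      M : Carrier → Set (ℓᵃ ⊔ ℓ)
      M = FixedBy s

      M-sub = fixedBy-isSubfield s
      open IsSubfield M-sub

      -- The cubic equation expresses ζ as a polynomial in s, so the field of s contains the base
      -- field.
      ζ∈M : M ζ
      ζ∈M = S-cong (trans (solve 2 (λ s z → con (+ 1) :- (s :* s :* s :+ s :* s :+ con (+ 7) :* s) :=
            z :- (s :* s :* s :+ s :* s :+ con (+ 7) :* s :+ (z :- con (+ 1)))) refl s ζ)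
          (trans (+-congˡ (-‿cong root)) (solve 1 (λ z → z :- con (+ 0) := z) refl ζ)))
        (S-+ (S-fromℤ (+ 1)) (S-neg (S-+ (S-+ (S-* (S-* s∈M s∈M) s∈M) (S-* s∈M s∈M)) (S-* (S-fromℤ (+ 7)) s∈M))))
        where s∈M = fixedBy-refl s

      base⊆M : ∀ {y} → FixedBy ζ y → M y
      base⊆M f σ σs = f σ (ζ∈M σ σs)

      τ³ : ∀ {y} → M y → τ · (τ · (τ · y)) ≈ y
      τ³ {y} f = trans (sym (triple y)) (trans (agree f (τ ∙ (τ ∙ τ)) identity (trans (triple s) (trans τ³s (sym (id-act s))))) (id-act y))
        where
        triple : ∀ y → (τ ∙ (τ ∙ τ)) · y ≈ τ · (τ · (τ · y))
        triple y = trans (∙-act τ (τ ∙ τ) y) (·-cong τ (∙-act τ τ y))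

      RotatesBy : Aut → Fin 3 → Set (c ⊔ ℓᵃ ⊔ ℓ)
      RotatesBy σ i = ∀ {y} → M y → σ · y ≈ rotation i · y

      -- σ s is one of the three roots, which are the rotations of s, and the action on s determines
      -- the action on all of M.
      stabiliser : ∀ σ → Fixes σ ζ → ¬ ¬ (∃[ i ] RotatesBy σ i)
      stabiliser σ σζ = all-roots (σ · s) (root-act σ σζ root) >>= λ e → return (rotates e)
        where
        rotates : (σ · s ≈ s ⊎ σ · s ≈ τ · s ⊎ σ · s ≈ τ · (τ · s)) → Σ (Fin 3) (RotatesBy σ)
        rotates (inj₁ e)        = 0F , λ f → agree f σ identity (trans e (sym (id-act s)))
        rotates (inj₂ (inj₁ e)) = 1F , λ f → agree f σ τ e
        rotates (inj₂ (inj₂ e)) = 2F , λ f → agree f σ (τ ∙ τ) (trans e (sym (∙-act τ τ s)))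

      base-from-τ : ∀ {y} → M y → τ · y ≈ y → FixedBy ζ y
      base-from-τ {y} f τy σ σζ = stable (stabiliser σ σζ >>= λ (i , e) → return (trans (e f) (rotate i)))
        where
        rotate : ∀ i → rotation i · y ≈ y
        rotate 0F = id-act y
        rotate 1F = τy
        rotate 2F = trans (∙-act τ τ y) (trans (·-cong τ τy) τy)

      -- σ₀² ∈ ⟨τ⟩ has order dividing 3 on M, so σ₀³ is an involution.
      J : Aut
      J = σ₀ ∙ (σ₀ ∙ σ₀)

      J-act : ∀ y → J · y ≈ σ₀ · (σ₀ · (σ₀ · y))
      J-act y = trans (∙-act σ₀ (σ₀ ∙ σ₀) y) (·-cong σ₀ (∙-act σ₀ σ₀ y))

      Jζ : J · ζ ≈ ζ̄
      Jζ = trans (J-act ζ) (trans (·-cong σ₀ (J²ζ σ₀ (proj₂ conjugation))) (proj₂ conjugation))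

      involutive : ∀ {y} → M y → J · (J · y) ≈ y
      involutive {y} f = trans (J-act (J · y)) (trans (·-cong σ₀ (·-cong σ₀ (·-cong σ₀ (J-act y)))) (stable
        (stabiliser (σ₀ ∙ σ₀) (trans (∙-act σ₀ σ₀ ζ) (J²ζ σ₀ (proj₂ conjugation))) >>= λ (i , e) →
          let ρ : ∀ {z} → M z → σ₀ · (σ₀ · z) ≈ rotation i · z
              ρ m = trans (sym (∙-act σ₀ σ₀ _)) (e m)
          in return (trans (·-cong σ₀ (·-cong σ₀ (trans (·-cong σ₀ (·-cong σ₀ (ρ f))) (ρ (S-act (rotation i) f)))))
               (trans (ρ (S-act (rotation i) (S-act (rotation i) f))) (cube i))))))
        where
        cube : ∀ i → rotation i · (rotation i · (rotation i · y)) ≈ y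
        cube 0F = trans (id-act _) (trans (id-act _) (id-act y))
        cube 1F = τ³ f
        cube 2F = trans (∙-act τ τ _) (trans (·-cong τ (·-cong τ (∙-act τ τ _))) (trans (·-cong τ (·-cong τ (·-cong τ (·-cong τ (∙-act τ τ y))))) (trans
          (·-cong τ (τ³ (S-act τ (S-act τ f)))) (τ³ f))))

      base-involutive : ∀ {y} → FixedBy ζ y → J · (J · y) ≈ y
      base-involutive f = involutive (base⊆M f)

      module J = Hom (act J)

      -- For a generator θ of M fixed by J, conjugating a polynomial in θ amounts to conjugating its
      -- coefficients. Springer's argument needs such a θ.
      record RealGenerator : Set (c ⊔ ℓᵃ ⊔ ℓ) where
        field
          θ    : Carrier
          θ∈M  : M θ
          Jθ   : J · θ ≈ θ
          τθ≉θ : ¬ τ · θ ≈ θ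

      -- The trace T or the norm N of s will do. If τ fixed both, τ s would be a root of (X - s)(X -
      -- J s) other than s, hence J s. Then τ (τ s) = J (J s) = s, which `s₂≉s` excludes.
      realGenerator : ¬ ¬ RealGenerator
      realGenerator = em {A = τ · T ≈ T} >>= λ where
          (no ne) → return record { θ = T ; θ∈M = T∈M ; Jθ = JT ; τθ≉θ = ne }
          (yes τT) → em {A = τ · N ≈ N} >>= λ where
            (no ne) → return record { θ = N ; θ∈M = N∈M ; Jθ = JN ; τθ≉θ = ne }
            (yes τN) → contradiction τN (impossible τT)
        where
        s∈M = fixedBy-refl s
        T = s + J · s
        N = s * J · s
        T∈M = S-+ s∈M (S-act J s∈M)
        N∈M = S-* s∈M (S-act J s∈M)
        JT : J · T ≈ T
        JT = trans (J.+-homo s (J · s)) (trans (+-congˡ (involutive s∈M)) (+-comm _ _))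
        JN : J · N ≈ N
        JN = trans (J.*-homo s (J · s)) (trans (*-congˡ (involutive s∈M)) (*-comm _ _))
        impossible : τ · T ≈ T → ¬ τ · N ≈ N
        impossible τT τN = s₂≉s (trans (·-cong τ s₁≈Js) (trans (commutes τ J s) (trans (·-cong J s₁≈Js) (involutive s∈M))))
          where
          s₁ = τ · s
          sum : s₁ + τ · (J · s) ≈ T
          sum = trans (sym (τ.+-homo s (J · s))) τT
          product : s₁ * τ · (J · s) ≈ N
          product = trans (sym (τ.*-homo s (J · s))) τN
          s₁≈Js : s₁ ≈ J · s
          s₁≈Js = trans (solve 2 (λ x y → x := (x :- y) :+ y) refl s₁ (J · s)) (trans (+-congʳ (cancelˡ (trans
            (solve 4 (λ u v s t → (u :- s) :* (u :- t) := u :* ((u :+ v) :- (s :+ t)) :- (u :* v :- s :* t)) refl s₁ (τ · (J · s)) s (J · s))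
            (trans (+-cong (trans (*-congˡ (trans (+-congʳ sum) (-‿inverseʳ T))) (zeroʳ _)) (-‿cong (trans (+-congʳ product) (-‿inverseʳ N))))
              (-‿inverseʳ 0#))) (difference≉0 s₁≉s))) (+-identityˡ _))

      module Springer (generator : RealGenerator) where
        open RealGenerator generator

        x : Fin 3 → Carrier
        x i = rotation i · θ

        distinct : Distinct x
        distinct 0F 0F i≢j = contradiction ≡.refl i≢j
        distinct 0F 1F _ e = τθ≉θ (trans (sym e) (id-act θ))
        distinct 0F 2F _ e = τθ≉θ (trans (·-cong τ (trans (sym (id-act θ)) (trans e (∙-act τ τ θ)))) (τ³ θ∈M))
        distinct 1F 0F _ e = τθ≉θ (trans e (id-act θ))
        distinct 1F 1F i≢j = contradiction ≡.refl i≢j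
        distinct 1F 2F _ e = τθ≉θ (sym (·-injective τ (trans e (∙-act τ τ θ))))
        distinct 2F 0F _ e = τθ≉θ (trans (·-cong τ (trans (sym (id-act θ)) (trans (sym e) (∙-act τ τ θ)))) (τ³ θ∈M))
        distinct 2F 1F _ e = τθ≉θ (sym (·-injective τ (trans (sym e) (∙-act τ τ θ))))
        distinct 2F 2F i≢j = contradiction ≡.refl i≢j

        -- The rotations of y are interpolated at those of θ. The stabiliser of s fixes all nodes
        -- and values, and τ permutes them cyclically, so the coefficients lie in the base field.
        coordinates : ∀ {y} → M y → ¬ ¬ (∃[ b₀ ] ∃[ b₁ ] ∃[ b₂ ] FixedBy ζ b₀ × FixedBy ζ b₁ × FixedBy ζ b₂ × y ≈ b₀ + θ * (b₁ + θ * b₂))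
        coordinates {y} y∈M = interpolate x distinct (λ i → rotation i · y) >>= λ (p , short , ev) →
            return (coeff p 0 , coeff p 1 , coeff p 2 , base p short ev 0 , base p short ev 1 , base p short ev 2 ,
              trans (sym (id-act y)) (trans (sym (ev 0F)) (trans (PolynomialRing.eval-congʳ K p (id-act θ)) (expand p short))))
          where
          expand : ∀ p → length p ≤ 3 → eval p θ ≈ coeff p 0 + θ * (coeff p 1 + θ * coeff p 2)
          expand [] _ = solve 1 (λ t → con (+ 0) := con (+ 0) :+ t :* (con (+ 0) :+ t :* con (+ 0))) refl θ
          expand (a ∷ []) _ = solve 2 (λ a t → a :+ t :* con (+ 0) := a :+ t :* (con (+ 0) :+ t :* con (+ 0))) refl a θ
          expand (a ∷ b ∷ []) _ = refl
          expand (a ∷ b ∷ d ∷ []) _ = solve 4 (λ a b d t → a :+ t :* (b :+ t :* (d :+ t :* con (+ 0))) := a :+ t :* (b :+ t :* d)) refl a b d θ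
          expand (a ∷ b ∷ d ∷ e ∷ p) (s≤s (s≤s (s≤s ())))
          module _ (p : Poly) (short : length p ≤ 3) (ev : ∀ i → eval p (x i) ≈ rotation i · y) where
            coefficient∈M : ∀ k → M (coeff p k)
            coefficient∈M k σ σs = interpolant-invariant x distinct p short (act σ)
              (λ j → return (j , S-act (rotation j) θ∈M σ σs , trans (·-cong σ (ev j)) (trans (S-act (rotation j) y∈M σ σs) (sym (ev j))))) k
            previous : Fin 3 → Fin 3
            previous 0F = 2F
            previous 1F = 0F
            previous 2F = 1F
            turn : ∀ {z} → M z → ∀ j → τ · (rotation (previous j) · z) ≈ rotation j · z
            turn {z} m 0F = trans (·-cong τ (∙-act τ τ z)) (trans (τ³ m) (sym (id-act z)))
            turn {z} m 1F = ·-cong τ (id-act z)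
            turn {z} m 2F = sym (∙-act τ τ z)
            base : ∀ k → FixedBy ζ (coeff p k)
            base k = base-from-τ (coefficient∈M k) (interpolant-invariant x distinct p short (act τ)
              (λ j → return (previous j , turn θ∈M j , trans (·-cong τ (ev (previous j))) (trans (turn y∈M j) (sym (ev j))))) k)

        base-proper = cyclotomic-proper J Jζ
        private
          module B = IsSubfield (fixedBy-isSubfield ζ)
          B-sub = fixedBy-isSubfield ζ

        quartic : (c₀ c₁ c₂ c₃ c₄ : Carrier) → Carrier → Carrier
        quartic c₀ c₁ c₂ c₃ c₄ r = c₀ + r * (c₁ + r * (c₂ + r * (c₃ + r * c₄)))

        -- A sum of norms y · J y, as a polynomial of degree ≤ 4 in θ, is a sum of norms at every real r in
        -- the base field, and its degree is even.
        record Quartic (x : Carrier) : Set (c ⊔ ℓᵃ ⊔ ℓ) where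
          field
            c₀ c₁ c₂ c₃ c₄ : Carrier
            c₀∈ : FixedBy ζ c₀
            c₁∈ : FixedBy ζ c₁
            c₂∈ : FixedBy ζ c₂
            c₃∈ : FixedBy ζ c₃
            Jc₃ : J · c₃ ≈ c₃
            x≈ : x ≈ quartic c₀ c₁ c₂ c₃ c₄ θ
            leading : Pos (FixedBy ζ) J c₄
            even    : c₄ ≈ 0# → c₃ ≈ 0#
            values  : ∀ r → FixedBy ζ r → J · r ≈ r → Pos (FixedBy ζ) J (quartic c₀ c₁ c₂ c₃ c₄ r)

        norm-zero : ∀ {b} → b * J · b ≈ 0# → b ≈ 0#
        norm-zero {b} e = stable λ b≉0 → b≉0 (·-injective J (trans (cancelˡ e b≉0) (sym J.0-homo)))

        pos⇒quartic : ∀ {y} → Pos M J y → ¬ ¬ Quartic y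
        pos⇒quartic (norm {y} z z∈M e) = coordinates z∈M >>= λ (b₀ , b₁ , b₂ , f₀ , f₁ , f₂ , z≈) →
          let J′ = λ b → J · b
              conj-at : ∀ r → J · r ≈ r → J · (b₀ + r * (b₁ + r * b₂)) ≈ J · b₀ + r * (J · b₁ + r * J · b₂)
              conj-at r Jr = trans (J.+-homo _ _) (+-congˡ (trans (J.*-homo _ _) (*-cong Jr (trans (J.+-homo _ _) (+-congˡ (trans (J.*-homo _ _) (*-congʳ Jr)))))))
              multiply : ∀ r → J · r ≈ r → (b₀ + r * (b₁ + r * b₂)) * J · (b₀ + r * (b₁ + r * b₂)) ≈
                quartic (b₀ * J · b₀) (b₀ * J · b₁ + b₁ * J · b₀) (b₀ * J · b₂ + b₁ * J · b₁ + b₂ * J · b₀) (b₁ * J · b₂ + b₂ * J · b₁) (b₂ * J · b₂) r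
              multiply r Jr = trans (*-congˡ (conj-at r Jr)) (solve 7 (λ r a b d a′ b′ d′ →
                (a :+ r :* (b :+ r :* d)) :* (a′ :+ r :* (b′ :+ r :* d′)) :=
                a :* a′ :+ r :* ((a :* b′ :+ b :* a′) :+ r :* ((a :* d′ :+ b :* b′ :+ d :* a′) :+ r :* ((b :* d′ :+ d :* b′) :+ r :* (d :* d′))))) refl
                r b₀ b₁ b₂ (J · b₀) (J · b₁) (J · b₂))
          in return record
            { c₀ = b₀ * J · b₀ ; c₁ = b₀ * J · b₁ + b₁ * J · b₀ ; c₂ = b₀ * J · b₂ + b₁ * J · b₁ + b₂ * J · b₀
            ; c₃ = b₁ * J · b₂ + b₂ * J · b₁ ; c₄ = b₂ * J · b₂
            ; c₀∈ = B.S-* f₀ (B.S-act J f₀) ; c₁∈ = B.S-+ (B.S-* f₀ (B.S-act J f₁)) (B.S-* f₁ (B.S-act J f₀))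
            ; c₂∈ = B.S-+ (B.S-+ (B.S-* f₀ (B.S-act J f₂)) (B.S-* f₁ (B.S-act J f₁))) (B.S-* f₂ (B.S-act J f₀))
            ; c₃∈ = B.S-+ (B.S-* f₁ (B.S-act J f₂)) (B.S-* f₂ (B.S-act J f₁))
            ; Jc₃ = trans (J.+-homo _ _) (trans (+-cong (trans (J.*-homo _ _) (trans (*-congˡ (base-involutive f₂)) (*-comm _ _)))
                (trans (J.*-homo _ _) (trans (*-congˡ (base-involutive f₁)) (*-comm _ _)))) (+-comm _ _))
            ; x≈ = trans e (trans (*-cong z≈ (·-cong J z≈)) (multiply θ Jθ))
            ; leading = norm b₂ f₂ refl
            ; even = λ c₄≈0 → let b₂≈0 = norm-zero c₄≈0 in trans (+-cong (trans (*-congˡ (trans (·-cong J b₂≈0) J.0-homo)) (zeroʳ _)) (trans (*-congʳ b₂≈0) (zeroˡ _))) (+-identityʳ 0#)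
            ; values = λ r f Jr → norm (b₀ + r * (b₁ + r * b₂)) (B.S-+ f₀ (B.S-* f (B.S-+ f₁ (B.S-* f f₂)))) (sym (multiply r Jr)) }
        pos⇒quartic (add p q e) = pos⇒quartic p >>= λ P → pos⇒quartic q >>= λ Q →
          let module P = Quartic P
              module Q = Quartic Q
              sum : ∀ r → quartic (P.c₀ + Q.c₀) (P.c₁ + Q.c₁) (P.c₂ + Q.c₂) (P.c₃ + Q.c₃) (P.c₄ + Q.c₄) r ≈
                quartic P.c₀ P.c₁ P.c₂ P.c₃ P.c₄ r + quartic Q.c₀ Q.c₁ Q.c₂ Q.c₃ Q.c₄ r
              sum r = solve 11 (λ r a b d e f a′ b′ d′ e′ f′ →
                (a :+ a′) :+ r :* ((b :+ b′) :+ r :* ((d :+ d′) :+ r :* ((e :+ e′) :+ r :* (f :+ f′)))) :=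
                (a :+ r :* (b :+ r :* (d :+ r :* (e :+ r :* f)))) :+ (a′ :+ r :* (b′ :+ r :* (d′ :+ r :* (e′ :+ r :* f′))))) refl
                r P.c₀ P.c₁ P.c₂ P.c₃ P.c₄ Q.c₀ Q.c₁ Q.c₂ Q.c₃ Q.c₄
          in return record
            { c₀ = P.c₀ + Q.c₀ ; c₁ = P.c₁ + Q.c₁ ; c₂ = P.c₂ + Q.c₂ ; c₃ = P.c₃ + Q.c₃ ; c₄ = P.c₄ + Q.c₄
            ; c₀∈ = B.S-+ P.c₀∈ Q.c₀∈ ; c₁∈ = B.S-+ P.c₁∈ Q.c₁∈ ; c₂∈ = B.S-+ P.c₂∈ Q.c₂∈ ; c₃∈ = B.S-+ P.c₃∈ Q.c₃∈
            ; Jc₃ = trans (J.+-homo _ _) (+-cong P.Jc₃ Q.Jc₃)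
            ; x≈ = trans e (trans (+-cong P.x≈ Q.x≈) (sym (sum θ)))
            ; leading = pos-+ B-sub base-involutive P.leading Q.leading
            -- Leading coefficients cannot cancel: both are sums of norms in the base field, so each
            -- vanishes if their sum does.
            ; even = λ z → trans (+-cong (P.even (pos-cancel B-sub base-involutive base-proper P.leading Q.leading z))
                (Q.even (pos-cancel B-sub base-involutive base-proper Q.leading P.leading (trans (+-comm _ _) z)))) (+-identityʳ 0#)
            ; values = λ r f Jr → add (P.values r f Jr) (Q.values r f Jr) (sum r) }

        trace-θ : Carrier
        trace-θ = x 0F + x 1F + x 2F

        trace∈base : FixedBy ζ trace-θ
        trace∈base = base-from-τ (S-+ (S-+ (S-act (rotation 0F) θ∈M) (S-act (rotation 1F) θ∈M)) (S-act (rotation 2F) θ∈M))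
          (trans (τ.+-homo _ _) (trans (+-cong (trans (τ.+-homo _ _) (+-cong (·-cong τ (id-act θ)) (sym (∙-act τ τ θ)))) (trans (·-cong τ (∙-act τ τ θ)) (trans (τ³ θ∈M) (sym (id-act θ)))))
            (solve 3 (λ a b d → a :+ b :+ d := d :+ a :+ b) refl (x 1F) (x 2F) (x 0F))))

        J-trace : J · trace-θ ≈ trace-θ
        J-trace = trans (J.+-homo _ _) (+-cong (trans (J.+-homo _ _) (+-cong (J-x 0F) (J-x 1F))) (J-x 2F))
          where
          J-x : ∀ i → J · x i ≈ x i
          J-x i = trans (commutes J (rotation i) θ) (·-cong (rotation i) Jθ)

        -- Springer's theorem for the cubic extension of the base field by θ.
        cubic-proper : ¬ Pos M J (- 1#)
        cubic-proper p = pos⇒quartic p contradict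
          where
          contradict : ¬ Quartic (- 1#)
          contradict Q = em {A = c₄ ≈ 0#} λ where
              (yes c₄≈0) → degenerate c₄≈0
              (no c₄≉0)  → IsClassicalField.invertible field′ c₄ c₄≉0 λ (z , e) → nondegenerate z e
            where
            open Quartic Q
            -- If the quartic takes the value - 1 at θ, then D vanishes at the three conjugates of
            -- θ. The aim is a zero of D in the real base field, where the quartic would express - 1
            -- as a sum of norms.
            D : Carrier → Carrier
            D r = quartic (c₀ + 1#) c₁ c₂ c₃ c₄ r
            D≈ : ∀ r → D r ≈ quartic c₀ c₁ c₂ c₃ c₄ r + 1#
            D≈ r = solve 3 (λ a o t → (a :+ o) :+ t := (a :+ t) :+ o) refl c₀ 1# (r * (c₁ + r * (c₂ + r * (c₃ + r * c₄))))
            D-θ : D θ ≈ 0#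
            D-θ = trans (D≈ θ) (trans (+-congʳ (sym x≈)) (-‿inverseˡ 1#))
            not-minus-one : ∀ r → FixedBy ζ r → J · r ≈ r → ¬ D r ≈ 0#
            not-minus-one r f Jr e = base-proper (pos-cong B-sub base-involutive
              (trans (solve 2 (λ q o → q := (q :+ o) :- o) refl _ 1#) (trans (+-congʳ (trans (sym (D≈ r)) e)) (+-identityˡ _))) (values r f Jr))
            rotate-D : ∀ i → D (x i) ≈ 0#
            rotate-D i = trans (sym image) (trans (·-cong ρ D-θ) (Hom.0-homo (act ρ)))
              where
              ρ = rotation i
              module ρ = Hom (act ρ)
              ρζ : ∀ i → rotation i · ζ ≈ ζ
              ρζ 0F = id-act ζ
              ρζ 1F = τζ
              ρζ 2F = trans (∙-act τ τ ζ) (trans (·-cong τ τζ) τζ)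
              horner : ∀ {b y y′} → FixedBy ζ b → ρ · y ≈ y′ → ρ · (b + θ * y) ≈ b + x i * y′
              horner f e = trans (ρ.+-homo _ _) (+-cong (f ρ (ρζ i)) (trans (ρ.*-homo _ _) (*-congˡ e)))
              image : ρ · D θ ≈ D (x i)
              image = horner (B.S-+ c₀∈ (B.S-fromℤ (+ 1))) (horner c₁∈ (horner c₂∈ (horner c₃∈ (pos-S B-sub base-involutive leading ρ (ρζ i)))))
            zero-polynomial : ∀ d₀ d₁ d₂ → (∀ i → d₀ + x i * (d₁ + x i * (d₂ + x i * 0#)) ≈ 0#) → (d₀ ∷ d₁ ∷ d₂ ∷ []) ≋ []
            zero-polynomial d₀ d₁ d₂ z = roots-unique 3 x distinct (d₀ ∷ d₁ ∷ d₂ ∷ []) ℕₚ.≤-refl z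
            -- Then c₃ = 0 too, and D has degree at most 2 with three roots. It is the zero
            -- polynomial, and 0 serves as the zero in the base field.
            degenerate : c₄ ≈ 0# → ⊥
            degenerate c₄≈0 = not-minus-one 0# (B.S-fromℤ (+ 0)) J.0-homo (trans (+-congˡ (zeroˡ _)) (trans (+-identityʳ _) (coeffs vanish 0)))
              where
              vanish : (c₀ + 1# ∷ c₁ ∷ c₂ ∷ []) ≋ []
              vanish = zero-polynomial (c₀ + 1#) c₁ c₂ λ i → trans
                (+-congˡ (*-congˡ (+-congˡ (*-congˡ (+-congˡ (*-congˡ (sym (trans (+-cong (even c₄≈0) (trans (*-congˡ c₄≈0) (zeroʳ _))) (+-identityʳ 0#)))))))))
                (rotate-D i)
            nondegenerate : ∀ z → c₄ * z ≈ 1# → ⊥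
            nondegenerate z e = not-minus-one r r∈base Jr (trans (split r) (trans (+-cong
                (trans (*-congˡ (trans (*-congˡ (trans (*-congˡ (trans (*-congˡ (-‿inverseʳ r)) (zeroʳ _))) (zeroʳ _))) (zeroʳ _))) (zeroʳ c₄))
                (eval-cong r lower-zero)) (+-identityʳ 0#)))
              where
              t₀ = x 0F
              t₁ = x 1F
              t₂ = x 2F
              -- The four roots of D add up to - c₃/c₄, so this is the one that is left besides the
              -- conjugates of θ. It is real and lies in the base field because both terms do.
              r = - (c₃ * z) - trace-θ
              z∈base : FixedBy ζ z
              z∈base = B.S-inverse e (pos-S B-sub base-involutive leading)
              r∈base : FixedBy ζ r
              r∈base = B.S-+ (B.S-neg (B.S-* c₃∈ z∈base)) (B.S-neg trace∈base)
              Jz : J · z ≈ z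
              Jz = trans (sym (*-identityˡ _)) (trans (*-congʳ (trans (sym e) (*-comm c₄ z))) (trans (*-assoc z c₄ _)
                (trans (*-congˡ (trans (*-congʳ (sym (pos-fixed B-sub base-involutive leading))) (trans (sym (J.*-homo c₄ z)) (trans (·-cong J e) J.1-homo)))) (*-identityʳ z))))
              Jr : J · r ≈ r
              Jr = trans (J.+-homo _ _) (+-cong (trans (J.neg-homo _) (-‿cong (trans (J.*-homo c₃ z) (*-cong Jc₃ Jz)))) (trans (J.neg-homo _) (-‿cong J-trace)))
              e₁ e₂ e₃ : Carrier
              e₁ = t₀ + t₁ + t₂
              e₂ = t₀ * t₁ + t₀ * t₂ + t₁ * t₂
              e₃ = t₀ * t₁ * t₂
              -- Coefficients of the remainder D - c₄ (y - t₀)(y - t₁)(y - t₂)(y - r). The choice of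
              -- r removes its cubic term, and the three roots t₀, t₁, t₂ make it zero.
              d₀ = c₀ + 1# - c₄ * (e₃ * r)
              d₁ = c₁ + c₄ * (e₃ + e₂ * r)
              d₂ = c₂ - c₄ * (e₂ + e₁ * r)
              c₃≈ : c₃ ≈ - (c₄ * (e₁ + r))
              c₃≈ = trans (sym (*-identityʳ c₃)) (trans (*-congˡ (sym e)) (solve 4 (λ c z d e → c :* (d :* z) := :- (d :* (e :+ (:- (c :* z) :- e)))) refl c₃ z c₄ trace-θ))
              split : ∀ y → D y ≈ c₄ * ((y - t₀) * ((y - t₁) * ((y - t₂) * (y - r)))) + (d₀ + y * (d₁ + y * (d₂ + y * 0#)))
              split y = trans (+-congˡ (*-congˡ (+-congˡ (*-congˡ (+-congˡ (*-congˡ (+-congʳ c₃≈)))))))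
                (solve 9 (λ y r t u v a b d f → let e₁ = t :+ u :+ v ; e₂ = t :* u :+ t :* v :+ u :* v ; e₃ = t :* u :* v in
                  a :+ y :* (b :+ y :* (d :+ y :* (:- (f :* (e₁ :+ r)) :+ y :* f))) :=
                  f :* ((y :- t) :* ((y :- u) :* ((y :- v) :* (y :- r)))) :+
                    ((a :- f :* (e₃ :* r)) :+ y :* ((b :+ f :* (e₃ :+ e₂ :* r)) :+ y :* ((d :- f :* (e₂ :+ e₁ :* r)) :+ y :* con (+ 0))))) refl
                  y r t₀ t₁ t₂ (c₀ + 1#) c₁ c₂ c₄)
              product-zero : ∀ i → (x i - t₀) * ((x i - t₁) * ((x i - t₂) * (x i - r))) ≈ 0#
              product-zero 0F = trans (*-congʳ (-‿inverseʳ t₀)) (zeroˡ _)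
              product-zero 1F = trans (*-congˡ (trans (*-congʳ (-‿inverseʳ t₁)) (zeroˡ _))) (zeroʳ _)
              product-zero 2F = trans (*-congˡ (trans (*-congˡ (trans (*-congʳ (-‿inverseʳ t₂)) (zeroˡ _))) (zeroʳ _))) (zeroʳ _)
              lower-zero : (d₀ ∷ d₁ ∷ d₂ ∷ []) ≋ []
              lower-zero = zero-polynomial d₀ d₁ d₂ λ i → trans (sym (+-identityˡ _)) (trans (+-congʳ (sym (trans (*-congˡ (product-zero i)) (zeroʳ c₄))))
                (trans (sym (split (x i))) (rotate-D i)))

      from-cyclic : ¬ ¬ PositiveInvolution
      from-cyclic = realGenerator >>= λ g → return record
        { S = M ; S-sub = M-sub ; J = J ; Jζ = Jζ ; involutive = involutive ; proper = Springer.cubic-proper g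
        ; s = s ; s∈S = fixedBy-refl s ; s-root = root }

    positiveInvolution : ∀ s → IsRoot s → ¬ ¬ PositiveInvolution
    positiveInvolution s root = classify s root >>= λ where
      (inj₁ (r , root′ , fix)) → return (from-cyclotomic r root′ fix)
      (inj₂ cyclic)            → Cyclic.from-cyclic s cyclic

-- The sum-of-squares certificate for the upper bound

module Certificate {c ℓ} (R : CommutativeRing c ℓ) where
  open CommutativeRing R
  open FromIntegers R

  combination : List ℤ → List Carrier → Carrier
  combination []       _        = 0#
  combination (_ ∷ _)  []       = 0#
  combination (k ∷ ks) (x ∷ xs) = fromℤ k * x + combination ks xs

  weightedSquares : List (ℕ × List ℤ) → List Carrier → Carrier
  weightedSquares []               xs = 0#
  weightedSquares ((w , ks) ∷ rest) xs = fromℤ (+ w) * (combination ks xs * combination ks xs) + weightedSquares rest xs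

  -- T is twice the real part of s, and V = (s - t)(t - s) is four times the square of its imaginary
  -- part. Polynomials symmetric in s and t are polynomials in T and V up to denominators, and V
  -- itself is a norm. Hence the shape: squares plus V times squares.
  evenMonomials oddMonomials : Carrier → Carrier → List Carrier
  evenMonomials T V = 1# ∷ T ∷ T * T ∷ V ∷ T * T * T ∷ T * V ∷ []
  oddMonomials  T V = 1# ∷ T ∷ T * T ∷ V ∷ []

  -- Each entry is a weight and the coefficients of a linear form in the monomials. The rows are
  -- triangular, as in an LDLᵀ factorisation of a positive definite Gram matrix. Denominators have
  -- been cleared, which accounts for the large factors in `certificate`.
  evenSquares oddSquares : List (ℕ × List ℤ)
  evenSquares =
    (1816174313149147176960 , + 150 ∷ -[1+ 303 ] ∷ -[1+ 43 ] ∷ -[1+ 11 ] ∷ + 8 ∷ + 5 ∷ []) ∷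
    (189500658717565440 , + 0 ∷ + 9584 ∷ -[1+ 7375 ] ∷ -[1+ 647 ] ∷ -[1+ 567 ] ∷ -[1+ 1254 ] ∷ []) ∷
    (61668010972495872 , + 0 ∷ + 0 ∷ + 14750 ∷ -[1+ 2049 ] ∷ + 429 ∷ -[1+ 1039 ] ∷ []) ∷
    (34473793494105 , + 0 ∷ + 0 ∷ + 0 ∷ + 139520 ∷ + 33024 ∷ + 116385 ∷ []) ∷
    (2116864335978 , + 0 ∷ + 0 ∷ + 0 ∷ + 0 ∷ + 147584 ∷ + 34535 ∷ []) ∷
    (1067178654513198100125 , + 0 ∷ + 0 ∷ + 0 ∷ + 0 ∷ + 0 ∷ + 1 ∷ []) ∷ []
  oddSquares =
    (900880115649378560000 , + 504 ∷ + 33 ∷ + 3 ∷ -[1+ 16 ] ∷ []) ∷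
    (13342418774428000 , + 0 ∷ + 25320 ∷ + 1752 ∷ + 929 ∷ []) ∷
    (839453111973000 , + 0 ∷ + 0 ∷ + 12016 ∷ -[1+ 762 ] ∷ []) ∷
    (68035529456347719000 , + 0 ∷ + 0 ∷ + 0 ∷ + 1 ∷ []) ∷ []

  private
    -- Copies on solver expressions, whose evaluation unfolds to the right-hand side of
    -- `certificate`.
    combination′ : ∀ {n} → List ℤ → List (Polynomial n) → Polynomial n
    combination′ []       _        = con (+ 0)
    combination′ (_ ∷ _)  []       = con (+ 0)
    combination′ (k ∷ ks) (x ∷ xs) = con k :* x :+ combination′ ks xs

    weightedSquares′ : ∀ {n} → List (ℕ × List ℤ) → List (Polynomial n) → Polynomial n
    weightedSquares′ []               xs = con (+ 0)
    weightedSquares′ ((w , ks) ∷ rest) xs = con (+ w) :* (combination′ ks xs :* combination′ ks xs) :+ weightedSquares′ rest xs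

  module _ (s t : Carrier) where
    private
      T V X Y : Carrier
      T = s + t
      V = (s - t) * (t - s)
      X = 1# - fromℤ (+ 7) * s - s * s - s * s * s
      Y = 1# - fromℤ (+ 7) * t - t * t - t * t * t

    -- 15/16 - (T² + T) + (2/5)(|X|² - 1) is a sum of squares of real polynomials in s and its conjugate t.
    certificate : fromℤ (+ 2724261469723720765440000) * (fromℤ (+ 15) - fromℤ (+ 16) * (T * T + T)) +
      fromℤ (+ 17435273406231812898816000) * (X * Y - 1#) ≈
      weightedSquares evenSquares (evenMonomials T V) + V * weightedSquares oddSquares (oddMonomials T V)
    certificate = solve 2 (λ s t →
      let T = s :+ t
          V = (s :- t) :* (t :- s)
          X = con (+ 1) :- con (+ 7) :* s :- s :* s :- s :* s :* s
          Y = con (+ 1) :- con (+ 7) :* t :- t :* t :- t :* t :* t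
      in con (+ 2724261469723720765440000) :* (con (+ 15) :- con (+ 16) :* (T :* T :+ T)) :+
           con (+ 17435273406231812898816000) :* (X :* Y :- con (+ 1)) :=
         weightedSquares′ evenSquares (con (+ 1) ∷ T ∷ T :* T ∷ V ∷ T :* T :* T ∷ T :* V ∷ []) :+
           V :* weightedSquares′ oddSquares (con (+ 1) ∷ T ∷ T :* T ∷ V ∷ [])) refl s t

-- Integers of absolute value < 1

private
  module ℚI = FromIntegers ℚₚ.+-*-commutativeRing

fromℤ-ℚ : ∀ i → ℚI.fromℤ i ≡ i ℚ./ 1
fromℤ-ℚ (+ n)      = fromℕ n
  where
  step : ∀ n → (+ suc n) ℚ./ 1 ℚ.+ 1ℚ ≡ (+ suc (suc n)) ℚ./ 1
  step n = ℚₚ.toℚᵘ-injective (ℚᵘₚ.≃-trans (ℚₚ.toℚᵘ-homo-+ ((+ suc n) ℚ./ 1) 1ℚ)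
    (ℚᵘₚ.≃-trans (ℚᵘₚ.+-congˡ (ℚ.toℚᵘ 1ℚ) (ℚₚ.toℚᵘ-fromℚᵘ (mkℚᵘ (+ suc n) 0)))
      (ℚᵘₚ.≃-trans (*≡* (≡.cong (λ i → i ℤ.* + 1) (add (+ suc n)))) (ℚᵘₚ.≃-sym (ℚₚ.toℚᵘ-fromℚᵘ (mkℚᵘ (+ suc (suc n)) 0))))))
    where
    add : ∀ i → i ℤ.* + 1 ℤ.+ + 1 ℤ.* + 1 ≡ + 1 ℤ.+ i
    add = solve-∀
  fromℕ : ∀ n → ℚI.fromℤ (+ n) ≡ (+ n) ℚ./ 1
  fromℕ zero          = ≡.refl
  fromℕ (suc zero)    = ≡.refl
  fromℕ (suc (suc n)) = ≡.trans (≡.cong (ℚ._+ 1ℚ) (fromℕ (suc n))) (step n)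
fromℤ-ℚ (-[1+ n ]) = ≡.trans (≡.cong ℚ.-_ (fromℤ-ℚ (+ suc n))) (negate (+ suc n))
  where
  negate : ∀ i → ℚ.- (i ℚ./ 1) ≡ (ℤ.- i) ℚ./ 1
  negate i = ℚₚ.toℚᵘ-injective (ℚᵘₚ.≃-trans (ℚₚ.toℚᵘ-homo‿- (i ℚ./ 1)) (ℚᵘₚ.≃-trans (ℚᵘₚ.-‿cong (ℚₚ.toℚᵘ-fromℚᵘ (mkℚᵘ i 0)))
    (ℚᵘₚ.≃-sym (ℚₚ.toℚᵘ-fromℚᵘ (mkℚᵘ (ℤ.- i) 0)))))

clear-denominator : ∀ p d .(coprime : Coprimality.Coprime ℤ.∣ p ∣ (suc d)) → mkℚ p d coprime ℚ.* ℚI.fromℤ (+ suc d) ≡ ℚI.fromℤ p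
clear-denominator p d coprime = ≡.trans (≡.cong (mkℚ p d coprime ℚ.*_) (fromℤ-ℚ (+ suc d))) (≡.trans
  (ℚₚ.toℚᵘ-injective (ℚᵘₚ.≃-trans (ℚₚ.toℚᵘ-homo-* (mkℚ p d coprime) ((+ suc d) ℚ./ 1))
    (ℚᵘₚ.≃-trans (ℚᵘₚ.*-congˡ {mkℚᵘ p d} (ℚₚ.toℚᵘ-fromℚᵘ (mkℚᵘ (+ suc d) 0)))
      (ℚᵘₚ.≃-trans (*≡* (≡.trans (ℤₚ.*-identityʳ _) (≡.cong (λ k → p ℤ.* + k) (≡.sym (ℕₚ.*-identityʳ (suc d))))))
        (ℚᵘₚ.≃-sym (ℚₚ.toℚᵘ-fromℚᵘ (mkℚᵘ p 0))))))) (≡.sym (fromℤ-ℚ p)))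

module Orbits {K : CommutativeRing c ℓ} (field′ : IsClassicalField K)
  (stable : ∀ {x y} → ¬ ¬ (CommutativeRing._≈_ K x y) → CommutativeRing._≈_ K x y)
  (G : AbelianAction K ℓᵃ) where
  open CommutativeRing K hiding (zero)
  open AbelianAction G
  open FromIntegers K using (solve; _:=_; _:+_; _:*_; _:-_)
  open Interpolation field′ stable
  open PolynomialRing K
  open import Algebra.Definitions.RawSemiring (RawRing.rawSemiring rawRing) using (_^_)

  record Orbit (y : Carrier) : Set (c ⊔ ℓᵃ ⊔ ℓ) where
    field
      size     : ℕ
      σ        : Fin size → Aut
      distinct : Distinct (λ i → σ i · y)
      covers   : ∀ τ → ¬ ¬ (∃[ i ] τ · y ≈ σ i · y)

  -- Distinct conjugates are roots of one nonzero polynomial that annihilates y, so their number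
  -- stays below the length of its coefficient list. `fuel` is the room that remains.
  orbit : ∀ y → ¬ ¬ Orbit y
  orbit y = go (suc (length (map ι p))) 0 (λ ()) (λ ()) (ℕₚ.+-identityʳ _)
    where
    p = proj₁ (algebraic y)
    root : ∀ τ → eval (map ι p) (τ · y) ≈ 0#
    root τ = trans (coefficients p) (trans (eval-map (act τ) (map ι p) y) (trans (·-cong τ (proj₂ (proj₂ (algebraic y)))) (Hom.0-homo (act τ))))
      where
      coefficients : ∀ p → eval (map ι p) (τ · y) ≈ eval (map (τ ·_) (map ι p)) (τ · y)
      coefficients []      = refl
      coefficients (q ∷ p) = +-cong (sym (act-ι τ q)) (*-congˡ (coefficients p))
    go : ∀ fuel r (σ : Fin r → Aut) → Distinct (λ i → σ i · y) → fuel ℕ.+ r ≡ suc (length (map ι p)) → ¬ ¬ Orbit y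
    go zero r σ d e = contradiction (roots-unique r (λ i → σ i · y) d (map ι p)
      (ℕₚ.≤-trans (ℕₚ.n≤1+n _) (ℕₚ.≤-reflexive (≡.sym e))) (λ i → root (σ i))) (proj₁ (proj₂ (algebraic y)))
    go (suc fuel) r σ d e = em {A = ∃[ τ ] ∀ i → ¬ τ · y ≈ σ i · y} >>= λ where
        (no none)      → return record { size = r ; σ = σ ; distinct = d ; covers = λ τ ¬∃ → none (τ , λ i eq → ¬∃ (i , eq)) }
        (yes (τ , new)) → go fuel (suc r) (extend τ) (extend-distinct τ new) (≡.trans (ℕₚ.+-suc fuel r) e)
      where
      extend : Aut → Fin (suc r) → Aut
      extend τ zero    = τ
      extend τ (suc i) = σ i
      extend-distinct : ∀ τ → (∀ i → ¬ τ · y ≈ σ i · y) → Distinct (λ i → extend τ i · y)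
      extend-distinct τ new zero    zero    i≢j   = contradiction ≡.refl i≢j
      extend-distinct τ new zero    (suc j) i≢j   = new j
      extend-distinct τ new (suc i) zero    i≢j e = new i (sym e)
      extend-distinct τ new (suc i) (suc j) i≢j   = d i j (i≢j ∘ ≡.cong suc)

  eval-monic : ∀ low y → eval (monic low) y ≈ eval low y + y ^ length low
  eval-monic []      y = trans (eval-const y 1#) (sym (+-identityˡ 1#))
  eval-monic (b ∷ p) y = trans (+-congˡ (*-congˡ (eval-monic p y)))
    (solve 4 (λ b y e w → b :+ y :* (e :+ w) := (b :+ y :* e) :+ y :* w) refl b y (eval p y) (y ^ length p))

  eval-0 : ∀ p → eval p 0# ≈ coeff p 0
  eval-0 []      = refl
  eval-0 (b ∷ p) = trans (+-congˡ (zeroˡ _)) (+-identityʳ b)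

  -- The lower part of the product of the X - σᵢ y takes the value - xᵈ at each conjugate x, where d
  -- is the size of the orbit. Automorphisms preserve these data, so its coefficients are fixed. The
  -- norm is the value of the product at 0.
  norm-rational : ∀ {y} (O : Orbit y) → ∃[ q ] ∏ (λ i → 0# - Orbit.σ O i · y) ≈ ι q
  norm-rational {y} O = let q , e = fixed (eval (monic low) 0#) invariant in q , trans (sym (prod 0#)) e
    where
    open Orbit O
    x : Fin size → Carrier
    x i = σ i · y
    low  = proj₁ (productPolynomial x)
    len  = proj₁ (proj₂ (productPolynomial x))
    prod = proj₂ (proj₂ (productPolynomial x))
    node : ∀ i → eval low (x i) ≈ - x i ^ length low
    node i = trans (solve 2 (λ e w → e := (e :+ w) :- w) refl (eval low (x i)) (x i ^ length low))
      (trans (+-congʳ (trans (sym (eval-monic low (x i))) (trans (prod (x i)) (∏-zero (λ j → x i - x j) i (-‿inverseʳ _))))) (+-identityˡ _))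
    ^-cong : ∀ k {z w} → z ≈ w → z ^ k ≈ w ^ k
    ^-cong zero    e = refl
    ^-cong (suc k) e = *-cong e (^-cong k e)
    permutes : ∀ τ j → ¬ ¬ (∃[ i ] τ · x i ≈ x j × τ · eval low (x i) ≈ eval low (x j))
    permutes τ j = covers (τ ⁻¹ ∙ σ j) >>= λ (i , e) →
      let τx = trans (·-cong τ (trans (sym e) (∙-act (τ ⁻¹) (σ j) y))) (inverseʳ τ (x j)) in
      return (i , τx , trans (·-cong τ (node i)) (trans (Hom.neg-homo (act τ) _) (trans (-‿cong (trans (^-homo (act τ) (x i) (length low)) (^-cong (length low) τx))) (sym (node j)))))
    invariant : ∀ τ → τ · eval (monic low) 0# ≈ eval (monic low) 0#
    invariant τ = trans (·-cong τ at-0) (trans (Hom.+-homo (act τ) _ _) (trans (+-cong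
        (interpolant-invariant x distinct low (ℕₚ.≤-reflexive len) (act τ) (permutes τ) 0)
        (trans (^-homo (act τ) 0# (length low)) (^-cong (length low) (Hom.0-homo (act τ))))) (sym at-0)))
      where
      at-0 : eval (monic low) 0# ≈ coeff low 0 + 0# ^ length low
      at-0 = trans (eval-monic low 0#) (+-congʳ (eval-0 low))

-- The two possible values of T

module Contradiction {K : CommutativeRing c ℓ} (field′ : IsClassicalField K)
  (stable : ∀ {x y} → ¬ ¬ (CommutativeRing._≈_ K x y) → CommutativeRing._≈_ K x y)
  (characteristic-0 : Characteristic0 K)
  (G : AbelianAction K ℓᵃ) (ζ ζ̄ : CommutativeRing.Carrier K) where
  open CommutativeRing K hiding (zero)
  open AbelianAction G
  open FromIntegers K using (fromℤ; fromℤ-+; fromℤ-*; fromℤ-neg; solve; _:=_; con; _:+_; _:*_; _:-_; :-_)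
  open Interpolation field′ stable using (∏; ∏≉0; cancelˡ; difference≉0)
  open Positivity field′ stable G
  open Orbits field′ stable G
  open CubicExtension field′ stable G ζ ζ̄
  open Lattices K
  open Divisibility field′ characteristic-0
  open Certificate K
  open import Algebra.Definitions.RawSemiring (RawRing.rawSemiring rawRing) using (_^_)

  -- For a denominator b ≥ 2, Bezout's identity for the absolute value of p and b, combined with b x
  -- = p, writes an integer congruent to 1 modulo b as b times an integral element, contrary to
  -- `not-divisible`.
  rational-integral : ∀ {V x} q → x ≈ ι q → Span V 1# → Stable V x → ∃[ m ] x ≈ fromℤ m
  rational-integral {V} {x} (mkℚ p d coprime) x≈ 1∈V st = go d ≡.refl
    where
    module ι = Hom rational
    bx≈p : fromℤ (+ suc d) * x ≈ fromℤ p
    bx≈p = trans (*-cong (sym (fromℤ-homo {R = ℚₚ.+-*-commutativeRing} rational (+ suc d))) x≈)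
      (trans (*-comm _ _) (trans (sym (ι.*-homo (mkℚ p d coprime) (ℚI.fromℤ (+ suc d)))) (trans (ι.⟦⟧-cong (clear-denominator p d coprime))
        (fromℤ-homo {R = ℚₚ.+-*-commutativeRing} rational p))))
    signed : ∃[ y ] Stable V y × fromℤ (+ suc d) * y ≈ fromℤ (+ ℤ.∣ p ∣)
    signed = abs p bx≈p
      where
      abs : ∀ p → fromℤ (+ suc d) * x ≈ fromℤ p → ∃[ y ] Stable V y × fromℤ (+ suc d) * y ≈ fromℤ (+ ℤ.∣ p ∣)
      abs (+ n)      e = x , st , e
      abs (-[1+ n ]) e = - x , stable-neg {a = x} st , trans (solve 2 (λ b x → b :* (:- x) := :- (b :* x)) refl (fromℤ (+ suc d)) x)
        (trans (-‿cong e) (solve 1 (λ n → :- (:- n) := n) refl (fromℤ (+ suc n))))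
    pos-+* : ∀ k m n → fromℤ (+ (k ℕ.+ m ℕ.* n)) ≈ fromℤ (+ k) + fromℤ (+ m) * fromℤ (+ n)
    pos-+* k m n = trans (fromℤ-+ (+ k) (+ (m ℕ.* n))) (+-congˡ (trans (reflexive (≡.cong fromℤ (ℤₚ.pos-* m n))) (fromℤ-* (+ m) (+ n))))
    go : ∀ e → e ≡ d → ∃[ m ] x ≈ fromℤ m
    go zero    ≡.refl = p , trans (sym (*-identityˡ x)) bx≈p
    go (suc e) ≡.refl = ⊥-elim (bezout (coprime-Bézout (recompute coprime)))
      where
      b = suc d
      y = proj₁ signed
      st-y = proj₁ (proj₂ signed)
      by = proj₂ (proj₂ signed)
      bezout : Bézout.Identity 1 ℤ.∣ p ∣ b → ⊥
      bezout (Bézout.+- u v eq) = not-divisible b (+ v) (s≤s (s≤s z≤n)) 1∈V (stable-* {a = fromℤ (+ u)} {y} (stable-fromℤ (+ u)) st-y)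
        (trans (fromℤ-+ (+ 1) (+ b ℤ.* + v)) (trans (+-congˡ (trans (fromℤ-* (+ b) (+ v)) (*-comm _ _))) (trans (sym (pos-+* 1 v b))
          (trans (reflexive (≡.cong (fromℤ ∘ +_) eq)) (trans (pos-+* 0 u ℤ.∣ p ∣) (trans (+-congˡ (*-congˡ (sym by)))
            (solve 3 (λ u b y → con (+ 0) :+ u :* (b :* y) := b :* (u :* y)) refl (fromℤ (+ u)) (fromℤ (+ b)) y)))))))
      bezout (Bézout.-+ u v eq) = not-divisible b (+ 0) (s≤s (s≤s z≤n)) 1∈V
        (stable-+ {a = fromℤ (+ v)} { - (fromℤ (+ u) * y)} (stable-fromℤ (+ v)) (stable-neg {a = fromℤ (+ u) * y} (stable-* {a = fromℤ (+ u)} {y} (stable-fromℤ (+ u)) st-y)))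
        (trans (trans (fromℤ-+ (+ 1) (+ b ℤ.* + 0)) (+-congˡ (trans (fromℤ-* (+ b) (+ 0)) (zeroʳ _))))
          (trans (solve 1 (λ w → con (+ 1) :+ con (+ 0) := (con (+ 1) :+ w) :- w) refl (fromℤ (+ u) * fromℤ (+ ℤ.∣ p ∣)))
            (trans (+-congʳ (trans (sym (pos-+* 1 u ℤ.∣ p ∣)) (trans (reflexive (≡.cong (fromℤ ∘ +_) eq)) (pos-+* 0 v b))))
              (trans (+-congˡ (-‿cong (*-congˡ (sym by))))
                (solve 4 (λ u v b y → (con (+ 0) :+ v :* b) :- u :* (b :* y) := b :* (v :- u :* y)) refl (fromℤ (+ u)) (fromℤ (+ v)) (fromℤ (+ b)) y)))))

  module _ (n : ℕ) (0<n : 0 < n) (ζ^n : ζ ^ n ≈ 1#) (ζ̄^n : ζ̄ ^ n ≈ 1#) (ζζ̄ : ζ * ζ̄ ≈ 1#) (ζ≉1 : ¬ ζ ≈ 1#) (I : PositiveInvolution) where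
    open PositiveInvolution I
    open IsSubfield S-sub
    private
      module J = Hom (act J)
      positive = Pos S J

    t T N β : Carrier
    t = J · s
    T = s + t
    N = s * t
    β = T * T + T

    Real : Carrier → Set (ℓᵃ ⊔ ℓ)
    Real x = S x × J · x ≈ x

    real-+ : ∀ {x y} → Real x → Real y → Real (x + y)
    real-+ (s , e) (t , f) = S-+ s t , trans (J.+-homo _ _) (+-cong e f)

    real-* : ∀ {x y} → Real x → Real y → Real (x * y)
    real-* (s , e) (t , f) = S-* s t , trans (J.*-homo _ _) (*-cong e f)

    real-neg : ∀ {x} → Real x → Real (- x)
    real-neg (s , e) = S-neg s , trans (J.neg-homo _) (-‿cong e)

    real-fromℤ : ∀ i → Real (fromℤ i)
    real-fromℤ i = S-fromℤ i , fromℤ-homo {R = K} (act J) i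

    p-cong : ∀ {x y} → x ≈ y → positive x → positive y
    p-cong = pos-cong S-sub involutive
    p-+ : ∀ {x y} → positive x → positive y → positive (x + y)
    p-+ = pos-+ S-sub involutive
    p-* : ∀ {x y} → positive x → positive y → positive (x * y)
    p-* = pos-* S-sub involutive
    p-ℕ : ∀ n → positive (fromℤ (+ n))
    p-ℕ = pos-ℕ S-sub involutive
    p-square : ∀ {x} → Real x → positive (x * x)
    p-square (s , e) = pos-square S-sub involutive s e

    not-negative : ∀ k → ¬ positive (fromℤ -[1+ k ])
    not-negative k p = proper (p-cong (trans (sym (fromℤ-+ -[1+ k ] (+ k))) (trans (reflexive (≡.cong fromℤ (minus-one k))) refl)) (p-+ p (p-ℕ k)))
      where
      minus-one : ∀ k → -[1+ k ] ℤ.+ + k ≡ -[1+ 0 ]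
      minus-one k = shift (+ k)
        where
        shift : ∀ i → ℤ.- (+ 1 ℤ.+ i) ℤ.+ i ≡ ℤ.- (+ 1)
        shift = solve-∀

    -- With z the inverse of k, x is the product of k x and the positive element k z².
    divide : ∀ k {x} → + k ≢ + 0 → positive (fromℤ (+ k) * x) → ¬ ¬ positive x
    divide k {x} k≢0 p = IsClassicalField.invertible field′ (fromℤ (+ k)) (characteristic-0 (+ k) k≢0) >>= λ (z , e) →
      let s-z = S-inverse e (S-fromℤ (+ k))
          m = fromℤ (+ k)
          Jz : J · z ≈ z
          Jz = trans (sym (*-identityˡ _)) (trans (*-congʳ (trans (sym e) (*-comm m z))) (trans (*-assoc z m _)
            (trans (*-congˡ (trans (*-congʳ (sym (proj₂ (real-fromℤ (+ k))))) (trans (sym (J.*-homo m z)) (trans (·-cong J e) J.1-homo)))) (*-identityʳ z))))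
      in return (p-cong (trans (solve 3 (λ m x z → (m :* x) :* (m :* (z :* z)) := x :* ((m :* z) :* (m :* z))) refl m x z)
           (trans (*-congˡ (trans (*-cong e e) (*-identityˡ 1#))) (*-identityʳ x))) (p-* p (p-* (p-ℕ k) (p-square (s-z , Jz)))))

    s-real : Real T × Real ((s - t) * (t - s))
    s-real = (S-+ s∈S (S-act J s∈S) , trans (J.+-homo s t) (trans (+-congˡ Jt) (+-comm t s))) ,
      (S-* (S-+ s∈S (S-neg t∈S)) (S-+ t∈S (S-neg s∈S)) , trans (J.*-homo _ _) (trans (*-cong J[s-t] (trans (J.+-homo t (- s)) (+-cong Jt (J.neg-homo s)))) (*-comm _ _)))
      where
      t∈S = S-act J s∈S
      Jt = involutive s∈S
      J[s-t] : J · (s - t) ≈ t - s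
      J[s-t] = trans (J.+-homo s (- t)) (+-congˡ (trans (J.neg-homo t) (-‿cong Jt)))

    cubic-homo : ∀ σ u z → σ · (u * u * u + u * u + fromℤ (+ 7) * u + (z - 1#)) ≈
      (σ · u) * (σ · u) * (σ · u) + (σ · u) * (σ · u) + fromℤ (+ 7) * (σ · u) + (σ · z - 1#)
    cubic-homo σ u z = trans (h.+-homo _ _) (+-cong
        (trans (h.+-homo _ _) (+-cong (trans (h.+-homo _ _) (+-cong (trans (h.*-homo (u * u) u) (*-congʳ (h.*-homo u u))) (h.*-homo u u)))
          (trans (h.*-homo (fromℤ (+ 7)) u) (*-congʳ (fromℤ-homo {R = K} (act σ) (+ 7))))))
        (trans (h.+-homo z (- 1#)) (+-congˡ (trans (h.neg-homo 1#) (-‿cong h.1-homo)))))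
      where module h = Hom (act σ)

    t-root : t * t * t + t * t + fromℤ (+ 7) * t + (ζ̄ - 1#) ≈ 0#
    t-root = trans (+-congˡ (+-congʳ (sym Jζ))) (trans (sym (cubic-homo J s ζ)) (trans (·-cong J s-root) J.0-homo))

    XY≈1 : (1# - fromℤ (+ 7) * s - s * s - s * s * s) * (1# - fromℤ (+ 7) * t - t * t - t * t * t) ≈ 1#
    XY≈1 = trans (*-cong (from-root s ζ s-root) (from-root t ζ̄ t-root)) ζζ̄
      where
      from-root : ∀ s ζ → s * s * s + s * s + fromℤ (+ 7) * s + (ζ - 1#) ≈ 0# → 1# - fromℤ (+ 7) * s - s * s - s * s * s ≈ ζ
      from-root s ζ e = trans (solve 2 (λ s z → con (+ 1) :- con (+ 7) :* s :- s :* s :- s :* s :* s :=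
        z :- (s :* s :* s :+ s :* s :+ con (+ 7) :* s :+ (z :- con (+ 1)))) refl s ζ) (trans (+-congˡ (-‿cong e)) (solve 1 (λ z → z :- con (+ 0) := z) refl ζ))

    drop-last : ∀ {a x b y z} → y ≈ 1# → a * x + b * (y - 1#) ≈ z → a * x ≈ z
    drop-last {a} {x} {b} {y} y≈1 e = trans (sym (trans (+-congˡ (trans (*-congˡ (trans (+-congʳ y≈1) (-‿inverseʳ 1#))) (zeroʳ b))) (+-identityʳ _))) e

    β-upper : ¬ ¬ positive (fromℤ (+ 15) - fromℤ (+ 16) * β)
    β-upper = divide 2724261469723720765440000 (λ ()) (p-cong (sym (drop-last XY≈1 (certificate s t)))
      (p-+ (squares evenSquares even-real) odd-positive))
      where
      T-real = proj₁ s-real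
      V-real = proj₂ s-real
      V = (s - t) * (t - s)
      combination-real : ∀ ks {xs} → All Real xs → Real (combination ks xs)
      combination-real []       _        = real-fromℤ (+ 0)
      combination-real (k ∷ ks) []       = real-fromℤ (+ 0)
      combination-real (k ∷ ks) (r ∷ rs) = real-+ (real-* (real-fromℤ k) r) (combination-real ks rs)
      squares : ∀ ws {xs} → All Real xs → positive (weightedSquares ws xs)
      squares []               rs = p-ℕ 0
      squares ((w , ks) ∷ ws) rs = p-+ (p-* (p-ℕ w) (p-square (combination-real ks rs))) (squares ws rs)
      even-real : All Real (evenMonomials T V)
      even-real = real-fromℤ (+ 1) ∷ T-real ∷ real-* T-real T-real ∷ V-real ∷ real-* (real-* T-real T-real) T-real ∷ real-* T-real V-real ∷ []
      odd-real : All Real (oddMonomials T V)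
      odd-real = real-fromℤ (+ 1) ∷ T-real ∷ real-* T-real T-real ∷ V-real ∷ []
      V-positive : positive V
      V-positive = norm (s - t) (S-+ s∈S (S-neg (S-act J s∈S))) (*-congˡ (sym (trans (J.+-homo s (- t))
        (+-congˡ (trans (J.neg-homo t) (-‿cong (involutive s∈S)))))))
      odd-positive : positive (V * weightedSquares oddSquares (oddMonomials T V))
      odd-positive = p-* V-positive (squares oddSquares odd-real)

    β-real : Real β
    β-real = real-+ (real-* (proj₁ s-real) (proj₁ s-real)) (proj₁ s-real)

    -- The bound - 1/4 is relaxed to - 15/16, so that it combines with the upper bound into a single
    -- one on β².
    β-lower : positive (fromℤ (+ 15) + fromℤ (+ 16) * β)
    β-lower = p-cong (solve 1 (λ T → con (+ 4) :* ((con (+ 2) :* T :+ con (+ 1)) :* (con (+ 2) :* T :+ con (+ 1))) :+ con (+ 11) :=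
        con (+ 15) :+ con (+ 16) :* (T :* T :+ T)) refl T)
      (p-+ (p-* (p-ℕ 4) (p-square (real-+ (real-* (real-fromℤ (+ 2)) (proj₁ s-real)) (real-fromℤ (+ 1))))) (p-ℕ 11))

    -- |x| ≤ 15/16
    Small : Carrier → Set (c ⊔ ℓᵃ ⊔ ℓ)
    Small x = positive (fromℤ (+ 225) - fromℤ (+ 256) * (x * x))

    β-small : ¬ ¬ Small β
    β-small = β-upper >>= λ p → return (p-cong (solve 1 (λ b → (con (+ 15) :- con (+ 16) :* b) :* (con (+ 15) :+ con (+ 16) :* b) :=
      con (+ 225) :- con (+ 256) :* (b :* b)) refl β) (p-* p β-lower))

    act-real : ∀ σ {x} → Real x → Real (σ · x)
    act-real σ (m , e) = S-act σ m , trans (commutes J σ _) (·-cong σ e)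

    act-small : ∀ σ {x} → Small x → Small (0# - σ · x)
    act-small σ {x} p = p-cong (trans (h.+-homo _ _) (+-cong (fromℤ-homo {R = K} (act σ) (+ 225)) (trans (h.neg-homo _) (-‿cong
        (trans (h.*-homo _ _) (*-cong (fromℤ-homo {R = K} (act σ) (+ 256)) (trans (h.*-homo x x)
          (solve 1 (λ y → y :* y := (con (+ 0) :- y) :* (con (+ 0) :- y)) refl (σ · x)))))))))
      (pos-act S-sub involutive σ p)
      where module h = Hom (act σ)

    -- The number 31 is 256 - 225: a small y satisfies 1 - y² ≥ 31/256. The index is `suc r` because
    -- the empty product 1 is not small.
    small-product : ∀ r (f : Fin (suc r) → Carrier) → (∀ i → Real (f i)) → (∀ i → Small (f i)) → Real (∏ f) × Small (∏ f)
    small-product zero f real small = (real-* (real zero) (real-fromℤ (+ 1))) ,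
      p-cong (solve 1 (λ x → con (+ 225) :- con (+ 256) :* (x :* x) := con (+ 225) :- con (+ 256) :* ((x :* con (+ 1)) :* (x :* con (+ 1)))) refl (f zero)) (small zero)
    small-product (suc r) f real small = let real′ , small′ = small-product r (λ i → f (suc i)) (λ i → real (suc i)) (λ i → small (suc i)) in
      real-* (real zero) real′ ,
      p-cong (solve 2 (λ x y → (con (+ 225) :- con (+ 256) :* (x :* x)) :+ (x :* x) :* (con (+ 31) :+ (con (+ 225) :- con (+ 256) :* (y :* y))) :=
          con (+ 225) :- con (+ 256) :* ((x :* y) :* (x :* y))) refl (f zero) (∏ (λ i → f (suc i))))
        (p-+ (small zero) (p-* (p-square (real zero)) (p-+ (p-ℕ 31) small′)))

    small-integer : ∀ m → Small (fromℤ m) → m ≡ + 0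
    small-integer m p with m ℤₚ.≟ + 0
    ... | yes e = e
    ... | no m≢0 = contradiction (p-cong value p) (not-negative (30 ℕ.+ 256 ℕ.* proj₁ square))
      where
      square-positive : ∀ m → m ≢ + 0 → ∃[ j ] m ℤ.* m ≡ + suc j
      square-positive (+ zero)   ne = contradiction ≡.refl ne
      square-positive (+ suc k)  _  = _ , ≡.refl
      square-positive (-[1+ k ]) _  = _ , ≡.refl
      square : ∃[ j ] m ℤ.* m ≡ + suc j
      square = square-positive m m≢0
      j = proj₁ square
      value : fromℤ (+ 225) - fromℤ (+ 256) * (fromℤ m * fromℤ m) ≈ fromℤ -[1+ 30 ℕ.+ 256 ℕ.* j ]
      value = trans (+-congˡ (-‿cong (*-congˡ (trans (sym (fromℤ-* m m)) (trans (reflexive (≡.cong fromℤ (proj₂ square))) (fromℤ-+ (+ 1) (+ j)))))))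
        (trans (solve 1 (λ j → con (+ 225) :- con (+ 256) :* (con (+ 1) :+ j) := :- (con (+ 31) :+ con (+ 256) :* j)) refl (fromℤ (+ j)))
          (trans (-‿cong (trans (+-congˡ (trans (sym (fromℤ-* (+ 256) (+ j))) (reflexive (≡.cong fromℤ (≡.sym (ℤₚ.pos-* 256 j))))))
            (sym (fromℤ-+ (+ 31) (+ (256 ℕ.* j)))))) (sym (fromℤ-neg (+ (31 ℕ.+ 256 ℕ.* j))))))

    -- The head is adjoined last, so each root of the cubic stands directly before the root of unity
    -- in its constant term. A single lattice for all conjugates makes the norm integral.
    conjugates : ∀ r → (Fin r → Aut) → List Carrier
    conjugates zero    σ = []
    conjugates (suc r) σ = σ zero · t ∷ σ zero · ζ̄ ∷ σ zero · s ∷ σ zero · ζ ∷ conjugates r (λ i → σ (suc i))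

    adjoin-root : ∀ {as} u z → u * u * u + u * u + fromℤ (+ 7) * u + (z - 1#) ≈ 0# → Integral (z ∷ as) → Integral (u ∷ z ∷ as)
    adjoin-root u z e I = adjoin-cubic u 1# (fromℤ (+ 7)) (z - 1#) I (stable-fromℤ (+ 1)) (stable-fromℤ (+ 7))
      (stable-+ {a = z} { - 1#} (All.head (proj₂ (proj₂ I))) (stable-neg {a = 1#} (stable-fromℤ (+ 1))))
      (trans (+-congʳ (+-congʳ (+-congˡ (*-identityˡ (u * u))))) e)

    integral-conjugates : ∀ r (σ : Fin r → Aut) → Integral (conjugates r σ)
    integral-conjugates zero    σ = integral-[]
    integral-conjugates (suc r) σ =
      adjoin-root (σ₀ · t) (σ₀ · ζ̄) (root t ζ̄ t-root) (adjoin-rootOfUnity n (σ₀ · ζ̄) 0<n (power ζ̄ ζ̄^n)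
        (adjoin-root (σ₀ · s) (σ₀ · ζ) (root s ζ s-root) (adjoin-rootOfUnity n (σ₀ · ζ) 0<n (power ζ ζ^n) (integral-conjugates r (λ i → σ (suc i))))))
      where
      σ₀ = σ zero
      module h = Hom (act σ₀)
      power : ∀ z → z ^ n ≈ 1# → (σ₀ · z) ^ n ≈ 1#
      power z e = trans (sym (^-homo (act σ₀) z n)) (trans (·-cong σ₀ e) h.1-homo)
      root : ∀ u z → u * u * u + u * u + fromℤ (+ 7) * u + (z - 1#) ≈ 0# →
        (σ₀ · u) * (σ₀ · u) * (σ₀ · u) + (σ₀ · u) * (σ₀ · u) + fromℤ (+ 7) * (σ₀ · u) + (σ₀ · z - 1#) ≈ 0#
      root u z e = trans (sym (cubic-homo σ₀ u z)) (trans (·-cong σ₀ e) h.0-homo)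

    stable-β : ∀ {V} r (σ : Fin r → Aut) → All (Stable V) (conjugates r σ) → ∀ i → Stable V (0# - σ i · β)
    stable-β (suc r) σ (st-t ∷ _ ∷ st-s ∷ _ ∷ _) zero = stable-+ {a = 0#} { - (σ zero · β)} (stable-fromℤ (+ 0))
        (stable-neg {a = σ zero · β} (stable-cong (sym (trans (h.+-homo _ _) (+-cong (trans (h.*-homo T T) (*-cong T≈ T≈)) T≈)))
          (stable-+ {a = T′ * T′} {T′} (stable-* {a = T′} {T′} st-T st-T) st-T)))
      where
      module h = Hom (act (σ zero))
      T′ = σ zero · s + σ zero · t
      T≈ : σ zero · T ≈ T′
      T≈ = h.+-homo s t
      st-T = stable-+ {a = σ zero · s} {σ zero · t} st-s st-t
    stable-β (suc r) σ (_ ∷ _ ∷ _ ∷ _ ∷ rest) (suc i) = stable-β r (λ i → σ (suc i)) rest i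

    stable-∏ : ∀ {V} r (f : Fin r → Carrier) → (∀ i → Stable V (f i)) → Stable V (∏ f)
    stable-∏ zero    f st = stable-fromℤ (+ 1)
    stable-∏ (suc r) f st = stable-* {a = f zero} {∏ (λ i → f (suc i))} (st zero) (stable-∏ r (λ i → f (suc i)) (λ i → st (suc i)))

    -- The norm of β is an integer of absolute value < 1.
    β≈0 : β ≈ 0#
    β≈0 = stable (orbit β >>= λ O → β-small >>= λ small → norm-zero O small)
      where
      integer : ∀ r (σ : Fin r → Aut) q → ∏ (λ i → 0# - σ i · β) ≈ ι q → Integral (conjugates r σ) → ∃[ m ] ∏ (λ i → 0# - σ i · β) ≈ fromℤ m
      integer r σ q e (V , 1∈V , st) = rational-integral q e 1∈V (stable-∏ r (λ i → 0# - σ i · β) (stable-β r σ st))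
      norm-zero : (O : Orbit β) → Small β → ¬ ¬ (β ≈ 0#)
      norm-zero O small = vanishing size σ covers (proj₂ (norm-rational O))
        where
        open Orbit O
        vanishing : ∀ r (σ : Fin r → Aut) → (∀ τ → ¬ ¬ (∃[ i ] τ · β ≈ σ i · β)) → ∀ {q} → ∏ (λ i → 0# - σ i · β) ≈ ι q → ¬ ¬ (β ≈ 0#)
        vanishing zero    σ covers e β≉0 = covers identity λ { (() , _) }
        vanishing (suc r) σ covers {q} e β≉0 =
          let m , N≈m = integer (suc r) σ q e (integral-conjugates (suc r) σ)
              _ , small-N = small-product r (λ i → 0# - σ i · β) (λ i → real-+ (real-fromℤ (+ 0)) (real-neg (act-real (σ i) β-real))) (λ i → act-small (σ i) small)
              m≡0 = small-integer m (p-cong (+-congˡ (-‿cong (*-congˡ (*-cong N≈m N≈m)))) small-N)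
          in ∏≉0 (λ i → 0# - σ i · β) (λ i z → β≉0 (·-injective (σ i) (trans
               (solve 1 (λ y → y := :- (con (+ 0) :- y)) refl (σ i · β)) (trans (-‿cong z) (trans (solve 0 (:- con (+ 0) := con (+ 0)) refl) (sym (Hom.0-homo (act (σ i)))))))))
             (trans N≈m (reflexive (≡.cong fromℤ m≡0)))

    ζ≈ : ζ ≈ 1# - s * (s * s + s + fromℤ (+ 7))
    ζ≈ = trans (solve 2 (λ s z → z := (con (+ 1) :- s :* (s :* s :+ s :+ con (+ 7))) :+ (s :* s :* s :+ s :* s :+ con (+ 7) :* s :+ (z :- con (+ 1)))) refl s ζ)
      (trans (+-congˡ s-root) (+-identityʳ _))

    s≉0 : ¬ s ≈ 0#
    s≉0 e = ζ≉1 (trans ζ≈ (trans (+-congˡ (-‿cong (trans (*-congʳ e) (zeroˡ _)))) (solve 0 (con (+ 1) :- con (+ 0) := con (+ 1)) refl)))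

    N-positive : positive N
    N-positive = norm s s∈S refl

    N-real : Real N
    N-real = pos-S S-sub involutive N-positive , pos-fixed S-sub involutive N-positive

    t≈ : ∀ u → s + t ≈ u → t ≈ u - s
    t≈ u e = trans (solve 2 (λ s t → t := (s :+ t) :- s) refl s t) (+-congʳ e)

    T≉0 : ¬ T ≈ 0#
    T≉0 e = proper (p-cong minus-one (p-+ (p-+ (p-ℕ 1) N-positive) (p-square {fromℤ (+ 7) - N} (real-+ (real-fromℤ (+ 7)) (real-neg N-real)))))
      where
      N≉0 : ¬ N ≈ 0#
      N≉0 z = s≉0 (trans (sym (involutive s∈S)) (trans (·-cong J (cancelˡ z s≉0)) J.0-homo))
      -- If T = 0, then t = - s and s² = - N, so that the product in `XY≈1` equals (1 + N)² + N (7 -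
      -- N)². The multiple of T in the solver identity is the general correction.
      relation : N * (fromℤ (+ 2) + N + (fromℤ (+ 7) - N) * (fromℤ (+ 7) - N)) ≈ 0#
      relation = trans (solve 2 (λ s t → let T = s :+ t ; N = s :* t in
          N :* (con (+ 2) :+ N :+ (con (+ 7) :- N) :* (con (+ 7) :- N)) :=
          ((con (+ 1) :- con (+ 7) :* s :- s :* s :- s :* s :* s) :* (con (+ 1) :- con (+ 7) :* t :- t :* t :- t :* t :* t) :- con (+ 1)) :+
            T :* (con (+ 7) :- con (+ 10) :* N :- N :* N :+ T :- con (+ 7) :* (N :* T) :+ T :* T)) refl s t)
        (trans (+-cong (trans (+-congʳ XY≈1) (-‿inverseʳ 1#)) (trans (*-congʳ e) (zeroˡ _))) (+-identityʳ 0#))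
      minus-one : 1# + N + (fromℤ (+ 7) - N) * (fromℤ (+ 7) - N) ≈ - 1#
      minus-one = trans (solve 1 (λ n → con (+ 1) :+ n :+ (con (+ 7) :- n) :* (con (+ 7) :- n) := (con (+ 2) :+ n :+ (con (+ 7) :- n) :* (con (+ 7) :- n)) :- con (+ 1)) refl N)
        (trans (+-congʳ (cancelˡ relation N≉0)) (+-identityˡ _))

    T≉-1 : ¬ T + 1# ≈ 0#
    T≉-1 e = no-integer (from-integral (integral-conjugates 1 (λ _ → identity)))
      where
      relation : (fromℤ (+ 7) - N) * (1# + fromℤ (+ 7) * N - N * N) ≈ 0#
      relation = trans (solve 2 (λ s t → let T = s :+ t ; N = s :* t in
          (con (+ 7) :- N) :* (con (+ 1) :+ con (+ 7) :* N :- N :* N) :=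
          ((con (+ 1) :- con (+ 7) :* s :- s :* s :- s :* s :* s) :* (con (+ 1) :- con (+ 7) :* t :- t :* t :- t :* t :* t) :- con (+ 1)) :+
            (T :+ con (+ 1)) :* (con (+ 7) :- con (+ 10) :* N :- N :* N :+ (con (+ 1) :- con (+ 7) :* N) :* (T :- con (+ 1)) :+ (T :* T :- T :+ con (+ 1)))) refl s t)
        (trans (+-cong (trans (+-congʳ XY≈1) (-‿inverseʳ 1#)) (trans (*-congʳ e) (zeroˡ _))) (+-identityʳ 0#))
      -- With T = - 1 and N = 7, s is a root of X² + X + 7, and ζ = 1 - s (s² + s + 7) would be 1.
      7-N≉0 : ¬ fromℤ (+ 7) - N ≈ 0#
      7-N≉0 z = ζ≉1 (trans ζ≈ (trans (+-congˡ (-‿cong (trans (*-congˡ (trans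
          (solve 2 (λ s t → s :* s :+ s :+ con (+ 7) := (con (+ 7) :- s :* t) :+ s :* (s :+ t :+ con (+ 1))) refl s t)
          (trans (+-cong z (trans (*-congˡ e) (zeroʳ s))) (+-identityʳ 0#)))) (zeroʳ s))))
        (solve 0 (con (+ 1) :- con (+ 0) := con (+ 1)) refl)))
      quadratic : 1# + fromℤ (+ 7) * N - N * N ≈ 0#
      quadratic = cancelˡ relation 7-N≉0
      -- A conjugate of N other than N would be the second root of the quadratic. The product - 1 of
      -- the two roots would then be positive.
      N-fixed : ∀ σ → σ · N ≈ N
      N-fixed σ = stable λ σN≉N → proper (p-cong (conjugate-product (cancelˡ difference (difference≉0 σN≉N))) (p-* N-positive (pos-act S-sub involutive σ N-positive)))
        where
        module h = Hom (act σ)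
        M = σ · N
        quadratic′ : 1# + fromℤ (+ 7) * M - M * M ≈ 0#
        quadratic′ = trans (sym (trans (h.+-homo _ _) (+-cong (trans (h.+-homo _ _) (+-cong h.1-homo (trans (h.*-homo _ _) (*-congʳ (fromℤ-homo {R = K} (act σ) (+ 7))))))
          (trans (h.neg-homo _) (-‿cong (h.*-homo N N)))))) (trans (·-cong σ quadratic) h.0-homo)
        difference : (M - N) * (M + N - fromℤ (+ 7)) ≈ 0#
        difference = trans (solve 2 (λ m n → (m :- n) :* (m :+ n :- con (+ 7)) :=
            (con (+ 1) :+ con (+ 7) :* n :- n :* n) :- (con (+ 1) :+ con (+ 7) :* m :- m :* m)) refl M N)
          (trans (+-cong quadratic (-‿cong quadratic′)) (-‿inverseʳ 0#))
        conjugate-product : M + N - fromℤ (+ 7) ≈ 0# → N * M ≈ - 1#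
        conjugate-product z = trans (solve 2 (λ m n → n :* m := n :* (m :+ n :- con (+ 7)) :+ (con (+ 1) :+ con (+ 7) :* n :- n :* n) :- con (+ 1)) refl M N)
          (trans (+-congʳ (trans (+-cong (trans (*-congˡ z) (zeroʳ N)) quadratic) (+-identityʳ 0#))) (+-identityˡ _))
      q = proj₁ (fixed N N-fixed)
      N≈ιq = proj₂ (fixed N N-fixed)
      from-integral : Integral (conjugates 1 (λ _ → identity)) → ∃[ m ] N ≈ fromℤ m
      from-integral (V , 1∈V , st-t ∷ _ ∷ st-s ∷ _) = rational-integral q N≈ιq 1∈V
        (stable-cong (*-cong (id-act s) (id-act t)) (stable-* {a = identity · s} {identity · t} st-s st-t))
      -- An integral solution would satisfy m (m - 7) = 1, which forces m to be a unit, and neither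
      -- 1 nor - 1 works.
      no-integer : ¬ (∃[ m ] N ≈ fromℤ m)
      no-integer (m , N≈m) = units m (ℕₚ.m*n≡1⇒m≡1 ℤ.∣ m ∣ ℤ.∣ m ℤ.- + 7 ∣ (≡.trans (≡.sym (ℤₚ.abs-* m (m ℤ.- + 7))) (≡.cong ℤ.∣_∣ product))) product
        where
        vanishing : + 1 ℤ.- m ℤ.* (m ℤ.- + 7) ≡ + 0
        vanishing with (+ 1 ℤ.- m ℤ.* (m ℤ.- + 7)) ℤₚ.≟ + 0
        ... | yes p = p
        ... | no ¬p = contradiction (trans (fromℤ-+ (+ 1) (ℤ.- (m ℤ.* (m ℤ.- + 7)))) (trans (+-congˡ (trans (fromℤ-neg (m ℤ.* (m ℤ.- + 7)))
              (-‿cong (trans (fromℤ-* m (m ℤ.- + 7)) (*-congˡ (fromℤ-+ m -[1+ 6 ]))))))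
              (trans (solve 1 (λ m → con (+ 1) :- m :* (m :- con (+ 7)) := con (+ 1) :+ con (+ 7) :* m :- m :* m) refl (fromℤ m))
                (trans (sym (+-cong (+-congˡ (*-congˡ N≈m)) (-‿cong (*-cong N≈m N≈m)))) quadratic)))) (characteristic-0 _ ¬p)
        product : m ℤ.* (m ℤ.- + 7) ≡ + 1
        product = ≡.sym (ℤₚ.i-j≡0⇒i≡j (+ 1) (m ℤ.* (m ℤ.- + 7)) vanishing)
        units : ∀ m → ℤ.∣ m ∣ ≡ 1 → m ℤ.* (m ℤ.- + 7) ≢ + 1
        units (+ .1)        ≡.refl ()
        units (-[1+ .0 ]) ≡.refl ()

    impossible : ⊥
    impossible = T≉-1 (cancelˡ (trans (solve 1 (λ T → T :* (T :+ con (+ 1)) := T :* T :+ T) refl T) β≈0) T≉0)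

-- From extensions of ℚ to the abstract setting

ℚ-isClassicalField : IsClassicalField ℚₚ.+-*-commutativeRing
ℚ-isClassicalField = record
  { nontrivial = λ ()
  ; invertible = λ q q≢0 → return (ℚ.1/_ q {{ℚ.≢-nonZero q≢0}} , ℚₚ.*-inverseʳ q {{ℚ.≢-nonZero q≢0}}) }

ℚ-characteristic-0 : Characteristic0 ℚₚ.+-*-commutativeRing
ℚ-characteristic-0 i i≢0 e = i≢0 (≡.trans (≡.sym (ℤₚ.*-identityʳ i)) (cross (ℚᵘₚ.≃-trans
    (ℚᵘₚ.≃-sym (ℚₚ.toℚᵘ-fromℚᵘ (mkℚᵘ i 0))) (ℚᵘₚ.≃-reflexive (≡.cong ℚ.toℚᵘ (≡.trans (≡.sym (fromℤ-ℚ i)) e))))))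
  where
  cross : ∀ {p q} → p ℚᵘ.≃ q → ℚᵘ.↥ p ℤ.* ℚᵘ.↧ q ≡ ℚᵘ.↥ q ℤ.* ℚᵘ.↧ p
  cross (*≡* e) = e

module Rescaling (R : CommutativeRing c ℓ) where
  open CommutativeRing R hiding (zero)
  open FromIntegers R
  open PolynomialRing R

  -- The accumulator m holds the power of 4 that has been reached. Starting at 1, this substitutes
  -- 4c for the variable.
  rescale : ℤ → Pℤ.Poly → Pℤ.Poly
  rescale m []      = []
  rescale m (i ∷ p) = m ℤ.* i ∷ rescale (+ 4 ℤ.* m) p

  coeff-rescale : ∀ m p i → Pℤ.coeff (rescale m p) i ≡ m ℤ.* (+ 4) ℤ.^ i ℤ.* Pℤ.coeff p i
  coeff-rescale m []      i       = ≡.sym (ℤₚ.*-zeroʳ (m ℤ.* (+ 4) ℤ.^ i))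
  coeff-rescale m (x ∷ p) zero    = ≡.cong (ℤ._* x) (≡.sym (ℤₚ.*-identityʳ m))
  coeff-rescale m (x ∷ p) (suc i) = ≡.trans (coeff-rescale (+ 4 ℤ.* m) p i)
    (≡.cong (ℤ._* Pℤ.coeff p i) (≡.trans (≡.cong (ℤ._* (+ 4) ℤ.^ i) (ℤₚ.*-comm (+ 4) m)) (ℤₚ.*-assoc m (+ 4) ((+ 4) ℤ.^ i))))

  eval-rescale : ∀ m p x → eval (map fromℤ (rescale m p)) x ≈ fromℤ m * eval (map fromℤ p) (fromℤ (+ 4) * x)
  eval-rescale m []      x = sym (zeroʳ _)
  eval-rescale m (i ∷ p) x = trans (+-cong (fromℤ-* m i) (*-congˡ (trans (eval-rescale (+ 4 ℤ.* m) p x) (*-congʳ (fromℤ-* (+ 4) m)))))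
    (solve 5 (λ m i x f e → m :* i :+ x :* ((f :* m) :* e) := m :* (i :+ (f :* x) :* e)) refl
      (fromℤ m) (fromℤ i) x (fromℤ (+ 4)) (eval (map fromℤ p) (fromℤ (+ 4) * x)))

  eval-scaled : ∀ p q x → (∀ i → Pℤ.coeff p i ≡ (+ 4) ℤ.^ i ℤ.* Pℤ.coeff q i) →
    eval (map fromℤ p) x ≈ eval (map fromℤ q) (fromℤ (+ 4) * x)
  eval-scaled p q x e = trans (eval-cong x (Hom.⟦⟧-cong (mapHom (fromℤHom R)) {p} {rescale (+ 1) q} λ i →
      ≡.trans (e i) (≡.sym (≡.trans (coeff-rescale (+ 1) q i) (≡.cong (ℤ._* Pℤ.coeff q i) (ℤₚ.*-identityˡ ((+ 4) ℤ.^ i)))))))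
    (trans (eval-rescale (+ 1) q x) (*-identityˡ _))

module AbelianExtension {c ℓ₁ ℓ₂} (L : Extension c ℓ₁ ℓ₂) (abelian : IsAbelian L) where
  open Extension L using (heytingCommutativeRing; field′; ι-homo) renaming (ι to ιᴸ)

  K : CommutativeRing c ℓ₁
  K = HeytingCommutativeRing.commutativeRing heytingCommutativeRing

  private
    module L = HeytingField field′
  open CommutativeRing K hiding (zero)

  -- Tightness identifies equality with the negation of apartness, and negations are stable. This is
  -- how arguments under a double negation return to equations.
  stable : ∀ {x y} → ¬ ¬ (x ≈ y) → x ≈ y
  stable {x} {y} e = proj₁ (L.tight x y) λ x#y → e λ x≈y → proj₂ (L.tight x y) x≈y x#y

  isClassicalField : IsClassicalField K
  isClassicalField = record
    { nontrivial = λ e → proj₂ (L.tight 1# 0#) e (L.invertible⇒# (1# ,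
        trans (*-identityˡ _) 1-0 , trans (*-identityʳ _) 1-0))
    ; invertible = λ x x≉0 k → x≉0 (proj₁ (L.tight x 0#) λ x#0 →
        let y , yx , xy = L.#⇒invertible x#0 in k (y , trans (*-congʳ (sym (x-0 x))) xy)) }
    where
    open FromIntegers K
    x-0 : ∀ x → x - 0# ≈ x
    x-0 = solve 1 (λ x → x :- con (+ 0) := x) refl
    1-0 = x-0 1#

  rational : Hom ℚ.+-*-rawRing K
  rational = record { ⟦_⟧ = ιᴸ ; ⟦⟧-cong = ⟦⟧-cong ; +-homo = +-homo ; *-homo = *-homo ; neg-homo = -‿homo ; 0-homo = 0#-homo ; 1-homo = 1#-homo }
    where open RingMorphisms.IsRingHomomorphism ι-homo

  characteristic-0 : Characteristic0 K
  characteristic-0 = characteristic-0-extension {F = ℚₚ.+-*-commutativeRing} {E = K} ℚ-isClassicalField ℚ-characteristic-0 rational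
    (IsClassicalField.nontrivial isClassicalField)

  private
    module A (σ : Automorphism L) where
      open Automorphism σ public
      open RingMorphisms.IsRingIsomorphism iso public

    hom : Automorphism L → Hom rawRing K
    hom σ = record { ⟦_⟧ = ⟦_⟧ ; ⟦⟧-cong = ⟦⟧-cong ; +-homo = +-homo ; *-homo = *-homo ; neg-homo = -‿homo ; 0-homo = 0#-homo ; 1-homo = 1#-homo }
      where open A σ

    mkAutomorphism : (h : Hom rawRing K) → (∀ {x y} → Hom.⟦_⟧ h x ≈ Hom.⟦_⟧ h y → x ≈ y) →
      (∀ y → ∃[ x ] Hom.⟦_⟧ h x ≈ y) → (∀ q → Hom.⟦_⟧ h (ιᴸ q) ≈ ιᴸ q) → Automorphism L
    mkAutomorphism h inj surj fix = record
      { ⟦_⟧ = ⟦_⟧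
      ; iso = record
        { isRingMonomorphism = record
          { isRingHomomorphism = record
            { isSemiringHomomorphism = record
              { isNearSemiringHomomorphism = record
                { +-isMonoidHomomorphism = record
                  { isMagmaHomomorphism = record { isRelHomomorphism = record { cong = ⟦⟧-cong } ; homo = +-homo }
                  ; ε-homo = 0-homo }
                ; *-homo = *-homo }
              ; 1#-homo = 1-homo }
            ; -‿homo = neg-homo }
          ; injective = inj }
        ; surjective = λ y → proj₁ (surj y) , λ e → trans (⟦⟧-cong e) (proj₂ (surj y)) }
      ; fixes = fix }
      where open Hom h

    inv : Automorphism L → Carrier → Carrier
    inv σ y = proj₁ (A.surjective σ y)

    inv-right : ∀ σ y → A.⟦_⟧ σ (inv σ y) ≈ y
    inv-right σ y = proj₂ (A.surjective σ y) refl

    inv-hom : Automorphism L → Hom rawRing K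
    inv-hom σ = record
      { ⟦_⟧ = inv σ
      ; ⟦⟧-cong = λ {x} {y} e → injective (trans (inv-right σ x) (trans e (sym (inv-right σ y))))
      ; +-homo = λ x y → injective (trans (inv-right σ _) (sym (trans (+-homo _ _) (+-cong (inv-right σ x) (inv-right σ y)))))
      ; *-homo = λ x y → injective (trans (inv-right σ _) (sym (trans (*-homo _ _) (*-cong (inv-right σ x) (inv-right σ y)))))
      ; neg-homo = λ x → injective (trans (inv-right σ _) (sym (trans (-‿homo _) (-‿cong (inv-right σ x)))))
      ; 0-homo = injective (trans (inv-right σ _) (sym 0#-homo))
      ; 1-homo = injective (trans (inv-right σ _) (sym 1#-homo)) }
      where open A σ

    inv-left : ∀ σ x → inv σ (A.⟦_⟧ σ x) ≈ x
    inv-left σ x = A.injective σ (inv-right σ _)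

  action : AbelianAction K (c ⊔ ℓ₁)
  action = record
    { Aut = Automorphism L
    ; act = hom
    ; _∙_ = λ σ τ → mkAutomorphism (hom σ ∘ʰ hom τ) (λ e → A.injective τ (A.injective σ e))
        (λ y → inv τ (inv σ y) , trans (A.⟦⟧-cong σ (inv-right τ _)) (inv-right σ y))
        (λ q → trans (A.⟦⟧-cong σ (A.fixes τ q)) (A.fixes σ q))
    ; _⁻¹ = λ σ → mkAutomorphism (inv-hom σ) (λ {x} {y} e → trans (sym (inv-right σ x)) (trans (A.⟦⟧-cong σ e) (inv-right σ y)))
        (λ y → A.⟦_⟧ σ y , inv-left σ y) (λ q → A.injective σ (trans (inv-right σ _) (sym (A.fixes σ q))))
    ; identity = mkAutomorphism (record { ⟦_⟧ = λ x → x ; ⟦⟧-cong = λ e → e ; +-homo = λ _ _ → refl ; *-homo = λ _ _ → refl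
        ; neg-homo = λ _ → refl ; 0-homo = refl ; 1-homo = refl }) (λ e → e) (λ y → y , refl) (λ _ → refl)
    ; rational = rational
    ; ∙-act = λ _ _ _ → refl
    ; inverseʳ = inv-right
    ; inverseˡ = inv-left
    ; id-act = λ _ → refl
    ; commutes = λ σ τ x → proj₂ abelian σ τ x
    ; act-ι = A.fixes
    ; fixed = proj₂ (proj₁ abelian)
    ; algebraic = λ x → let p , p≉0 , root = proj₁ (proj₁ abelian) x in p , (λ e → p≉0 (zero-map p e)) , root }
    where
    open PolynomialRing K using (coeffs; _≋_)
    module ι = Hom rational
    ι-zero : ∀ q → ιᴸ q ≈ 0# → q ≡ 0ℚ
    ι-zero q e with q ℚₚ.≟ 0ℚ
    ... | yes p = p
    ... | no q≢0 = ⊥-elim (IsClassicalField.invertible ℚ-isClassicalField q q≢0 λ (y , qy) →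
          IsClassicalField.nontrivial isClassicalField (trans (sym ι.1-homo) (trans (ι.⟦⟧-cong (≡.sym qy)) (trans (ι.*-homo q y) (trans (*-congʳ e) (zeroˡ _))))))
    zero-map : ∀ p → map ιᴸ p ≋ [] → ∀ i → Polynomial.coeff ℚ.+-*-rawRing p i ≡ 0ℚ
    zero-map p e i = ι-zero _ (trans (sym (coeff-map rational p i)) (coeffs e i))

  open FromIntegers K
  open PolynomialRing K using (eval; eval-congʳ)
  open Interpolation isClassicalField stable using (cancelˡ)
  open import Algebra.Definitions.RawSemiring (RawRing.rawSemiring rawRing) using (_^_)

  ι-integer : ∀ i → ιᴸ (i ℚ./ 1) ≈ fromℤ i
  ι-integer i = trans (Hom.⟦⟧-cong rational (≡.sym (fromℤ-ℚ i))) (fromℤ-homo {R = ℚₚ.+-*-commutativeRing} rational i)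

  eval-ones-at-1 : ∀ k → eval (replicate k 1#) 1# ≈ fromℤ (+ k)
  eval-ones-at-1 zero    = refl
  eval-ones-at-1 (suc k) = trans (+-congˡ (trans (*-identityˡ _) (eval-ones-at-1 k))) (sym (fromℤ-+ (+ 1) (+ k)))

  eval-ones : ∀ k x → (x - 1#) * eval (replicate k 1#) x ≈ x ^ k - 1#
  eval-ones zero    x = trans (zeroʳ _) (sym (-‿inverseʳ 1#))
  eval-ones (suc k) x = trans (solve 2 (λ x e → (x :- con (+ 1)) :* (con (+ 1) :+ x :* e) := (x :- con (+ 1)) :+ x :* ((x :- con (+ 1)) :* e)) refl x (eval (replicate k 1#) x))
    (trans (+-congˡ (*-congˡ (eval-ones k x))) (solve 2 (λ x p → (x :- con (+ 1)) :+ x :* (p :- con (+ 1)) := x :* p :- con (+ 1)) refl x (x ^ k)))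

  module _ (k : ℕ) (2≤k : 2 ≤ k) (α₄ ζ : Carrier) where
    private
      0<k = ℕₚ.≤-trans (s≤s z≤n) 2≤k
    open RootOfUnity isClassicalField characteristic-0 α₄ using (C; RootOfQuadratic)

    -- With s = (ζ - C - 8)/C the quadratic equation becomes s² = - C - 7.
    no-root : RootOfQuadratic ζ → eval (replicate k 1#) ζ ≈ 0# → ⊥
    no-root quadratic G≈0 = IsClassicalField.invertible isClassicalField C C≉0 λ (y , Cy) →
      -- The exact order `suc n` of ζ takes over from the exponent k. Only then are the powers
      -- distinct, as Parseval's identity requires, and `ζ ^ n` is the inverse of ζ.
      least (λ m → 0 < m × ζ ^ m ≈ 1#) k (0<k , ζ^k) λ { (suc n , (_ , ζ^n) , minimal) →
      ¬¬-finite-choice (λ _ → em) λ conjugate? →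
      let module Q = CyclotomicField isClassicalField stable (λ n → characteristic-0 (+ suc n) λ ()) action ζ (ζ ^ n) (suc n)
          module T = Q.Trace (s≤s z≤n) ζ^n ζ^n (λ m pos m<n e → minimal m m<n (pos , e)) conjugate?
      in T.conjugation λ conjugation →
      CubicExtension.positiveInvolution isClassicalField stable action ζ (ζ ^ n) ζ^n conjugation T.cyclotomic-proper ((ζ - g) * y) (cubic y Cy) λ I →
      Contradiction.impossible isClassicalField stable characteristic-0 action ζ (ζ ^ n) (suc n) (s≤s z≤n) ζ^n
        (trans (power-swap n (suc n)) (trans (power-cong n ζ^n) (one-power n))) ζ^n ζ≉1 I }
      where
      open import Algebra.Properties.Semiring.Exp (CommutativeRing.semiring K) using (^-assocʳ; ^-congˡ)
      g = C + fromℤ (+ 8)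
      power-cong : ∀ n {x y} → x ≈ y → x ^ n ≈ y ^ n
      power-cong n = ^-congˡ n
      one-power : ∀ n → 1# ^ n ≈ 1#
      one-power zero    = refl
      one-power (suc n) = trans (*-identityˡ _) (one-power n)
      power-swap : ∀ m n → (ζ ^ m) ^ n ≈ (ζ ^ n) ^ m
      power-swap m n = trans (^-assocʳ ζ m n) (trans (reflexive (≡.cong (ζ ^_) (ℕₚ.*-comm m n))) (sym (^-assocʳ ζ n m)))
      equal : ∀ {x y} → x - y ≈ 0# → x ≈ y
      equal {x} {y} e = trans (solve 2 (λ x y → x := (x :- y) :+ y) refl x y) (trans (+-congʳ e) (+-identityˡ y))
      ζ^k : ζ ^ k ≈ 1#
      ζ^k = equal (trans (sym (eval-ones k ζ)) (trans (*-congˡ G≈0) (zeroʳ _)))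
      ζ≉1 : ¬ ζ ≈ 1#
      ζ≉1 e = characteristic-0 (+ k) (λ { ≡.refl → contradiction 0<k λ () }) (trans (sym (eval-ones-at-1 k)) (trans (eval-congʳ (replicate k 1#) (sym e)) G≈0))
      -- At C = 0 the quadratic is (x - 8)², which leaves ζ = 8.
      C≉0 : ¬ C ≈ 0#
      C≉0 z = integer-not-rootOfUnity {R = K} characteristic-0 8 k (s≤s (s≤s z≤n)) 0<k (trans (power-cong k (sym ζ≈8)) ζ^k)
        where
        square : (ζ - fromℤ (+ 8)) * (ζ - fromℤ (+ 8)) ≈ 0#
        square = trans (solve 2 (λ z c → (z :- con (+ 8)) :* (z :- con (+ 8)) :=
            (z :* z :- con (+ 2) :* (c :+ con (+ 8)) :* z :+ (c :* c :* c :+ con (+ 8) :* (c :* c) :+ con (+ 16) :* c :+ con (+ 64))) :+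
              c :* (con (+ 2) :* z :- c :* c :- con (+ 8) :* c :- con (+ 16))) refl ζ C)
          (trans (+-cong quadratic (trans (*-congʳ z) (zeroˡ _))) (+-identityʳ 0#))
        ζ≈8 : ζ ≈ fromℤ (+ 8)
        ζ≈8 = equal (stable λ ne → ne (cancelˡ square ne))
      cubic : ∀ y → C * y ≈ 1# → let s = (ζ - g) * y in s * s * s + s * s + fromℤ (+ 7) * s + (ζ - 1#) ≈ 0#
      cubic y Cy = trans (solve 3 (λ s z c →
            s :* s :* s :+ s :* s :+ con (+ 7) :* s :+ (z :- con (+ 1)) :=
            (s :+ con (+ 1)) :* (s :* s :+ c :+ con (+ 7)) :+ ((z :- (c :+ con (+ 8))) :- c :* s)) refl s ζ C)
          (trans (+-cong (trans (*-congˡ s²) (zeroʳ _)) (trans (+-congˡ (-‿cong Cs)) (-‿inverseʳ _))) (+-identityʳ 0#))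
        where
        s = (ζ - g) * y
        Cs : C * s ≈ ζ - g
        Cs = trans (solve 3 (λ c d y → c :* (d :* y) := d :* (c :* y)) refl C (ζ - g) y) (trans (*-congˡ Cy) (*-identityʳ _))
        s² : s * s + C + fromℤ (+ 7) ≈ 0#
        s² = trans (solve 3 (λ z c y → let d = z :- (c :+ con (+ 8)) ; w = c :* y in
              (d :* y) :* (d :* y) :+ c :+ con (+ 7) :=
              (z :* z :- con (+ 2) :* (c :+ con (+ 8)) :* z :+ (c :* c :* c :+ con (+ 8) :* (c :* c) :+ con (+ 16) :* c :+ con (+ 64))) :* (y :* y) :+
                (c :+ con (+ 7)) :* ((con (+ 1) :- w) :* (con (+ 1) :+ w))) refl ζ C y)
          (trans (+-cong (trans (*-congʳ quadratic) (zeroˡ _)) (trans (*-congˡ (trans (*-congʳ (trans (+-congˡ (-‿cong Cy)) (-‿inverseʳ 1#))) (zeroˡ _))) (zeroʳ _)))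
            (+-identityʳ 0#))

  no-roots : ∀ k → 2 ≤ k → ∀ Δ̃ → IsΔ̃ (3 ℕ.* k) 3 Δ̃ → ¬ HasRoot L Δ̃
  no-roots k 2≤k Δ̃ (Δ , (Ψ , δ , cyclotomic , multiplier , resultant) , scaled) (α , root) =
    RootOfUnity.root-of-unity isClassicalField characteristic-0 α₄ k 2≤k Ψ δ Δ cyclotomic multiplier
      (≡.subst (λ m → Pℤ[c].IsResultant (map Pℤ.const (Ψ m)) δ Δ) 3k/3≡k resultant) Δ-root
      λ (ζ , quadratic , G≈0) → no-root k 2≤k α₄ ζ quadratic G≈0
    where
    open Rescaling K
    3k/3≡k : 3 ℕ.* k ℕ./ 3 ≡ k
    3k/3≡k = ≡.trans (≡.cong (ℕ._/ 3) (ℕₚ.*-comm 3 k)) (m*n/n≡m k 3)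
    -- The given root is a value of C = 4c, whereas the resultants are polynomials in c.
    α₄ = α * ιᴸ ((+ 1) ℚ./ 4)
    4α₄ : fromℤ (+ 4) * α₄ ≈ α
    4α₄ = trans (*-congʳ (sym (ι-integer (+ 4)))) (trans (solve 3 (λ f a q → f :* (a :* q) := a :* (f :* q)) refl (ιᴸ ((+ 4) ℚ./ 1)) α (ιᴸ ((+ 1) ℚ./ 4)))
      (trans (*-congˡ (trans (sym (Hom.*-homo rational ((+ 4) ℚ./ 1) ((+ 1) ℚ./ 4))) (Hom.1-homo rational))) (*-identityʳ α)))
    Δ-root : eval (map fromℤ Δ) α₄ ≈ 0#
    Δ-root = trans (eval-scaled Δ Δ̃ α₄ scaled) (trans (eval-congʳ (map fromℤ Δ̃) 4α₄) (trans (sym (coefficients Δ̃)) root))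
      where
      coefficients : ∀ p → eval (map (λ i → ιᴸ (i ℚ./ 1)) p) α ≈ eval (map fromℤ p) α
      coefficients []      = refl
      coefficients (i ∷ p) = +-cong (ι-integer i) (*-congˡ (coefficients p))

open import Data.Nat.Base using (_*_)

theorem4p3 : ∀ {c ℓ₁ ℓ₂} (k : ℕ) → 2 ≤ k →
    ∀ Δ̃ → IsΔ̃ (3 * k) 3 Δ̃ →
    (ℚᵃᵇ : Extension c ℓ₁ ℓ₂) → IsMaximalAbelian ℚᵃᵇ →
    ¬ HasRoot ℚᵃᵇ Δ̃
theorem4p3 k 2≤k Δ̃ isΔ̃ ℚᵃᵇ maximal = AbelianExtension.no-roots ℚᵃᵇ (proj₁ maximal) k 2≤k Δ̃ isΔ̃
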